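{- Let $k,t,\ell$ be positive integers. There exists $n_2 = n_2(k,t,\ell)$ such that for all $n \ge n_2$ and all integers $s$ with $0 \le s \le \binom{n-t+1}{k-t+1} - \binom{n-t-\ell+1}{k-t+1}$, the family $\mathcal{L}_{n,k}(s)$ minimizes the number of $t$-disjoint pairs among all families of $s$ sets in $\binom{[n]}{k}$.
   Context: $[n]=\{1,\dots,n\}$ and $\binom{[n]}{k}$ is the set of all $k$-element subsets of $[n]$. The lexicographical ordering on $\binom{[n]}{k}$ is defined by $A < B$ if $\min(A \,\Delta\, B) \in A$; $\mathcal{L}_{n,k}(s)$ is the family of the first $s$ sets in this ordering. Two sets $F_1,F_2$ are $t$-intersecting if $|F_1 \cap F_2| \ge t$ and $t$-disjoint otherwise. The number of $t$-disjoint pairs of a family $\mathcal{F}$ is the number of unordered pairs $\{F_1,F_2\}$ of distinct members of $\mathcal{F}$ with $|F_1\cap F_2| < t$. -}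

module Defs where

open import Data.Nat using (ℕ; zero; suc; _+_; _<?_)
open import Data.Nat.Properties using (_≟_)
open import Data.Bool using (true; false)
open import Data.Vec using (Vec; []; _∷_)
open import Data.List using (List; []; _∷_; _++_; map; filter; take; length)
open import Data.Fin.Subset using (Subset; ∣_∣; _∩_)

-- Subsets of [n] = {1,…,n} are represented as characteristic vectors
-- (Subset n = Vec Bool n); coordinate i (0-based) corresponds to element i+1,
-- and true = inside.

-- All subsets of [n] listed in lexicographic order (A < B iff min(A Δ B) ∈ A):
-- sets containing the element 1 come before those that do not, recursively.
allSubsetsLex : (n : ℕ) → List (Subset n)
allSubsetsLex zero    = [] ∷ []
allSubsetsLex (suc n) = map (true ∷_) (allSubsetsLex n) ++ map (false ∷_) (allSubsetsLex n)

kSubsetsLex : (n k : ℕ) → List (Subset n)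
kSubsetsLex n k = filter (λ A → ∣ A ∣ ≟ k) (allSubsetsLex n)

L : (n k s : ℕ) → List (Subset n)
L n k s = take s (kSubsetsLex n k)

tDisjointPairs : {n : ℕ} → (t : ℕ) → List (Subset n) → ℕ
tDisjointPairs t []      = 0
tDisjointPairs t (A ∷ F) = length (filter (λ B → ∣ A ∩ B ∣ <? t) F) + tDisjointPairs t F

module Submission where

open import Defs
open import Data.Bool as Bool using (true; false)
open import Data.Empty using (⊥-elim)
open import Data.Fin using (Fin)
open import Data.Fin.Subset using (Subset; ∣_∣; _∩_; _∪_; ∁; _⊆_; _∈_; _∉_; ⊤; ⁅_⁆) renaming (⊥ to ∅)
open import Data.Fin.Subset.Properties
open import Data.List using (List; []; _∷_; _++_; length; map; filter; take)
open import Data.List.Membership.Propositional using (find; lose) renaming (_∈_ to _∈ₗ_)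
open import Data.List.Membership.Propositional.Properties using (∈-filter⁺; ∈-map⁺; ∈-map⁻; ∈-++⁺ˡ; ∈-++⁺ʳ)
import Data.List.Membership.DecPropositional as DecMembership
open import Data.List.Properties using (filter-++; filter-≐; filter-none; filter-all; length-filter; length-map; length-++; length-take; map-++; map-∘; take-map)
open import Data.List.Relation.Unary.All as All using (All; []; _∷_)
open import Data.List.Relation.Unary.All.Properties as All using (¬All⇒Any¬)
open import Data.List.Relation.Unary.AllPairs using ([]; _∷_)
open import Data.List.Relation.Unary.Any as Any using (Any; here; there; any?)
open import Data.List.Relation.Unary.Unique.Propositional using (Unique)
import Data.List.Relation.Unary.Unique.Propositional.Properties as Unique
open import Data.Nat
open import Data.Nat.Combinatorics using (_C_; nCk+nC[k+1]≡[n+1]C[k+1]; k>n⇒nCk≡0)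
open import Data.Nat.ListAction using (sum)
open import Data.Nat.ListAction.Properties using (sum-++)
open import Data.Nat.Properties
open import Data.Nat.Tactic.RingSolver using (solve-∀)
open import Data.Product using (∃-syntax; _×_; _,_; proj₁; proj₂)
open import Data.Sum using (_⊎_; inj₁; inj₂; [_,_]′)
open import Data.Vec using (here; there) renaming ([] to []ᵥ; _∷_ to _∷ᵥ_)
open import Data.Vec.Properties using (≡-dec)
open import Function using (_∘_)
open import Relation.Binary.PropositionalEquality using (_≡_; _≢_; refl; sym; trans; cong; cong₂; subst; subst₂; module ≡-Reasoning)
open import Relation.Nullary using (Dec; yes; no; ¬_; ¬?; _×-dec_; _⊎-dec_; contradiction)
open import Relation.Unary using (Decidable)

-- Between q and q + 1 full stars the number of t-disjoint pairs of the lexicographic family is an affine function w q * s − Λ q of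
-- its size s. It therefore suffices to show D F + 2 Λ q ≥ 2 w q |F| for every family F of k-sets, where D counts ordered
-- t-disjoint pairs and |F| is no longer prescribed. Adding or removing one set at a time, we may assume that F is locally optimal.
--
-- A star is the family of k-sets containing a t-set T. A set outside q distinct stars is t-disjoint from at least w q members of
-- their union, whatever the centres are; hence a family containing q full stars may be replaced by their union. For a union of
-- stars the inequality is proved according to the position of the centres: a common (t − 1)-subset (the lexicographic case), all
-- of them inside a (t + 1)-set, or two centres meeting in fewer than t − 1 elements, when D exceeds the bound by order N * M.
--
-- If a locally optimal F contains fewer than q full stars, every incomplete star has at most θ = |F| − w q members in F while every
-- member of F meets at least θ members in t elements. Bounding the t-intersecting pairs by the sum of the squared degrees of the
-- t-sets proves the inequality unless θ is close to N, and then F is a union of q + 1 stars from which few sets are missing.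

-- The slopes `w q` grow with `q`, and `Λ` makes consecutive pieces meet at s = `B (q + 1)`. The
-- lexicographic count is thus convex and piecewise affine and each piece is a supporting line, so
-- one linear inequality for each `q` loses nothing. With the size free, local optimality compares
-- every degree with the absolute number `w q`; a fixed size would only allow exchanges of a member
-- for a non-member.
--
-- The orders of magnitude rest on N M₂ ≤ M² and on N / M = m / c: for large n, N exceeds any
-- prescribed multiple of M. The obstacle is that q stars with pairwise near centres agree with the
-- bound in order N² and also in order N M. Estimates with error O(M²) therefore settle only the
-- case of a far pair of centres; a common core or a common (t + 1)-set needs exact counts. The same
-- orders explain the end of the proof: q + 1 almost full stars that form no sunflower beat the
-- bound by N M, while restoring O(M) missing sets, each of degree at most `w q` + O(M), costs O(M²)
-- beyond the slope.

private
  variable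
    n : ℕ

-- Sums over all subsets, and counts as sums of indicators

𝟙 : {X : Set} → Dec X → ℕ
𝟙 (yes _) = 1
𝟙 (no  _) = 0

𝟙-yes : {X : Set} (X? : Dec X) → X → 𝟙 X? ≡ 1
𝟙-yes (yes _) _ = refl
𝟙-yes (no ¬x) x = contradiction x ¬x

𝟙-no : {X : Set} (X? : Dec X) → ¬ X → 𝟙 X? ≡ 0
𝟙-no (yes x) ¬x = contradiction x ¬x
𝟙-no (no _)  _  = refl

𝟙-mono : {X Y : Set} (X? : Dec X) (Y? : Dec Y) → (X → Y) → 𝟙 X? ≤ 𝟙 Y?
𝟙-mono (yes x) Y? f = ≤-reflexive (sym (𝟙-yes Y? (f x)))
𝟙-mono (no _)  Y? f = z≤n

Σs : (Subset n → ℕ) → ℕ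
Σs {zero}  f = f []ᵥ
Σs {suc n} f = Σs (f ∘ (true ∷ᵥ_)) + Σs (f ∘ (false ∷ᵥ_))

Σs-mono : {f g : Subset n → ℕ} → (∀ A → f A ≤ g A) → Σs f ≤ Σs g
Σs-mono {n = zero}  h = h []ᵥ
Σs-mono {n = suc n} h = +-mono-≤ (Σs-mono (h ∘ (true ∷ᵥ_))) (Σs-mono (h ∘ (false ∷ᵥ_)))

Σs-cong : {f g : Subset n → ℕ} → (∀ A → f A ≡ g A) → Σs f ≡ Σs g
Σs-cong h = ≤-antisym (Σs-mono (≤-reflexive ∘ h)) (Σs-mono (≤-reflexive ∘ sym ∘ h))

interchange : ∀ a b c d → (a + b) + (c + d) ≡ (a + c) + (b + d)
interchange = solve-∀

Σs-+ : (f g : Subset n → ℕ) → Σs (λ A → f A + g A) ≡ Σs f + Σs g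
Σs-+ {n = zero}  f g = refl
Σs-+ {n = suc n} f g =
  trans (cong₂ _+_ (Σs-+ (f ∘ (true ∷ᵥ_)) (g ∘ (true ∷ᵥ_))) (Σs-+ (f ∘ (false ∷ᵥ_)) (g ∘ (false ∷ᵥ_))))
        (interchange (Σs (f ∘ (true ∷ᵥ_))) _ _ _)

Σs-*ˡ : ∀ c (f : Subset n → ℕ) → Σs (λ A → c * f A) ≡ c * Σs f
Σs-*ˡ {n = zero}  c f = refl
Σs-*ˡ {n = suc n} c f =
  trans (cong₂ _+_ (Σs-*ˡ c (f ∘ (true ∷ᵥ_))) (Σs-*ˡ c (f ∘ (false ∷ᵥ_)))) (sym (*-distribˡ-+ c _ _))

Σs-swap : ∀ {m} (f : Subset n → Subset m → ℕ) → Σs (λ A → Σs (f A)) ≡ Σs (λ B → Σs (λ A → f A B))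
Σs-swap {n = zero}  f = refl
Σs-swap {n = suc n} f =
  trans (cong₂ _+_ (Σs-swap (f ∘ (true ∷ᵥ_))) (Σs-swap (f ∘ (false ∷ᵥ_))))
        (sym (Σs-+ (λ B → Σs (λ A → f (true ∷ᵥ A) B)) (λ B → Σs (λ A → f (false ∷ᵥ A) B))))

term≤Σs : (f : Subset n → ℕ) → ∀ A → f A ≤ Σs f
term≤Σs f []ᵥ          = ≤-refl
term≤Σs f (true  ∷ᵥ A) = ≤-trans (term≤Σs (f ∘ (true ∷ᵥ_)) A) (m≤m+n _ _)
term≤Σs f (false ∷ᵥ A) = ≤-trans (term≤Σs (f ∘ (false ∷ᵥ_)) A) (m≤n+m _ _)

Σs-exists : (f : Subset n → ℕ) → 0 < Σs f → ∃[ A ] 0 < f A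
Σs-exists {n = zero}  f h = []ᵥ , h
Σs-exists {n = suc n} f h with Σs (f ∘ (true ∷ᵥ_)) in eq
... | suc _ = let A , p = Σs-exists (f ∘ (true ∷ᵥ_)) (subst (0 <_) (sym eq) z<s) in true ∷ᵥ A , p
... | zero  = let A , p = Σs-exists (f ∘ (false ∷ᵥ_)) h in false ∷ᵥ A , p

# : {P : Subset n → Set} → Decidable P → ℕ
# P? = Σs (λ A → 𝟙 (P? A))

_∧?_ : {P Q : Subset n → Set} → Decidable P → Decidable Q → Decidable (λ A → P A × Q A)
(P? ∧? Q?) A = P? A ×-dec Q? A

_∖?_ : {P Q : Subset n → Set} → Decidable P → Decidable Q → Decidable (λ A → P A × ¬ Q A)
(P? ∖? Q?) A = P? A ×-dec ¬? (Q? A)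

infixr 6 _∧?_ _∖?_

module _ {P : Subset n → Set} (P? : Decidable P) where

  #-mono : {Q : Subset n → Set} (Q? : Decidable Q) → (∀ A → P A → Q A) → # P? ≤ # Q?
  #-mono Q? h = Σs-mono (λ A → 𝟙-mono (P? A) (Q? A) (h A))

  #-union : {Q R : Subset n → Set} (Q? : Decidable Q) (R? : Decidable R) →
            (∀ A → P A → Q A ⊎ R A) → # P? ≤ # Q? + # R?
  #-union Q? R? h = ≤-trans (Σs-mono go) (≤-reflexive (Σs-+ (λ A → 𝟙 (Q? A)) (λ A → 𝟙 (R? A))))
    where
    go : ∀ A → 𝟙 (P? A) ≤ 𝟙 (Q? A) + 𝟙 (R? A)
    go A with P? A
    ... | no _ = z≤n
    ... | yes p with h A p
    ...   | inj₁ q = ≤-trans (≤-reflexive (sym (𝟙-yes (Q? A) q))) (m≤m+n _ _)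
    ...   | inj₂ r = ≤-trans (≤-reflexive (sym (𝟙-yes (R? A) r))) (m≤n+m _ _)

  #-disjoint : {Q R : Subset n → Set} (Q? : Decidable Q) (R? : Decidable R) →
               (∀ A → Q A → P A) → (∀ A → R A → P A) → (∀ A → Q A → ¬ R A) → # Q? + # R? ≤ # P?
  #-disjoint Q? R? f g h = ≤-trans (≤-reflexive (sym (Σs-+ (λ A → 𝟙 (Q? A)) (λ A → 𝟙 (R? A))))) (Σs-mono go)
    where
    go : ∀ A → 𝟙 (Q? A) + 𝟙 (R? A) ≤ 𝟙 (P? A)
    go A with Q? A
    ... | yes q rewrite 𝟙-no (R? A) (h A q) = ≤-reflexive (sym (𝟙-yes (P? A) (f A q)))
    ... | no _  = 𝟙-mono (R? A) (P? A) (g A)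

  #-split : {Q : Subset n → Set} (Q? : Decidable Q) → # P? ≡ # (P? ∧? Q?) + # (P? ∖? Q?)
  #-split {Q} Q? = ≤-antisym (#-union (P? ∧? Q?) (P? ∖? Q?) go)
      (#-disjoint (P? ∧? Q?) (P? ∖? Q?) (λ _ → proj₁) (λ _ → proj₁) (λ _ a b → proj₂ b (proj₂ a)))
    where
    go : ∀ A → P A → (P A × Q A) ⊎ (P A × ¬ Q A)
    go A p with Q? A
    ... | yes q = inj₁ (p , q)
    ... | no ¬q = inj₂ (p , ¬q)

  abstract

    #-exists : 0 < # P? → ∃[ A ] P A
    #-exists h with Σs-exists (λ A → 𝟙 (P? A)) h
    ... | A , pos with P? A
    ...   | yes p = A , p
    ...   | no  _ = contradiction pos (λ ())

  #-positive : ∀ {A} → P A → 0 < # P?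
  #-positive {A} p = ≤-trans (≤-reflexive (sym (𝟙-yes (P? A) p))) (term≤Σs (λ A → 𝟙 (P? A)) A)

  #-empty : (∀ A → ¬ P A) → # P? ≡ 0
  #-empty h with # P? in eq
  ... | zero  = refl
  ... | suc _ = let A , p = #-exists (subst (0 <_) (sym eq) z<s) in contradiction p (h A)

module _ {P Q : Subset n → Set} (P? : Decidable P) (Q? : Decidable Q) where

  #-cong : (∀ A → P A → Q A) → (∀ A → Q A → P A) → # P? ≡ # Q?
  #-cong f g = ≤-antisym (#-mono P? Q? f) (#-mono Q? P? g)

  abstract

    #-exists-∖ : # Q? < # P? → ∃[ A ] (P A × ¬ Q A)
    #-exists-∖ h = #-exists (P? ∖? Q?) (+-cancelˡ-< (# Q?) 0 _ (begin-strict
      # Q? + 0                       ≡⟨ +-identityʳ _ ⟩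
      # Q?                           <⟨ h ⟩
      # P?                           ≡⟨ #-split P? Q? ⟩
      # (P? ∧? Q?) + # (P? ∖? Q?)    ≤⟨ +-monoˡ-≤ _ (#-mono (P? ∧? Q?) Q? (λ _ → proj₂)) ⟩
      # Q? + # (P? ∖? Q?)            ∎))
      where open ≤-Reasoning

  #-⊇ : (∀ A → P A → Q A) → # Q? ≤ # P? → ∀ A → Q A → P A
  #-⊇ f h A q with P? A
  ... | yes p = p
  ... | no ¬p = contradiction (#-positive (Q? ∖? P?) (q , ¬p)) (≤⇒≯ (+-cancelˡ-≤ (# P?) _ 0 (begin
      # P? + # (Q? ∖? P?)         ≤⟨ #-disjoint Q? P? (Q? ∖? P?) f (λ _ → proj₁) (λ _ p r → proj₂ r p) ⟩
      # Q?                        ≤⟨ h ⟩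
      # P?                        ≡⟨ sym (+-identityʳ _) ⟩
      # P? + 0                    ∎)))
    where open ≤-Reasoning

Rel₂ : ℕ → Set₁
Rel₂ n = Subset n → Subset n → Set

Decidable₂ : ∀ {n} → Rel₂ n → Set
Decidable₂ R = ∀ A B → Dec (R A B)

## : {R : Rel₂ n} → Decidable₂ R → ℕ
## R? = Σs (λ A → # (R? A))

##-mono : {R S : Rel₂ n} (R? : Decidable₂ R) (S? : Decidable₂ S) → (∀ A B → R A B → S A B) → ## R? ≤ ## S?
##-mono R? S? h = Σs-mono (λ A → #-mono (R? A) (S? A) (h A))

##-union : {R S T : Rel₂ n} (R? : Decidable₂ R) (S? : Decidable₂ S) (T? : Decidable₂ T) →
           (∀ A B → R A B → S A B ⊎ T A B) → ## R? ≤ ## S? + ## T?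
##-union R? S? T? h = ≤-trans (Σs-mono (λ A → #-union (R? A) (S? A) (T? A) (h A)))
                              (≤-reflexive (Σs-+ (λ A → # (S? A)) (λ A → # (T? A))))

##-disjoint : {R S T : Rel₂ n} (R? : Decidable₂ R) (S? : Decidable₂ S) (T? : Decidable₂ T) →
              (∀ A B → S A B → R A B) → (∀ A B → T A B → R A B) → (∀ A B → S A B → ¬ T A B) →
              ## S? + ## T? ≤ ## R?
##-disjoint R? S? T? f g h = ≤-trans (≤-reflexive (sym (Σs-+ (λ A → # (S? A)) (λ A → # (T? A)))))
                                     (Σs-mono (λ A → #-disjoint (R? A) (S? A) (T? A) (f A) (g A) (h A)))

##-swap : {R : Rel₂ n} (R? : Decidable₂ R) → ## R? ≡ ## (λ B A → R? A B)
##-swap R? = Σs-swap (λ A B → 𝟙 (R? A B))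

Σs-≤-const : {P : Subset n → Set} (P? : Decidable P) (f : Subset n → ℕ) (c : ℕ) →
             (∀ A → P A → f A ≤ c) → (∀ A → ¬ P A → f A ≡ 0) → Σs f ≤ # P? * c
Σs-≤-const P? f c h h₀ = ≤-trans (Σs-mono go) (≤-reflexive (trans (Σs-*ˡ c (λ A → 𝟙 (P? A))) (*-comm c _)))
  where
  go : ∀ A → f A ≤ c * 𝟙 (P? A)
  go A with P? A
  ... | yes p = ≤-trans (h A p) (≤-reflexive (sym (*-identityʳ c)))
  ... | no ¬p = ≤-reflexive (trans (h₀ A ¬p) (sym (*-zeroʳ c)))

Σs-≥-const : {P : Subset n → Set} (P? : Decidable P) (f : Subset n → ℕ) (c : ℕ) →
             (∀ A → P A → c ≤ f A) → # P? * c ≤ Σs f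
Σs-≥-const P? f c h = ≤-trans (≤-reflexive (sym (trans (Σs-*ˡ c (λ A → 𝟙 (P? A))) (*-comm c _)))) (Σs-mono go)
  where
  go : ∀ A → c * 𝟙 (P? A) ≤ f A
  go A with P? A
  ... | yes p = ≤-trans (≤-reflexive (*-identityʳ c)) (h A p)
  ... | no ¬p = ≤-trans (≤-reflexive (*-zeroʳ c)) z≤n

##-≤ : {P : Subset n → Set} {R : Rel₂ n} (P? : Decidable P) (R? : Decidable₂ R) (c : ℕ) →
       (∀ A → P A → # (R? A) ≤ c) → (∀ A B → R A B → P A) → ## R? ≤ # P? * c
##-≤ P? R? c h k = Σs-≤-const P? (λ A → # (R? A)) c h (λ A ¬p → #-empty (R? A) (λ B r → ¬p (k A B r)))

##-≥ : {P : Subset n → Set} {R : Rel₂ n} (P? : Decidable P) (R? : Decidable₂ R) (c : ℕ) →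
       (∀ A → P A → c ≤ # (R? A)) → # P? * c ≤ ## R?
##-≥ P? R? c h = Σs-≥-const P? (λ A → # (R? A)) c h

module _ {J : Rel₂ n} (J? : Decidable₂ J) where

  pairs : {P Q : Subset n → Set} → Decidable P → Decidable Q → ℕ
  pairs P? Q? = ## (λ A B → P? A ×-dec Q? B ×-dec J? A B)

  pairs-sym : {P Q : Subset n → Set} (P? : Decidable P) (Q? : Decidable Q) →
              (∀ A B → J A B → J B A) → pairs P? Q? ≤ pairs Q? P?
  pairs-sym P? Q? s = ≤-trans (≤-reflexive (##-swap (λ A B → P? A ×-dec Q? B ×-dec J? A B)))
    (##-mono (λ B A → P? A ×-dec Q? B ×-dec J? A B) (λ A B → Q? A ×-dec P? B ×-dec J? A B)
             (λ _ _ (p , q , j) → q , p , s _ _ j))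

  pairs-≤ : {P Q : Subset n → Set} (P? : Decidable P) (Q? : Decidable Q) (c : ℕ) →
            (∀ A → P A → # (Q? ∧? J? A) ≤ c) → pairs P? Q? ≤ # P? * c
  pairs-≤ P? Q? c h = ##-≤ P? (λ A B → P? A ×-dec Q? B ×-dec J? A B) c
    (λ A p → ≤-trans (#-mono (λ B → P? A ×-dec Q? B ×-dec J? A B) (Q? ∧? J? A) (λ _ → proj₂)) (h A p))
    (λ _ _ → proj₁)

  pairs-≥ : {P Q : Subset n → Set} (P? : Decidable P) (Q? : Decidable Q) (c : ℕ) →
            (∀ A → P A → c ≤ # (Q? ∧? J? A)) → # P? * c ≤ pairs P? Q?
  pairs-≥ P? Q? c h = ##-≥ P? (λ A B → P? A ×-dec Q? B ×-dec J? A B) c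
    (λ A p → ≤-trans (h A p) (#-mono (Q? ∧? J? A) (λ B → P? A ×-dec Q? B ×-dec J? A B) (λ _ → p ,_)))

  -- The two mixed blocks have equal size because `J` is symmetric, hence the coefficient 2. The
  -- upper estimate rests on `P` and `Q` covering `F`, the lower one on their being disjoint parts
  -- of it.
  pairs-square-≤ : {F P Q : Subset n → Set} (F? : Decidable F) (P? : Decidable P) (Q? : Decidable Q) →
                   (∀ A B → J A B → J B A) → (∀ A → F A → P A ⊎ Q A) →
                   pairs F? F? ≤ pairs P? P? + 2 * pairs Q? P? + pairs Q? Q?
  pairs-square-≤ {F} {P} {Q} F? P? Q? s h = ≤-trans (##-union FF (λ A B → PP A B ⊎-dec QP A B) (λ A B → PQ A B ⊎-dec QQ A B) go)
    (≤-trans (+-mono-≤ (##-union (λ A B → PP A B ⊎-dec QP A B) PP QP (λ _ _ z → z))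
                       (##-union (λ A B → PQ A B ⊎-dec QQ A B) PQ QQ (λ _ _ z → z)))
    (≤-trans (+-monoʳ-≤ (## PP + ## QP) (+-monoˡ-≤ (## QQ) (pairs-sym P? Q? s))) (≤-reflexive (eq (## PP) (## QP) (## QQ)))))
    where
    FF = λ A B → F? A ×-dec F? B ×-dec J? A B
    PP = λ A B → P? A ×-dec P? B ×-dec J? A B
    QP = λ A B → Q? A ×-dec P? B ×-dec J? A B
    PQ = λ A B → P? A ×-dec Q? B ×-dec J? A B
    QQ = λ A B → Q? A ×-dec Q? B ×-dec J? A B
    eq : ∀ a b c → (a + b) + (b + c) ≡ a + 2 * b + c
    eq = solve-∀
    go : ∀ A B → F A × F B × J A B → ((P A × P B × J A B) ⊎ (Q A × P B × J A B)) ⊎ ((P A × Q B × J A B) ⊎ (Q A × Q B × J A B))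
    go A B (a , b , j) with h A a | h B b
    ... | inj₁ p | inj₁ p′ = inj₁ (inj₁ (p , p′ , j))
    ... | inj₂ q | inj₁ p′ = inj₁ (inj₂ (q , p′ , j))
    ... | inj₁ p | inj₂ q′ = inj₂ (inj₁ (p , q′ , j))
    ... | inj₂ q | inj₂ q′ = inj₂ (inj₂ (q , q′ , j))

  pairs-square-≥ : {F P Q : Subset n → Set} (F? : Decidable F) (P? : Decidable P) (Q? : Decidable Q) →
                   (∀ A B → J A B → J B A) → (∀ A → P A → F A) → (∀ A → Q A → F A) → (∀ A → P A → ¬ Q A) →
                   pairs P? P? + 2 * pairs Q? P? + pairs Q? Q? ≤ pairs F? F?
  pairs-square-≥ {F} {P} {Q} F? P? Q? s f g h =
    ≤-trans (≤-reflexive (sym (eq (## PP) (## QP) (## QQ))))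
    (≤-trans (+-monoʳ-≤ (## PP + ## QP) (+-monoˡ-≤ (## QQ) (pairs-sym Q? P? s)))
    (≤-trans (+-mono-≤ (##-disjoint (λ A B → PP A B ⊎-dec QP A B) PP QP (λ _ _ → inj₁) (λ _ _ → inj₂)
                                    (λ A _ (p , _) (q , _) → h A p q))
                       (##-disjoint (λ A B → PQ A B ⊎-dec QQ A B) PQ QQ (λ _ _ → inj₁) (λ _ _ → inj₂)
                                    (λ A _ (p , _) (q , _) → h A p q)))
             (##-disjoint FF (λ A B → PP A B ⊎-dec QP A B) (λ A B → PQ A B ⊎-dec QQ A B) into₁ into₂ apart)))
    where
    FF = λ A B → F? A ×-dec F? B ×-dec J? A B
    PP = λ A B → P? A ×-dec P? B ×-dec J? A B
    QP = λ A B → Q? A ×-dec P? B ×-dec J? A B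
    PQ = λ A B → P? A ×-dec Q? B ×-dec J? A B
    QQ = λ A B → Q? A ×-dec Q? B ×-dec J? A B
    eq : ∀ a b c → (a + b) + (b + c) ≡ a + 2 * b + c
    eq = solve-∀
    into₁ : ∀ A B → (P A × P B × J A B) ⊎ (Q A × P B × J A B) → F A × F B × J A B
    into₁ _ _ (inj₁ (p , p′ , j)) = f _ p , f _ p′ , j
    into₁ _ _ (inj₂ (q , p′ , j)) = g _ q , f _ p′ , j
    into₂ : ∀ A B → (P A × Q B × J A B) ⊎ (Q A × Q B × J A B) → F A × F B × J A B
    into₂ _ _ (inj₁ (p , q′ , j)) = f _ p , g _ q′ , j
    into₂ _ _ (inj₂ (q , q′ , j)) = g _ q , g _ q′ , j
    apart : ∀ A B → (P A × P B × J A B) ⊎ (Q A × P B × J A B) → ¬ ((P A × Q B × J A B) ⊎ (Q A × Q B × J A B))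
    apart _ B (inj₁ (_ , p , _)) (inj₁ (_ , q , _)) = h B p q
    apart _ B (inj₁ (_ , p , _)) (inj₂ (_ , q , _)) = h B p q
    apart _ B (inj₂ (_ , p , _)) (inj₁ (_ , q , _)) = h B p q
    apart _ B (inj₂ (_ , p , _)) (inj₂ (_ , q , _)) = h B p q

-- Binomial coefficients: absorption, convexity and log-concavity

bin : ℕ → ℕ → ℕ
bin _       zero    = 1
bin zero    (suc _) = 0
bin (suc x) (suc c) = bin x c + bin x (suc c)

-- bin⁻ x c is the binomial coefficient "x choose c − 1", zero for c = 0.
bin⁻ : ℕ → ℕ → ℕ
bin⁻ x zero    = 0
bin⁻ x (suc c) = bin x c

bin≡C : ∀ x c → bin x c ≡ x C c
bin≡C x       zero    = refl
bin≡C zero    (suc c) = sym (k>n⇒nCk≡0 {0} {suc c} z<s)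
bin≡C (suc x) (suc c) = trans (cong₂ _+_ (bin≡C x c) (bin≡C x (suc c))) (nCk+nC[k+1]≡[n+1]C[k+1] x c)

bin-suc : ∀ x c → bin (suc x) c ≡ bin⁻ x c + bin x c
bin-suc x zero    = refl
bin-suc x (suc c) = refl

bin-mono : ∀ {x y} c → x ≤ y → bin x c ≤ bin y c
bin-mono zero    _         = ≤-refl
bin-mono (suc c) z≤n       = z≤n
bin-mono (suc c) (s≤s x≤y) = +-mono-≤ (bin-mono c x≤y) (bin-mono (suc c) x≤y)

bin⁻-mono : ∀ {x y} c → x ≤ y → bin⁻ x c ≤ bin⁻ y c
bin⁻-mono zero    _   = z≤n
bin⁻-mono (suc c) x≤y = bin-mono c x≤y

bin-pos : ∀ {x c} → c ≤ x → 0 < bin x c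
bin-pos z≤n       = z<s
bin-pos (s≤s c≤x) = ≤-trans (bin-pos c≤x) (m≤m+n _ _)

bin-≥ : ∀ m t → suc m ≤ bin (suc t + m) (suc t)
bin-≥ m zero    = ≤-reflexive (go m)
  where
  go : ∀ m → suc m ≡ bin (suc m) 1
  go zero    = refl
  go (suc m) = cong suc (go m)
bin-≥ m (suc t) = ≤-trans (bin-≥ m t) (m≤m+n _ _)

-- Absorption (c + 1) C(x, c + 1) = (x - c) C(x, c), with the subtracted term moved to the left so
-- that the identity holds in ℕ for x < c as well.
bin-absorb : ∀ x c → suc c * bin x (suc c) + c * bin x c ≡ x * bin x c
bin-absorb zero    zero    = refl
bin-absorb zero    (suc c) = cong₂ _+_ (*-zeroʳ (suc (suc c))) (*-zeroʳ (suc c))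
bin-absorb (suc x) zero    = cong suc (bin-absorb x zero)
bin-absorb (suc x) (suc c) = begin
  suc (suc c) * (bin x (suc c) + bin x (suc (suc c))) + suc c * (bin x c + bin x (suc c))
    ≡⟨ eq₁ c (bin x c) (bin x (suc c)) (bin x (suc (suc c))) ⟩
  (suc (suc c) * bin x (suc (suc c)) + suc c * bin x (suc c)) + ((suc c * bin x (suc c) + c * bin x c) + bin x c + bin x (suc c))
    ≡⟨ cong₂ (λ u v → u + (v + bin x c + bin x (suc c))) (bin-absorb x (suc c)) (bin-absorb x c) ⟩
  x * bin x (suc c) + (x * bin x c + bin x c + bin x (suc c))
    ≡⟨ eq₂ x (bin x c) (bin x (suc c)) ⟩
  suc x * (bin x c + bin x (suc c)) ∎
  where
  open ≡-Reasoning
  eq₁ : ∀ c u v w → suc (suc c) * (v + w) + suc c * (u + v) ≡ (suc (suc c) * w + suc c * v) + ((suc c * v + c * u) + u + v)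
  eq₁ = solve-∀
  eq₂ : ∀ x u v → x * v + (x * u + u + v) ≡ suc x * (u + v)
  eq₂ = solve-∀

bin-absorb-suc : ∀ x c → suc c * bin (suc x) (suc c) ≡ suc x * bin x c
bin-absorb-suc x c = trans (eq c (bin x c) (bin x (suc c))) (cong (bin x c +_) (bin-absorb x c))
  where
  eq : ∀ c u v → suc c * (u + v) ≡ u + (suc c * v + c * u)
  eq = solve-∀

-- Lowering the upper index by one costs a binomial coefficient that is largest at the first step,
-- so `a` steps cost at most `a` times that value. Truncated subtraction keeps this true when `a`
-- exceeds `m`.
bin-upper : ∀ m a c → bin m c ≤ bin (m ∸ a) c + a * bin⁻ (m ∸ 1) c
bin-upper m zero    c = ≤-reflexive (sym (+-identityʳ _))
bin-upper m (suc a) c = begin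
  bin m c                                                  ≤⟨ bin-upper m a c ⟩
  bin (m ∸ a) c + a * bin⁻ (m ∸ 1) c                       ≤⟨ +-monoˡ-≤ _ (step (m ∸ a) (m∸n≤m m a)) ⟩
  bin (m ∸ a ∸ 1) c + bin⁻ (m ∸ 1) c + a * bin⁻ (m ∸ 1) c  ≡⟨ cong (λ z → bin z c + bin⁻ (m ∸ 1) c + a * bin⁻ (m ∸ 1) c)
      (trans (∸-+-assoc m a 1) (cong (m ∸_) (+-comm a 1))) ⟩
  bin (m ∸ suc a) c + bin⁻ (m ∸ 1) c + a * bin⁻ (m ∸ 1) c  ≡⟨ +-assoc (bin (m ∸ suc a) c) _ _ ⟩
  bin (m ∸ suc a) c + suc a * bin⁻ (m ∸ 1) c               ∎
  where
  open ≤-Reasoning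
  step : ∀ z → z ≤ m → bin z c ≤ bin (z ∸ 1) c + bin⁻ (m ∸ 1) c
  step zero    _   = m≤m+n _ _
  step (suc z) z<m = begin
    bin (suc z) c               ≡⟨ bin-suc z c ⟩
    bin⁻ z c + bin z c          ≤⟨ +-monoˡ-≤ _ (bin⁻-mono c (∸-monoˡ-≤ 1 z<m)) ⟩
    bin⁻ (m ∸ 1) c + bin z c    ≡⟨ +-comm _ (bin z c) ⟩
    bin z c + bin⁻ (m ∸ 1) c    ∎

-- The increments of `bin _ c` grow, so `a` steps gain at least `a` times the first one. Together
-- with `bin-upper` this is convexity used from both ends.
bin-lower : ∀ x a c → bin x c + a * bin⁻ x c ≤ bin (a + x) c
bin-lower x zero    c = ≤-reflexive (+-identityʳ _)
bin-lower x (suc a) c = begin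
  bin x c + (bin⁻ x c + a * bin⁻ x c)  ≡⟨ eq (bin x c) (bin⁻ x c) (a * bin⁻ x c) ⟩
  bin⁻ x c + (bin x c + a * bin⁻ x c)  ≤⟨ +-mono-≤ (bin⁻-mono c (m≤n+m x a)) (bin-lower x a c) ⟩
  bin⁻ (a + x) c + bin (a + x) c       ≡⟨ sym (bin-suc (a + x) c) ⟩
  bin (suc a + x) c                    ∎
  where
  open ≤-Reasoning
  eq : ∀ u v w → u + (v + w) ≡ v + (u + w)
  eq = solve-∀

-- The growth factor from y to y + 1 is (y + 1) / (y + 1 - c), which decreases in y. Pascal's rule
-- splits off a common product, and absorption turns what remains into x ≤ y.
bin-ratio-step : ∀ x y c → x ≤ y → bin (suc y) c * bin x c ≤ bin (suc x) c * bin y c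
bin-ratio-step x y zero    x≤y = ≤-refl
bin-ratio-step x y (suc c) x≤y = begin
  (bin y c + bin y (suc c)) * bin x (suc c)                  ≡⟨ *-distribʳ-+ (bin x (suc c)) (bin y c) _ ⟩
  bin y c * bin x (suc c) + bin y (suc c) * bin x (suc c)    ≤⟨ +-mono-≤ (*-cancelˡ-≤ (suc c) core)
      (≤-reflexive (*-comm (bin y (suc c)) _)) ⟩
  bin x c * bin y (suc c) + bin x (suc c) * bin y (suc c)    ≡⟨ sym (*-distribʳ-+ (bin y (suc c)) (bin x c) _) ⟩
  (bin x c + bin x (suc c)) * bin y (suc c)                  ∎
  where
  open ≤-Reasoning
  eq₁ : ∀ c a b d → suc c * (a * b) + c * (a * d) ≡ a * (suc c * b + c * d)
  eq₁ = solve-∀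
  eq₂ : ∀ a b d → a * (b * d) ≡ b * (d * a)
  eq₂ = solve-∀
  eq₃ : ∀ c a b d → d * (suc c * b + c * a) ≡ suc c * (d * b) + c * (a * d)
  eq₃ = solve-∀
  core : suc c * (bin y c * bin x (suc c)) ≤ suc c * (bin x c * bin y (suc c))
  core = +-cancelʳ-≤ (c * (bin y c * bin x c)) _ _ (begin
    suc c * (bin y c * bin x (suc c)) + c * (bin y c * bin x c)  ≡⟨ eq₁ c (bin y c) (bin x (suc c)) (bin x c) ⟩
    bin y c * (suc c * bin x (suc c) + c * bin x c)              ≡⟨ cong (bin y c *_) (bin-absorb x c) ⟩
    bin y c * (x * bin x c)                                      ≡⟨ eq₂ (bin y c) x (bin x c) ⟩
    x * (bin x c * bin y c)                                      ≤⟨ *-monoˡ-≤ _ x≤y ⟩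
    y * (bin x c * bin y c)                                      ≡⟨ sym
        (eq₂ (bin x c) y (bin y c) ∙ cong (y *_) (*-comm (bin y c) (bin x c))) ⟩
    bin x c * (y * bin y c)                                      ≡⟨ cong (bin x c *_) (sym (bin-absorb y c)) ⟩
    bin x c * (suc c * bin y (suc c) + c * bin y c)              ≡⟨ eq₃ c (bin y c) (bin y (suc c)) (bin x c) ⟩
    suc c * (bin x c * bin y (suc c)) + c * (bin y c * bin x c)  ∎)
    where
    _∙_ = trans

bin-ratio : ∀ x y i c → x ≤ y → bin (i + y) c * bin x c ≤ bin (i + x) c * bin y c
bin-ratio x y zero    c x≤y = ≤-reflexive (*-comm (bin y c) (bin x c))
bin-ratio x y (suc i) c x≤y with c ≤? x
... | no c≰x = ≤-trans (≤-reflexive (trans (cong (bin (suc i + y) c *_) (vanish x c (≰⇒> c≰x))) (*-zeroʳ (bin (suc i + y) c)))) z≤n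
  where
  vanish : ∀ x c → x < c → bin x c ≡ 0
  vanish zero    (suc c) _         = refl
  vanish (suc x) (suc c) (s≤s x<c) = cong₂ _+_ (vanish x c x<c) (vanish x (suc c) (m≤n⇒m≤1+n x<c))
-- The one-step ratio is multiplied by the inductive inequality; the common factors are positive
-- because c ≤ x and can be cancelled.
... | yes c≤x = *-cancelʳ-≤ _ _ (bin (i + x) c * bin (i + y) c) ⦃ >-nonZero
    (*-mono-≤ (bin-pos (≤-trans c≤x (m≤n+m x i))) (bin-pos (≤-trans c≤x (≤-trans x≤y (m≤n+m y i))))) ⦄ (begin
  bin (suc i + y) c * bin x c * (bin (i + x) c * bin (i + y) c)
    ≡⟨ eq (bin (suc i + y) c) (bin x c) (bin (i + x) c) (bin (i + y) c) ⟩
  (bin (suc i + y) c * bin (i + x) c) * (bin (i + y) c * bin x c)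
    ≤⟨ *-mono-≤ (bin-ratio-step (i + x) (i + y) c (+-monoʳ-≤ i x≤y)) (bin-ratio x y i c x≤y) ⟩
  (bin (suc i + x) c * bin (i + y) c) * (bin (i + x) c * bin y c)
    ≡⟨ eq′ (bin (suc i + x) c) (bin (i + y) c) (bin (i + x) c) (bin y c) ⟩
  bin (suc i + x) c * bin y c * (bin (i + x) c * bin (i + y) c) ∎)
  where
  open ≤-Reasoning
  eq : ∀ a b d e → a * b * (d * e) ≡ (a * d) * (e * b)
  eq = solve-∀
  eq′ : ∀ a b d e → (a * b) * (d * e) ≡ a * e * (d * b)
  eq′ = solve-∀

-- tel q x c = bin (x − 1) c + … + bin (x − q) c, which telescopes to bin x (c + 1) − bin (x − q) (c + 1).
tel : ℕ → ℕ → ℕ → ℕ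
tel zero    x c = 0
tel (suc q) x c = tel q x c + bin (x ∸ suc q) c

tel-sum : ∀ q x c → q ≤ x → tel q x c + bin (x ∸ q) (suc c) ≡ bin x (suc c)
tel-sum zero    x c _   = refl
tel-sum (suc q) x c q<x = trans (+-assoc (tel q x c) _ _)
  (trans (cong (λ z → tel q x c + bin z (suc c)) (sym (+-∸-assoc 1 q<x))) (tel-sum q x c (<⇒≤ q<x)))

-- Peels off the largest term instead of the smallest: the recursion of the lexicographic order
-- removes its first star, that of `tel` the last.
tel-shift : ∀ q x c → tel (suc q) (suc x) c ≡ bin x c + tel q x c
tel-shift zero    x c = sym (+-identityʳ _)
tel-shift (suc q) x c = trans (cong (_+ bin (x ∸ suc q) c) (tel-shift q x c)) (+-assoc (bin x c) _ _)

tel-≤ : ∀ q x c → tel q x c ≤ q * bin (x ∸ 1) c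
tel-≤ zero    x c = z≤n
tel-≤ (suc q) x c = ≤-trans (+-mono-≤ (tel-≤ q x c) (bin-mono c (∸-monoʳ-≤ x (s≤s z≤n))))
    (≤-reflexive (+-comm (q * bin (x ∸ 1) c) _))

-- Cardinalities in the Boolean lattice

∣p∣≡∣p∩q∣+∣p∩∁q∣ : (p q : Subset n) → ∣ p ∣ ≡ ∣ p ∩ q ∣ + ∣ p ∩ ∁ q ∣
∣p∣≡∣p∩q∣+∣p∩∁q∣ []ᵥ          []ᵥ          = refl
∣p∣≡∣p∩q∣+∣p∩∁q∣ (false ∷ᵥ p) (_ ∷ᵥ q)     = ∣p∣≡∣p∩q∣+∣p∩∁q∣ p q
∣p∣≡∣p∩q∣+∣p∩∁q∣ (true ∷ᵥ p)  (true ∷ᵥ q)  = cong suc (∣p∣≡∣p∩q∣+∣p∩∁q∣ p q)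
∣p∣≡∣p∩q∣+∣p∩∁q∣ (true ∷ᵥ p)  (false ∷ᵥ q) = trans (cong suc (∣p∣≡∣p∩q∣+∣p∩∁q∣ p q)) (sym (+-suc _ _))

∣p∪q∣+∣p∩q∣≡∣p∣+∣q∣ : (p q : Subset n) → ∣ p ∪ q ∣ + ∣ p ∩ q ∣ ≡ ∣ p ∣ + ∣ q ∣
∣p∪q∣+∣p∩q∣≡∣p∣+∣q∣ []ᵥ          []ᵥ          = refl
∣p∪q∣+∣p∩q∣≡∣p∣+∣q∣ (false ∷ᵥ p) (false ∷ᵥ q) = ∣p∪q∣+∣p∩q∣≡∣p∣+∣q∣ p q
∣p∪q∣+∣p∩q∣≡∣p∣+∣q∣ (false ∷ᵥ p) (true ∷ᵥ q)  = trans (cong suc (∣p∪q∣+∣p∩q∣≡∣p∣+∣q∣ p q)) (sym (+-suc _ _))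
∣p∪q∣+∣p∩q∣≡∣p∣+∣q∣ (true ∷ᵥ p)  (false ∷ᵥ q) = cong suc (∣p∪q∣+∣p∩q∣≡∣p∣+∣q∣ p q)
∣p∪q∣+∣p∩q∣≡∣p∣+∣q∣ (true ∷ᵥ p)  (true ∷ᵥ q)  = cong suc
    (trans (+-suc _ _) (trans (cong suc (∣p∪q∣+∣p∩q∣≡∣p∣+∣q∣ p q)) (sym (+-suc _ _))))

∣p∪q∣≤∣p∣+∣q∣ : (p q : Subset n) → ∣ p ∪ q ∣ ≤ ∣ p ∣ + ∣ q ∣
∣p∪q∣≤∣p∣+∣q∣ p q = ≤-trans (m≤m+n _ _) (≤-reflexive (∣p∪q∣+∣p∩q∣≡∣p∣+∣q∣ p q))

abstract

  ⊈⇒∃ : {p q : Subset n} → ¬ p ⊆ q → ∃[ x ] (x ∈ p × x ∉ q)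
  ⊈⇒∃ {p = p} {q} p⊈q with nonempty? (p ∩ ∁ q)
  ... | yes (x , x∈) = let a , b = x∈p∩q⁻ p (∁ q) x∈ in x , a , x∈∁p⇒x∉p b
  ... | no empty = ⊥-elim (p⊈q λ {x} x∈p → x∉∁p⇒x∈p λ x∈∁q → empty (x , x∈p∩q⁺ (x∈p , x∈∁q)))

⊆∧∣∣≥⇒≡ : {p q : Subset n} → p ⊆ q → ∣ q ∣ ≤ ∣ p ∣ → p ≡ q
⊆∧∣∣≥⇒≡ {p = p} {q} p⊆q h with q ⊆? p
... | yes q⊆p = ⊆-antisym p⊆q q⊆p
... | no q⊈p = ⊥-elim (<⇒≱ (p⊂q⇒∣p∣<∣q∣ (p⊆q , ⊈⇒∃ q⊈p)) h)

Between : ℕ → Subset n → Subset n → Subset n → Set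
Between k Z Y A = ∣ A ∣ ≡ k × Z ⊆ A × A ⊆ Y

between? : ∀ k (Z Y : Subset n) → Decidable (Between k Z Y)
between? k Z Y A = (∣ A ∣ ≟ k) ×-dec (Z ⊆? A) ×-dec (A ⊆? Y)

#-between : (Z Y : Subset n) → Z ⊆ Y → ∀ j → # (between? (∣ Z ∣ + j) Z Y) ≡ bin (∣ Y ∣ ∸ ∣ Z ∣) j
#-between []ᵥ []ᵥ _ zero    = 𝟙-yes (between? 0 []ᵥ []ᵥ []ᵥ) (refl , ⊆-refl , ⊆-refl)
#-between []ᵥ []ᵥ _ (suc j) = 𝟙-no (between? (suc j) []ᵥ []ᵥ []ᵥ) (λ ())
#-between (true ∷ᵥ Z) (false ∷ᵥ Y) h j with () ← h here
#-between (true ∷ᵥ Z) (true ∷ᵥ Y) h j = trans (cong₂ _+_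
  (trans (#-cong (λ A → between? (suc (∣ Z ∣ + j)) (true ∷ᵥ Z) (true ∷ᵥ Y) (true ∷ᵥ A)) (between? (∣ Z ∣ + j) Z Y)
            (λ A (e , f , g) → suc-injective e , drop-∷-⊆ f , drop-∷-⊆ g)
            (λ A (e , f , g) → cong suc e , s⊆s f , s⊆s g))
         (#-between Z Y (drop-∷-⊆ h) j))
  (#-empty (λ A → between? (suc (∣ Z ∣ + j)) (true ∷ᵥ Z) (true ∷ᵥ Y) (false ∷ᵥ A)) λ A (_ , f , _) → contradiction (f here) (λ ())))
  (+-identityʳ _)
#-between (false ∷ᵥ Z) (false ∷ᵥ Y) h j = cong₂ _+_
  (#-empty (λ A → between? (∣ Z ∣ + j) (false ∷ᵥ Z) (false ∷ᵥ Y) (true ∷ᵥ A)) λ A (_ , _ , g) → contradiction (g here) (λ ()))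
  (trans (#-cong (λ A → between? (∣ Z ∣ + j) (false ∷ᵥ Z) (false ∷ᵥ Y) (false ∷ᵥ A)) (between? (∣ Z ∣ + j) Z Y)
            (λ A (e , f , g) → e , drop-∷-⊆ f , drop-∷-⊆ g)
            (λ A (e , f , g) → e , s⊆s f , s⊆s g))
         (#-between Z Y (drop-∷-⊆ h) j))
#-between (false ∷ᵥ Z) (true ∷ᵥ Y) h j =
  -- A coordinate in Y but not in Z is the only free one, and its two choices are the summands of
  -- Pascal's rule. For j = 0 it cannot be taken, which `bin⁻` expresses by its value zero.
  trans (cong₂ _+_ (outer j)
    (trans (#-cong (λ A → between? (∣ Z ∣ + j) (false ∷ᵥ Z) (true ∷ᵥ Y) (false ∷ᵥ A)) (between? (∣ Z ∣ + j) Z Y)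
            (λ A (e , f , g) → e , drop-∷-⊆ f , λ x∈A → drop-there (g (there x∈A)))
            (λ A (e , f , g) → e , s⊆s f , out⊆ g))
         (#-between Z Y (out-⊆ h) j)))
  (trans (sym (bin-suc (∣ Y ∣ ∸ ∣ Z ∣) j)) (cong (λ z → bin z j) (sym (+-∸-assoc 1 (p⊆q⇒∣p∣≤∣q∣ (out-⊆ h))))))
  where
  out-⊆ : ∀ {Z Y : Subset n} → (false ∷ᵥ Z) ⊆ (true ∷ᵥ Y) → Z ⊆ Y
  out-⊆ h x∈ = drop-there (h (there x∈))
  outer : ∀ j → # (λ A → between? (∣ Z ∣ + j) (false ∷ᵥ Z) (true ∷ᵥ Y) (true ∷ᵥ A)) ≡ bin⁻ (∣ Y ∣ ∸ ∣ Z ∣) j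
  outer zero = #-empty (λ A → between? (∣ Z ∣ + 0) (false ∷ᵥ Z) (true ∷ᵥ Y) (true ∷ᵥ A)) λ A (e , f , _) →
    <⇒≱ (≤-reflexive (trans e (+-identityʳ _))) (p⊆q⇒∣p∣≤∣q∣ (out-⊆ f))
  outer (suc j) = trans (#-cong (λ A → between? (∣ Z ∣ + suc j) (false ∷ᵥ Z) (true ∷ᵥ Y) (true ∷ᵥ A)) (between? (∣ Z ∣ + j) Z Y)
            (λ A (e , f , g) → suc-injective (trans e (+-suc _ _)) , out-⊆ f , drop-∷-⊆ g)
            (λ A (e , f , g) → trans (cong suc e) (sym (+-suc _ _)) , out⊆ f , s⊆s g))
         (#-between Z Y (out-⊆ h) j)

abstract

  ∃-between : (Z Y : Subset n) → Z ⊆ Y → ∀ j → ∣ Z ∣ + j ≤ ∣ Y ∣ → ∃[ A ] Between (∣ Z ∣ + j) Z Y A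
  ∃-between Z Y h j le = #-exists (between? (∣ Z ∣ + j) Z Y)
    (subst (0 <_) (sym (#-between Z Y h j)) (bin-pos (≤-trans (≤-reflexive (sym (m+n∸m≡n ∣ Z ∣ j))) (∸-monoˡ-≤ ∣ Z ∣ le))))

∣p∩q∣≥∣q∣ : {p q : Subset n} → q ⊆ p → ∣ q ∣ ≤ ∣ p ∩ q ∣
∣p∩q∣≥∣q∣ q⊆p = p⊆q⇒∣p∣≤∣q∣ (λ x∈q → x∈p∩q⁺ (q⊆p x∈q , x∈q))

⊈⇒∣∩∣< : {A T : Subset n} → ¬ T ⊆ A → ∣ A ∩ T ∣ < ∣ T ∣
⊈⇒∣∩∣< {A = A} {T} T⊈A = ≰⇒> λ h → T⊈A λ x∈T →
  p∩q⊆p A T (subst (_ ∈_) (sym (⊆∧∣∣≥⇒≡ (p∩q⊆q A T) h)) x∈T)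

∣⊆∣ : {p q : Subset n} → q ⊆ p → ∣ p ∣ ≡ ∣ q ∣ + ∣ p ∩ ∁ q ∣
∣⊆∣ {p = p} {q} q⊆p = trans (∣p∣≡∣p∩q∣+∣p∩∁q∣ p q)
  (cong (_+ ∣ p ∩ ∁ q ∣) (≤-antisym (p⊆q⇒∣p∣≤∣q∣ (p∩q⊆q p q)) (∣p∩q∣≥∣q∣ q⊆p)))

∣p∣+∣∁p∣≡n : (p : Subset n) → ∣ p ∣ + ∣ ∁ p ∣ ≡ n
∣p∣+∣∁p∣≡n p = trans (cong (∣ p ∣ +_) (∣∁p∣≡n∸∣p∣ p)) (m+[n∸m]≡n (∣p∣≤n p))

-- Large sets are measured by a bound on the number of absent points, and such bounds add under
-- intersection.
cosize-∩ : (p q : Subset n) {a b : ℕ} → n ≤ ∣ p ∣ + a → n ≤ ∣ q ∣ + b → n ≤ ∣ p ∩ q ∣ + (a + b)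
cosize-∩ {n} p q {a} {b} hp hq = +-cancelˡ-≤ n _ _ (begin
  n + n                            ≤⟨ +-mono-≤ hp hq ⟩
  (∣ p ∣ + a) + (∣ q ∣ + b)         ≡⟨ interchange (∣ p ∣) a (∣ q ∣) b ⟩
  (∣ p ∣ + ∣ q ∣) + (a + b)         ≡⟨ cong (_+ (a + b)) (sym (∣p∪q∣+∣p∩q∣≡∣p∣+∣q∣ p q)) ⟩
  (∣ p ∪ q ∣ + ∣ p ∩ q ∣) + (a + b) ≤⟨ +-monoˡ-≤ (a + b) (+-monoˡ-≤ (∣ p ∩ q ∣) (∣p∣≤n (p ∪ q))) ⟩
  (n + ∣ p ∩ q ∣) + (a + b)         ≡⟨ +-assoc n _ _ ⟩
  n + (∣ p ∩ q ∣ + (a + b))         ∎)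
  where open ≤-Reasoning

cosize-∁⁅⁆ : (x : Fin n) → n ≤ ∣ ∁ ⁅ x ⁆ ∣ + 1
cosize-∁⁅⁆ {n} x = ≤-reflexive (trans (sym (∣p∣+∣∁p∣≡n ⁅ x ⁆)) (trans (cong (_+ ∣ ∁ ⁅ x ⁆ ∣) (∣⁅x⁆∣≡1 x)) (+-comm 1 _)))

∈∁⁅⁆ : {x y : Fin n} → y ≢ x → y ∈ ∁ ⁅ x ⁆
∈∁⁅⁆ {x = x} y≢x = x∉p⇒x∈∁p (x≢y⇒x∉⁅y⁆ y≢x)

-- Stars, their unions and their disjointness degrees

module Stars (n t c : ℕ) where

  -- N, M and M₂ are the numbers of k-sets containing a fixed set of t, t + 1 and t + 2 elements.
  k m x N M M₂ : ℕ
  k  = t + c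
  m  = n ∸ t
  x  = n ∸ k
  N  = bin m c
  M  = bin⁻ (m ∸ 1) c
  M₂ = bin⁻ (m ∸ 2) (c ∸ 1)

  -- B q is the size of the union of the first q stars of the lexicographic order, and w q is the number of its members
  -- that are t-disjoint from the next set of the order.
  w B : ℕ → ℕ
  w q = tel q x c
  B q = tel q (suc m) c

  -- w q * s − Λ q is the number of t-disjoint pairs of L n k s for B q ≤ s ≤ B (q + 1).
  Λ : ℕ → ℕ
  Λ zero    = 0
  Λ (suc q) = Λ q + B (suc q) * bin (x ∸ suc q) c

  Disj? : Decidable₂ {n} (λ A B → ∣ A ∩ B ∣ < t)
  Disj? A B = ∣ A ∩ B ∣ <? t

  Inter? : Decidable₂ {n} (λ A B → t ≤ ∣ A ∩ B ∣)
  Inter? A B = t ≤? ∣ A ∩ B ∣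

  Disj-sym : ∀ (A B : Subset n) → ∣ A ∩ B ∣ < t → ∣ B ∩ A ∣ < t
  Disj-sym A B = subst (λ z → ∣ z ∣ < t) (∩-comm A B)

  Inter-sym : ∀ (A B : Subset n) → t ≤ ∣ A ∩ B ∣ → t ≤ ∣ B ∩ A ∣
  Inter-sym A B = subst (λ z → t ≤ ∣ z ∣) (∩-comm A B)

  D I : {P : Subset n → Set} → Decidable P → ℕ
  D P? = pairs Disj? P? P?
  I P? = pairs Inter? P? P?

  Star : Subset n → Subset n → Set
  Star T A = ∣ A ∣ ≡ k × T ⊆ A

  star? : ∀ T → Decidable (Star T)
  star? T A = (∣ A ∣ ≟ k) ×-dec (T ⊆? A)

  U : List (Subset n) → Subset n → Set
  U 𝒯 A = ∣ A ∣ ≡ k × Any (_⊆ A) 𝒯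

  U? : ∀ 𝒯 → Decidable (U 𝒯)
  U? 𝒯 A = (∣ A ∣ ≟ k) ×-dec any? (_⊆? A) 𝒯

  Sized : List (Subset n) → Set
  Sized = All (λ T → ∣ T ∣ ≡ t)

  #-Between : ∀ {T Y : Subset n} → ∣ T ∣ ≡ t → T ⊆ Y → # (between? k T Y) ≡ bin (∣ Y ∣ ∸ t) c
  #-Between {T} {Y} e T⊆Y = trans (cong (λ z → # (between? (z + c) T Y)) (sym e))
    (trans (#-between T Y T⊆Y c) (cong (λ z → bin (∣ Y ∣ ∸ z) c) e))

  #-star : ∀ {T : Subset n} → ∣ T ∣ ≡ t → # (star? T) ≡ N
  #-star {T} ∣T∣ = trans (#-cong (star? T) (between? k T ⊤) (λ A (e , f) → e , f , ⊆⊤) (λ A (e , f , _) → e , f))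
    (trans (#-Between {T} {⊤} ∣T∣ ⊆⊤) (cong (λ z → bin (z ∸ t) c) (∣⊤∣≡n n)))

  #-star-meets : ∀ {T : Subset n} V → ∣ T ∣ ≡ t → T ⊆ ∁ V → # (λ A → star? T A ×-dec ¬? (A ⊆? ∁ V)) ≤ ∣ V ∣ * M
  #-star-meets {T} V ∣T∣ h = +-cancelˡ-≤ (bin (m ∸ ∣ V ∣) c) _ _ (begin
    -- The members of the star inside the complement of V are counted exactly; `bin-upper` bounds
    -- what is left of N.
    bin (m ∸ ∣ V ∣) c + # (star? T ∖? (_⊆? ∁ V))              ≡⟨ cong (_+ # (star? T ∖? (_⊆? ∁ V))) (sym inside≡) ⟩
    # (star? T ∧? (_⊆? ∁ V)) + # (star? T ∖? (_⊆? ∁ V))       ≡⟨ sym (#-split (star? T) (_⊆? ∁ V)) ⟩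
    # (star? T)                                               ≡⟨ #-star ∣T∣ ⟩
    bin m c                                                   ≤⟨ bin-upper m ∣ V ∣ c ⟩
    bin (m ∸ ∣ V ∣) c + ∣ V ∣ * M                              ∎)
    where
    open ≤-Reasoning
    inside≡ : # (star? T ∧? (_⊆? ∁ V)) ≡ bin (m ∸ ∣ V ∣) c
    inside≡ = trans (#-cong (star? T ∧? (_⊆? ∁ V)) (between? k T (∁ V)) (λ A ((e , f) , g) → e , f , g)
        (λ A (e , f , g) → (e , f) , g))
      (trans (#-Between ∣T∣ h) (cong (λ z → bin z c)
        (trans (cong (_∸ t) (∣∁p∣≡n∸∣p∣ V)) (trans (∸-+-assoc n ∣ V ∣ t)
            (trans (cong (n ∸_) (+-comm ∣ V ∣ t)) (sym (∸-+-assoc n t ∣ V ∣)))))))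

  #-two-stars : ∀ {T T′ : Subset n} → ∣ T ∣ ≡ t → ∣ T′ ∣ ≡ t → T′ ≢ T → # (λ A → star? T A ×-dec (T′ ⊆? A)) ≤ M
  #-two-stars {T} {T′} ∣T∣ ∣T′∣ T′≢T with ⊈⇒∃ {p = T′} {T} (λ s → T′≢T (⊆∧∣∣≥⇒≡ s (≤-reflexive (trans ∣T∣ (sym ∣T′∣)))))
  ... | y , y∈T′ , y∉T = begin
    # (λ A → star? T A ×-dec (T′ ⊆? A))             ≤⟨ #-mono _ (λ A → star? T A ×-dec ¬? (A ⊆? ∁ ⁅ y ⁆))
        (λ A (s , f) → s , λ g → x∈∁p⇒x∉p (g (f y∈T′)) (x∈⁅x⁆ y)) ⟩
    # (λ A → star? T A ×-dec ¬? (A ⊆? ∁ ⁅ y ⁆))     ≤⟨ #-star-meets ⁅ y ⁆ ∣T∣ (λ z∈T → ∈∁⁅⁆ λ { refl → y∉T z∈T }) ⟩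
    ∣ ⁅ y ⁆ ∣ * M                                   ≡⟨ cong (_* M) (∣⁅x⁆∣≡1 y) ⟩
    1 * M                                           ≡⟨ *-identityˡ M ⟩
    M                                               ∎
    where open ≤-Reasoning

  #-star-inter : ∀ {T : Subset n} A V → ∣ T ∣ ≡ t → T ⊆ ∁ V → ∣ A ∩ ∁ V ∣ < t → # (star? T ∧? Inter? A) ≤ ∣ V ∣ * M
  #-star-inter {T} A V ∣T∣ h s = ≤-trans
    (#-mono (star? T ∧? Inter? A) (λ B → star? T B ×-dec ¬? (B ⊆? ∁ V))
      -- A member that avoids V shares with A only points of A outside V, fewer than t; so a
      -- t-intersecting member must meet V.
      (λ B (st , i) → st , λ B⊆ → <⇒≱ s (≤-trans i (p⊆q⇒∣p∣≤∣q∣ λ z∈ → let a , b = x∈p∩q⁻ A B z∈ in x∈p∩q⁺ (a , B⊆ b)))))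
    (#-star-meets V ∣T∣ h)

  #-star-inter-≤ : ∀ {T : Subset n} A → ∣ A ∣ ≡ k → ∣ T ∣ ≡ t → ¬ T ⊆ A → # (star? T ∧? Inter? A) ≤ k * M
  #-star-inter-≤ {T} A ∣A∣ ∣T∣ T⊈A = ≤-trans (#-star-inter A (A ∩ ∁ T) ∣T∣
      -- With V = A minus T, what A keeps outside V lies in T, and this is less than t points
      -- because T is not contained in A.
      (λ z∈T → x∉p⇒x∈∁p λ z∈ → x∈∁p⇒x∉p (p∩q⊆q A (∁ T) z∈) z∈T)
      (≤-trans (s≤s (p⊆q⇒∣p∣≤∣q∣ λ z∈ → let a , b = x∈p∩q⁻ A (∁ (A ∩ ∁ T)) z∈ in
          x∈p∩q⁺ (a , x∉∁p⇒x∈p λ z∈∁T → x∈∁p⇒x∉p b (x∈p∩q⁺ (a , z∈∁T)))))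
        (subst (∣ A ∩ T ∣ <_) ∣T∣ (⊈⇒∣∩∣< T⊈A))))
    (*-monoˡ-≤ M (≤-trans (p⊆q⇒∣p∣≤∣q∣ (p∩q⊆p A (∁ T))) (≤-reflexive ∣A∣)))

  #-star-disj : ∀ {T Y : Subset n} A → ∣ T ∣ ≡ t → T ⊆ Y → ∣ A ∩ Y ∣ < t → bin (∣ Y ∣ ∸ t) c ≤ # (between? k T Y ∧? Disj? A)
  #-star-disj {T} {Y} A ∣T∣ T⊆Y s = ≤-trans (≤-reflexive (sym (#-Between ∣T∣ T⊆Y)))
    (#-mono (between? k T Y) (between? k T Y ∧? Disj? A) (λ B b@(_ , _ , B⊆Y) → b ,
       ≤-trans (s≤s (p⊆q⇒∣p∣≤∣q∣ λ z∈ → let a , z = x∈p∩q⁻ A B z∈ in x∈p∩q⁺ (a , B⊆Y z))) s))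

  -- Y omits one point of each T′ outside T, so a k-set between T and Y belongs to the star of T and
  -- to no star of 𝒯.
  avoiding : ∀ {T : Subset n} 𝒯 → ∣ T ∣ ≡ t → Sized 𝒯 → All (T ≢_) 𝒯 →
             ∃[ Y ] (T ⊆ Y × n ≤ ∣ Y ∣ + length 𝒯 × All (λ T′ → ¬ T′ ⊆ Y) 𝒯)
  avoiding [] _ _ _ = ⊤ , ⊆⊤ , ≤-reflexive (sym (trans (+-identityʳ _) (∣⊤∣≡n n))) , []
  avoiding {T} (T′ ∷ 𝒯) ∣T∣ (∣T′∣ ∷ sz) (T≢T′ ∷ ne) with avoiding 𝒯 ∣T∣ sz ne
    | ⊈⇒∃ {p = T′} {T} (λ s → T≢T′ (sym (⊆∧∣∣≥⇒≡ s (≤-reflexive (trans ∣T∣ (sym ∣T′∣))))))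
  ... | Y , T⊆Y , size , av | y , y∈T′ , y∉T = Y ∩ ∁ ⁅ y ⁆
    , (λ z∈T → x∈p∩q⁺ (T⊆Y z∈T , ∈∁⁅⁆ λ { refl → y∉T z∈T }))
    , ≤-trans (cosize-∩ Y (∁ ⁅ y ⁆) size (cosize-∁⁅⁆ y)) (≤-reflexive (cong (∣ Y ∩ ∁ ⁅ y ⁆ ∣ +_) (+-comm (length 𝒯) 1)))
    , (λ s → x∈∁p⇒x∉p (p∩q⊆q Y _ (s y∈T′)) (x∈⁅x⁆ y))
    ∷ All.map (λ a s → a (λ z∈ → p∩q⊆p Y _ (s z∈))) av

  -- A (c + 1)-element set to be avoided suffices to make a superset of T t-disjoint from A.
  thin : ∀ {T : Subset n} A → 0 < t → ∣ A ∣ ≡ k → ∣ T ∣ ≡ t → ¬ T ⊆ A → ∃[ Y ] (T ⊆ Y × n ≤ ∣ Y ∣ + suc c × ∣ A ∩ Y ∣ < t)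
  thin {T} A 0<t ∣A∣ ∣T∣ T⊈A with ∃-between (A ∩ T) A (p∩q⊆p A T) (t ∸ suc ∣ A ∩ T ∣)
        (≤-trans (+-monoʳ-≤ ∣ A ∩ T ∣ (∸-monoʳ-≤ t (n≤1+n _)))
            (≤-trans (≤-reflexive (m+[n∸m]≡n (<⇒≤ small))) (subst (t ≤_) (sym ∣A∣) (m≤m+n t c))))
    where
    small : ∣ A ∩ T ∣ < t
    small = subst (∣ A ∩ T ∣ <_) ∣T∣ (⊈⇒∣∩∣< T⊈A)
  ... | G , ∣G∣ , A∩T⊆G , G⊆A = ∁ W , T⊆ , size , ≤-trans (s≤s (p⊆q⇒∣p∣≤∣q∣ A∩∁W⊆G)) (≤-reflexive suc∣G∣)
    where
    W = A ∩ ∁ G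
    small : ∣ A ∩ T ∣ < t
    small = subst (∣ A ∩ T ∣ <_) ∣T∣ (⊈⇒∣∩∣< T⊈A)
    suc∣G∣ : suc ∣ G ∣ ≡ t
    suc∣G∣ = trans (cong suc ∣G∣) (m+[n∸m]≡n small)
    T⊆ : T ⊆ ∁ W
    T⊆ z∈T = x∉p⇒x∈∁p λ z∈W → let a , b = x∈p∩q⁻ A (∁ G) z∈W in x∈∁p⇒x∉p b (A∩T⊆G (x∈p∩q⁺ (a , z∈T)))
    A∩∁W⊆G : A ∩ ∁ W ⊆ G
    A∩∁W⊆G z∈ = let a , b = x∈p∩q⁻ A (∁ W) z∈ in x∉∁p⇒x∈p λ z∈∁G → x∈∁p⇒x∉p b (x∈p∩q⁺ (a , z∈∁G))
    size : n ≤ ∣ ∁ W ∣ + suc c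
    size = ≤-reflexive (trans (sym (∣p∣+∣∁p∣≡n W)) (trans (+-comm ∣ W ∣ _) (cong (∣ ∁ W ∣ +_)
      (+-cancelˡ-≡ ∣ G ∣ _ _ (trans (sym (∣⊆∣ G⊆A)) (trans ∣A∣ (trans (cong (_+ c) (sym suc∣G∣)) (sym (+-suc ∣ G ∣ c)))))))))

  -- Omitting c + 1 + b points from a star leaves at least as many sets as the (b + 1)-st summand of
  -- `w`.
  cosize⇒ : ∀ {a b} → n ≤ a + (suc c + b) → x ∸ suc b ≤ a ∸ t
  cosize⇒ {a} {b} h = begin
    n ∸ k ∸ suc b                        ≡⟨ ∸-+-assoc n k (suc b) ⟩
    n ∸ (t + c + suc b)                  ≤⟨ ∸-monoˡ-≤ (t + c + suc b) h ⟩
    (a + (suc c + b)) ∸ (t + c + suc b)  ≡⟨ cong₂ _∸_ (+-comm a (suc c + b)) (eq t c b) ⟩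
    ((suc c + b) + a) ∸ ((suc c + b) + t) ≡⟨ [m+n]∸[m+o]≡n∸o (suc c + b) a t ⟩
    a ∸ t                                ∎
    where
    open ≤-Reasoning
    eq : ∀ t c b → t + c + suc b ≡ (suc c + b) + t
    eq = solve-∀

  avoids⇒¬Any : ∀ {Y B : Subset n} {𝒯} → B ⊆ Y → All (λ T → ¬ T ⊆ Y) 𝒯 → ¬ Any (_⊆ B) 𝒯
  avoids⇒¬Any g (a ∷ _)  (here s)  = a (λ z∈ → g (s z∈))
  avoids⇒¬Any g (_ ∷ as) (there s) = avoids⇒¬Any g as s

  U-cons-new : ∀ T 𝒯 → # (U? (T ∷ 𝒯)) ≡ # (U? 𝒯) + # (star? T ∖? U? 𝒯)
  U-cons-new T 𝒯 = ≤-antisym (#-union (U? (T ∷ 𝒯)) (U? 𝒯) (star? T ∖? U? 𝒯) split)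
    (#-disjoint (U? (T ∷ 𝒯)) (U? 𝒯) (star? T ∖? U? 𝒯) (λ A (e , a) → e , there a) (λ A ((e , s) , _) → e , here s)
        (λ A u (_ , ¬u) → ¬u u))
    where
    split : ∀ A → U (T ∷ 𝒯) A → U 𝒯 A ⊎ (Star T A × ¬ U 𝒯 A)
    split A (e , there a) = inj₁ (e , a)
    split A (e , here s) with U? 𝒯 A
    ... | yes u = inj₁ u
    ... | no ¬u = inj₂ ((e , s) , ¬u)

  #-U-≤ : ∀ 𝒯 → Sized 𝒯 → # (U? 𝒯) ≤ length 𝒯 * N
  #-U-≤ [] _ = ≤-reflexive (#-empty (U? []) (λ { _ (_ , ()) }))
  #-U-≤ (T ∷ 𝒯) (∣T∣ ∷ sz) = ≤-trans (≤-reflexive (U-cons-new T 𝒯)) (≤-trans (≤-reflexive (+-comm (# (U? 𝒯)) _))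
    (+-mono-≤ (≤-trans (#-mono (star? T ∖? U? 𝒯) (star? T) (λ _ → proj₁)) (≤-reflexive (#-star ∣T∣))) (#-U-≤ 𝒯 sz)))

  #-new-≥ : ∀ T 𝒯 → ∣ T ∣ ≡ t → Sized 𝒯 → All (T ≢_) 𝒯 → bin (m ∸ length 𝒯) c ≤ # (star? T ∖? U? 𝒯)
  #-new-≥ T 𝒯 ∣T∣ sz ne with avoiding 𝒯 ∣T∣ sz ne
  ... | Y , T⊆Y , size , av = begin
    bin (m ∸ length 𝒯) c     ≤⟨ bin-mono c (≤-trans
        (≤-reflexive (trans (∸-+-assoc n t (length 𝒯))
        (trans (cong (n ∸_) (+-comm t (length 𝒯))) (sym (∸-+-assoc n (length 𝒯) t)))))
        (∸-monoˡ-≤ t (m≤n+o⇒m∸n≤o n (length 𝒯) (≤-trans size (≤-reflexive (+-comm ∣ Y ∣ (length 𝒯))))))) ⟩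
    bin (∣ Y ∣ ∸ t) c         ≡⟨ sym (#-Between ∣T∣ T⊆Y) ⟩
    # (between? k T Y)       ≤⟨ #-mono (between? k T Y) (star? T ∖? U? 𝒯)
        (λ A (e , f , g) → (e , f) , λ (_ , a) → avoids⇒¬Any g av a) ⟩
    # (star? T ∖? U? 𝒯)      ∎
    where
    open ≤-Reasoning

  B-≤-#-U : ∀ 𝒯 → Sized 𝒯 → Unique 𝒯 → B (length 𝒯) ≤ # (U? 𝒯)
  B-≤-#-U [] _ _ = z≤n
  B-≤-#-U (T ∷ 𝒯) (∣T∣ ∷ sz) (ne ∷ un) = ≤-trans (+-mono-≤ (B-≤-#-U 𝒯 sz un) (#-new-≥ T 𝒯 ∣T∣ sz ne))
      (≤-reflexive (sym (U-cons-new T 𝒯)))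

  DU? : ∀ 𝒯 A → Decidable (λ B → U 𝒯 B × ∣ A ∩ B ∣ < t)
  DU? 𝒯 A B = U? 𝒯 B ×-dec Disj? A B

  #-DU-cons : ∀ A T 𝒯 Y → ∣ T ∣ ≡ t → T ⊆ Y → ∣ A ∩ Y ∣ < t → All (λ T′ → ¬ T′ ⊆ Y) 𝒯 →
              # (DU? 𝒯 A) + bin (∣ Y ∣ ∸ t) c ≤ # (DU? (T ∷ 𝒯) A)
  #-DU-cons A T 𝒯 Y ∣T∣ T⊆Y small av = ≤-trans
    (+-monoʳ-≤ (# (DU? 𝒯 A)) (#-star-disj A ∣T∣ T⊆Y small))
    (#-disjoint (DU? (T ∷ 𝒯) A) (DU? 𝒯 A) (between? k T Y ∧? Disj? A)
       (λ B ((e , a) , d) → (e , there a) , d) (λ B ((e , s , _) , d) → (e , here s) , d)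
       (λ B ((_ , a) , _) ((_ , _ , g) , _) → avoids⇒¬Any g av a))

  -- Inside the newest star, c + 1 omitted points force t-disjointness from A, and one more point
  -- for each older star avoids that star. This leaves `bin (x ∸ suc q) c` new sets wherever the
  -- centres lie, q being the number of older stars; these numbers add up to `w`.
  disj-U-≥ : 0 < t → ∀ A 𝒯 → ∣ A ∣ ≡ k → Sized 𝒯 → Unique 𝒯 → All (λ T → ¬ T ⊆ A) 𝒯 → w (length 𝒯) ≤ # (DU? 𝒯 A)
  disj-U-≥ _ A [] _ _ _ _ = z≤n
  disj-U-≥ 0<t A (T ∷ 𝒯) ∣A∣ (∣T∣ ∷ sz) (ne ∷ un) (T⊈A ∷ av) =
    let Y , T⊆Y , size , avY = avoiding 𝒯 ∣T∣ sz ne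
        Y′ , T⊆Y′ , size′ , small = thin A 0<t ∣A∣ ∣T∣ T⊈A
    in ≤-trans (+-mono-≤ (disj-U-≥ 0<t A 𝒯 ∣A∣ sz un av) (bin-mono c (cosize⇒ {∣ Y′ ∩ Y ∣} {length 𝒯} (cosize-∩ Y′ Y size′ size))))
         (#-DU-cons A T 𝒯 (Y′ ∩ Y) ∣T∣ (λ z∈ → x∈p∩q⁺ (T⊆Y′ z∈ , T⊆Y z∈))
           (≤-trans (s≤s (p⊆q⇒∣p∣≤∣q∣ λ z∈ → let a , b = x∈p∩q⁻ A (Y′ ∩ Y) z∈ in x∈p∩q⁺ (a , p∩q⊆p Y′ Y b))) small)
           (All.map (λ a s → a (λ z∈ → p∩q⊆q Y′ Y (s z∈))) avY))

  D-cons : ∀ T 𝒯 γ → (∀ A → Star T A × ¬ U 𝒯 A → γ ≤ # (DU? 𝒯 A)) →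
           D (U? 𝒯) + 2 * (# (star? T ∖? U? 𝒯) * γ) ≤ D (U? (T ∷ 𝒯))
  D-cons T 𝒯 γ h = begin
    D (U? 𝒯) + 2 * (# new * γ)                                ≤⟨ +-monoʳ-≤ (D (U? 𝒯)) (*-monoʳ-≤ 2 (pairs-≥ Disj? new (U? 𝒯) γ h)) ⟩
    -- Disjoint pairs within the new part are given away.
    D (U? 𝒯) + 2 * pairs Disj? new (U? 𝒯)                     ≤⟨ m≤m+n _ _ ⟩
    D (U? 𝒯) + 2 * pairs Disj? new (U? 𝒯) + D new             ≤⟨ pairs-square-≥ Disj? (U? (T ∷ 𝒯)) (U? 𝒯) new Disj-sym
        (λ A (e , a) → e , there a) (λ A ((e , s) , _) → e , here s) (λ A u (_ , ¬u) → ¬u u) ⟩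
    D (U? (T ∷ 𝒯))                                            ∎
    where
    open ≤-Reasoning
    new = star? T ∖? U? 𝒯

  Good : ℕ → List (Subset n) → Set
  Good q 𝒯 = 2 * (w q * # (U? 𝒯)) ≤ D (U? 𝒯) + 2 * Λ q

  notU⇒ : ∀ {A} 𝒯 → ∣ A ∣ ≡ k → ¬ U 𝒯 A → All (λ T → ¬ T ⊆ A) 𝒯
  notU⇒ []      e ¬u = []
  notU⇒ (T ∷ 𝒯) e ¬u = (λ s → ¬u (e , here s)) ∷ notU⇒ 𝒯 e (λ (e , a) → ¬u (e , there a))

  -- Adding a star raises Λ by B (q + 1) K and the slope by K, so only the size of the union has to be compared with B (q + 1).
  good-by-size : 0 < t → ∀ 𝒯 → Sized 𝒯 → Unique 𝒯 → Good (length 𝒯) 𝒯 → ∀ T → ∣ T ∣ ≡ t → All (T ≢_) 𝒯 →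
                 # (U? (T ∷ 𝒯)) ≤ B (suc (length 𝒯)) → Good (suc (length 𝒯)) (T ∷ 𝒯)
  good-by-size 0<t 𝒯 sz un ih T ∣T∣ ne size = begin
    2 * ((w q + K) * # (U? (T ∷ 𝒯)))                     ≡⟨ eq₁ (w q) K (# (U? (T ∷ 𝒯))) ⟩
    2 * (w q * # (U? (T ∷ 𝒯))) + 2 * (# (U? (T ∷ 𝒯)) * K) ≤⟨ +-monoʳ-≤ (2 * (w q * # (U? (T ∷ 𝒯))))
        (*-monoʳ-≤ 2 (*-monoˡ-≤ K size)) ⟩
    2 * (w q * # (U? (T ∷ 𝒯))) + 2 * (B (suc q) * K)     ≡⟨ cong (λ z → 2 * (w q * z) + 2 * (B (suc q) * K)) (U-cons-new T 𝒯) ⟩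
    2 * (w q * (u + v)) + 2 * (B (suc q) * K)            ≡⟨ eq₂ (w q) u v (B (suc q) * K) ⟩
    2 * (w q * u) + 2 * (v * w q) + 2 * (B (suc q) * K)  ≤⟨ +-monoˡ-≤ _ (+-monoˡ-≤ (2 * (v * w q)) ih) ⟩
    D (U? 𝒯) + 2 * Λ q + 2 * (v * w q) + 2 * (B (suc q) * K) ≡⟨ eq₃ (D (U? 𝒯)) (Λ q) (v * w q) (B (suc q) * K) ⟩
    (D (U? 𝒯) + 2 * (v * w q)) + 2 * (Λ q + B (suc q) * K) ≤⟨ +-monoˡ-≤ _
        (D-cons T 𝒯 (w q) λ A ((e , _) , ¬u) → disj-U-≥ 0<t A 𝒯 e sz un (notU⇒ 𝒯 e ¬u)) ⟩
    D (U? (T ∷ 𝒯)) + 2 * Λ (suc q)                       ∎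
    where
    open ≤-Reasoning
    q = length 𝒯
    K = bin (x ∸ suc q) c
    u = # (U? 𝒯)
    v = # (star? T ∖? U? 𝒯)
    eq₁ : ∀ a b z → 2 * ((a + b) * z) ≡ 2 * (a * z) + 2 * (z * b)
    eq₁ = solve-∀
    eq₂ : ∀ a u v z → 2 * (a * (u + v)) + 2 * z ≡ 2 * (a * u) + 2 * (v * a) + 2 * z
    eq₂ = solve-∀
    eq₃ : ∀ a b d e → a + 2 * b + 2 * d + 2 * e ≡ (a + 2 * d) + 2 * (b + e)
    eq₃ = solve-∀

-- A log-concave comparison for centres inside a (t + 1)-set

rearrange : ∀ {a b κ κ′} → κ ≤ κ′ → b ≤ a → κ′ * b + κ * a ≤ κ′ * a + κ * b
rearrange {b = b} {κ = κ} κ≤κ′ b≤a with m≤n⇒∃[o]m+o≡n κ≤κ′ | m≤n⇒∃[o]m+o≡n b≤a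
... | d , refl | e , refl = ≤-trans (m≤m+n _ (d * e)) (≤-reflexive (eq b κ d e))
  where
  eq : ∀ b κ d e → (κ + d) * b + κ * (b + e) + d * e ≡ (κ + d) * (b + e) + κ * b
  eq = solve-∀

-- Families of stars inside one (t + 1)-set agree with the lexicographic family up to the order N * M, so they need this exact
-- comparison, which is the log-concavity of x ↦ bin x c.
pure-arith : ∀ q m x c κ → q ≤ x → x ≤ m → κ ≤ bin (x ∸ 1) c →
  bin (m ∸ 1) c * tel q x c + κ * (q * bin (m ∸ 1) c) ≤ bin (m ∸ 1) c * (q * bin (x ∸ 1) c) + κ * tel q m c
pure-arith zero    m x c κ _ _ _ = ≤-refl
pure-arith (suc q) m x c κ q<x x≤m κ≤ = begin
  N′ * (tel q x c + Kq) + κ * (N′ + q * N′)          ≡⟨ eq₁ N′ (tel q x c) Kq κ q ⟩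
  (N′ * tel q x c + κ * (q * N′)) + (N′ * Kq + κ * N′) ≤⟨ +-mono-≤ (pure-arith q m x c κ (<⇒≤ q<x) x≤m κ≤) term ⟩
  (N′ * (q * K₁) + κ * tel q m c) + (K₁ * N′ + κ * b) ≡⟨ eq₂ N′ q K₁ κ (tel q m c) b ⟩
  N′ * (K₁ + q * K₁) + κ * (tel q m c + b)           ∎
  where
  open ≤-Reasoning
  N′ = bin (m ∸ 1) c
  K₁ = bin (x ∸ 1) c
  Kq = bin (x ∸ suc q) c
  b  = bin (m ∸ suc q) c
  eq₁ : ∀ a b d e q → a * (b + d) + e * (a + q * a) ≡ (a * b + e * (q * a)) + (a * d + e * a)
  eq₁ = solve-∀
  eq₂ : ∀ a q b e f g → (a * (q * b) + e * f) + (b * a + e * g) ≡ a * (b + q * b) + e * (f + g)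
  eq₂ = solve-∀
  back : ∀ z → q < z → q + (z ∸ suc q) ≡ z ∸ 1
  back (suc z) (s≤s q≤z) = m+[n∸m]≡n q≤z
  ratio : N′ * Kq ≤ K₁ * b
  ratio = subst₂ (λ u v → bin u c * Kq ≤ bin v c * b) (back m (≤-trans q<x x≤m)) (back x q<x)
    (bin-ratio (x ∸ suc q) (m ∸ suc q) q c (∸-monoˡ-≤ (suc q) x≤m))
  -- `ratio` trades N′ * Kq for K₁ * b; what remains is the rearrangement inequality for κ ≤ K₁ and
  -- b ≤ N′.
  term : N′ * Kq + κ * N′ ≤ K₁ * N′ + κ * b
  term = ≤-trans (+-monoˡ-≤ (κ * N′) ratio) (rearrange κ≤ (bin-mono c (∸-monoʳ-≤ m (s≤s z≤n))))

-- Sunflowers: centres with a common (t - 1)-subset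

module Sunflowers (n t c : ℕ) where
  open Stars n t c

  -- X is a transversal of the petals T minus Z: a set that avoids X contains no centre.
  petals : ∀ {Z : Subset n} 𝒯 → ∣ Z ∣ < t → Sized 𝒯 →
           ∃[ X ] (∣ X ∣ ≤ length 𝒯 × Z ⊆ ∁ X × All (λ T → ¬ T ⊆ ∁ X) 𝒯)
  petals [] _ _ = ∁ (⊤ {n}) , ≤-reflexive (trans (∣∁p∣≡n∸∣p∣ (⊤ {n})) (trans (cong (n ∸_) (∣⊤∣≡n n)) (n∸n≡0 n))) ,
      (λ z∈ → x∉p⇒x∈∁p (λ z → x∈∁p⇒x∉p z ∈⊤)) , []
  petals {Z} (T ∷ 𝒯) lt (∣T∣ ∷ sz) =
    let X , size , Z⊆ , av = petals 𝒯 lt sz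
        y , y∈T , y∉Z = ⊈⇒∃ {p = T} {Z} (λ s → <⇒≱ lt (≤-trans (≤-reflexive (sym ∣T∣)) (p⊆q⇒∣p∣≤∣q∣ s)))
    in ⁅ y ⁆ ∪ X
     , ≤-trans (∣p∪q∣≤∣p∣+∣q∣ ⁅ y ⁆ X) (+-mono-≤ (≤-reflexive (∣⁅x⁆∣≡1 y)) size)
     , (λ z∈Z → x∉p⇒x∈∁p λ z∈ → [ (λ a → y∉Z (subst (_∈ Z) (x∈⁅y⁆⇒x≡y y a) z∈Z)) , x∈∁p⇒x∉p (Z⊆ z∈Z) ]′ (x∈p∪q⁻ ⁅ y ⁆ X z∈))
     , (λ s → x∈∁p⇒x∉p (s y∈T) (x∈p∪q⁺ (inj₁ (x∈⁅x⁆ y))))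
     ∷ All.map (λ a s → a (λ z∈ → x∉p⇒x∈∁p λ z∈X → x∈∁p⇒x∉p (s z∈) (x∈p∪q⁺ (inj₂ z∈X)))) av

  Any-core : ∀ {Z A : Subset n} {𝒯} → All (Z ⊆_) 𝒯 → Any (_⊆ A) 𝒯 → Z ⊆ A
  Any-core (s ∷ _)  (here h)  z∈ = h (s z∈)
  Any-core (_ ∷ ss) (there h) z∈ = Any-core ss h z∈

  module _ {Z : Subset n} (∣Z∣ : suc ∣ Z ∣ ≡ t) where

    #-core : ∀ (Y : Subset n) → Z ⊆ Y → # (between? k Z Y) ≡ bin (suc ∣ Y ∣ ∸ t) (suc c)
    #-core Y Z⊆Y = trans (cong (λ z → # (between? z Z Y)) (trans (cong (_+ c) (sym ∣Z∣)) (sym (+-suc ∣ Z ∣ c))))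
      (trans (#-between Z Y Z⊆Y (suc c)) (cong (λ z → bin (suc ∣ Y ∣ ∸ z) (suc c)) ∣Z∣))

    suc-∸ : ∀ (Y : Subset n) {a} → n ≤ ∣ Y ∣ + a → suc n ∸ t ∸ a ≤ suc ∣ Y ∣ ∸ t
    suc-∸ Y {a} h = ≤-trans (≤-reflexive (trans (∸-+-assoc (suc n) t a)
        (trans (cong (suc n ∸_) (+-comm t a)) (sym (∸-+-assoc (suc n) a t)))))
      (∸-monoˡ-≤ t (m≤n+o⇒m∸n≤o (suc n) a (≤-trans (s≤s h)
          (≤-reflexive (trans (cong suc (+-comm ∣ Y ∣ a)) (sym (+-suc a ∣ Y ∣)))))))

    -- Every member of the union contains Z, and a superset of Z that avoids the transversal X lies
    -- in no star. Taking these away from all k-sets containing Z leaves a telescoping difference.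
    sunflower-size : ∀ 𝒯 → Sized 𝒯 → All (Z ⊆_) 𝒯 → t ≤ n → length 𝒯 ≤ m → # (U? 𝒯) ≤ B (length 𝒯)
    sunflower-size 𝒯 sz cs t≤n len≤ =
      let X , size , Z⊆ , av = petals 𝒯 (≤-reflexive ∣Z∣) sz
          m+1 = +-∸-assoc 1 t≤n
      in +-cancelʳ-≤ (bin (suc m ∸ length 𝒯) (suc c)) _ _ (begin
      # (U? 𝒯) + bin (suc m ∸ length 𝒯) (suc c)
        ≤⟨ +-monoʳ-≤ (# (U? 𝒯)) (bin-mono (suc c) (≤-trans (≤-reflexive (cong (_∸ length 𝒯) (sym m+1)))
             (suc-∸ (∁ X) {length 𝒯} (≤-trans (≤-reflexive (trans (sym (∣p∣+∣∁p∣≡n X)) (+-comm ∣ X ∣ _)))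
                 (+-monoʳ-≤ ∣ ∁ X ∣ size))))) ⟩
      # (U? 𝒯) + bin (suc ∣ ∁ X ∣ ∸ t) (suc c)
        ≡⟨ cong (# (U? 𝒯) +_) (sym (#-core (∁ X) Z⊆)) ⟩
      # (U? 𝒯) + # (between? k Z (∁ X))
        ≤⟨ #-disjoint (between? k Z ⊤) (U? 𝒯) (between? k Z (∁ X))
             (λ A (e , a) → e , Any-core cs a , ⊆⊤) (λ A (e , f , g) → e , f , ⊆⊤)
             (λ A (_ , a) (_ , _ , g) → avoids⇒¬Any g av a) ⟩
      # (between? k Z ⊤)
        ≡⟨ trans (#-core ⊤ ⊆⊤) (cong (λ z → bin z (suc c)) (trans (cong (λ z → suc z ∸ t) (∣⊤∣≡n n)) m+1)) ⟩
      bin (suc m) (suc c)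
        ≡⟨ sym (tel-sum (length 𝒯) (suc m) c (m≤n⇒m≤1+n len≤)) ⟩
      B (length 𝒯) + bin (suc m ∸ length 𝒯) (suc c) ∎)
      where open ≤-Reasoning

    sunflower-good : 0 < t → ∀ 𝒯 → Sized 𝒯 → Unique 𝒯 → All (Z ⊆_) 𝒯 → t ≤ n → length 𝒯 ≤ m → Good (length 𝒯) 𝒯
    sunflower-good _ [] _ _ _ _ _ = z≤n
    sunflower-good 0<t (T ∷ 𝒯) sz@(∣T∣ ∷ sz′) (ne ∷ un) cs@(_ ∷ cs′) t≤n len≤ =
      good-by-size 0<t 𝒯 sz′ un (sunflower-good 0<t 𝒯 sz′ un cs′ t≤n (<⇒≤ len≤)) T ∣T∣ ne
        (sunflower-size (T ∷ 𝒯) sz cs t≤n len≤)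

    -- Two supersets of Z are t-disjoint only if they meet in Z alone. The disjoint partners of A
    -- therefore avoid W, the c + 1 points of A outside Z, and they must meet X; counting such sets
    -- gives the telescoping difference that equals `w q`.
    sunflower-degree : ∀ A 𝒯 {q} → Sized 𝒯 → All (Z ⊆_) 𝒯 → length 𝒯 ≡ suc q → q ≤ x → k ≤ n → U 𝒯 A → # (DU? 𝒯 A) ≤ w q
    sunflower-degree A 𝒯 {q} sz cs len q≤x k≤n (∣A∣ , a) =
      let X , size , Z⊆∁X , av = petals 𝒯 (≤-reflexive ∣Z∣) sz
          Z⊆A = Any-core cs a
          W = A ∩ ∁ Z
          Z⊆∁W : Z ⊆ ∁ W
          Z⊆∁W = λ z∈Z → x∉p⇒x∈∁p λ z∈W → x∈∁p⇒x∉p (p∩q⊆q A (∁ Z) z∈W) z∈Z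
          ∣W∣ : ∣ W ∣ ≡ suc c
          ∣W∣ = +-cancelˡ-≡ ∣ Z ∣ _ _ (trans (sym (∣⊆∣ Z⊆A)) (trans ∣A∣ (trans (cong (_+ c) (sym ∣Z∣)) (sym (+-suc ∣ Z ∣ c)))))
          y , y∈A , y∉∁X = ⊈⇒∃ {p = A} {∁ X} (λ s → avoids⇒¬Any s av a)
          y∈X = x∉∁p⇒x∈p y∉∁X
          y∈W = x∈p∩q⁺ (y∈A , x∉p⇒x∈∁p λ y∈Z → x∈∁p⇒x∉p (Z⊆∁X y∈Z) y∈X)
          -- A itself contains a centre, so it meets X. Hence W and X overlap, and q + 1 petals cost
          -- at most q points beyond W.
          meet : 1 ≤ ∣ X ∩ W ∣
          meet = ≤-trans (≤-reflexive (sym (∣⁅x⁆∣≡1 y)))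
              (p⊆q⇒∣p∣≤∣q∣ {p = ⁅ y ⁆} (λ z∈ → subst (_∈ X ∩ W) (sym (x∈⁅y⁆⇒x≡y y z∈)) (x∈p∩q⁺ (y∈X , y∈W))))
          union : ∣ X ∪ W ∣ ≤ suc c + q
          union = ≤-pred (begin
            1 + ∣ X ∪ W ∣             ≤⟨ +-monoˡ-≤ ∣ X ∪ W ∣ meet ⟩
            ∣ X ∩ W ∣ + ∣ X ∪ W ∣     ≡⟨ +-comm ∣ X ∩ W ∣ _ ⟩
            ∣ X ∪ W ∣ + ∣ X ∩ W ∣     ≡⟨ ∣p∪q∣+∣p∩q∣≡∣p∣+∣q∣ X W ⟩
            ∣ X ∣ + ∣ W ∣             ≤⟨ +-mono-≤ (≤-trans size (≤-reflexive len)) (≤-reflexive ∣W∣) ⟩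
            suc q + suc c            ≡⟨ cong suc (+-comm q (suc c)) ⟩
            1 + (suc c + q)          ∎)
          Z⊆∁XW : Z ⊆ ∁ (X ∪ W)
          Z⊆∁XW = λ z∈Z → x∉p⇒x∈∁p λ z∈ → [ x∈∁p⇒x∉p (Z⊆∁X z∈Z) , x∈∁p⇒x∉p (Z⊆∁W z∈Z) ]′ (x∈p∪q⁻ X W z∈)
      in +-cancelʳ-≤ (bin (x ∸ q) (suc c)) _ _ (begin
      # (DU? 𝒯 A) + bin (x ∸ q) (suc c)
        ≤⟨ +-monoʳ-≤ (# (DU? 𝒯 A)) (bin-mono (suc c)
            (≤-trans (≤-reflexive (trans (cong (_∸ q) (shift k≤n)) (∸-+-assoc (suc n ∸ t) (suc c) q)))
             (suc-∸ (∁ (X ∪ W)) {suc c + q} (≤-trans (≤-reflexive (trans (sym (∣p∣+∣∁p∣≡n (X ∪ W))) (+-comm ∣ X ∪ W ∣ _)))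
                 (+-monoʳ-≤ ∣ ∁ (X ∪ W) ∣ union))))) ⟩
      # (DU? 𝒯 A) + bin (suc ∣ ∁ (X ∪ W) ∣ ∸ t) (suc c)
        ≡⟨ cong (# (DU? 𝒯 A) +_) (sym (#-core (∁ (X ∪ W)) Z⊆∁XW)) ⟩
      # (DU? 𝒯 A) + # (between? k Z (∁ (X ∪ W)))
        ≤⟨ #-disjoint (between? k Z (∁ W)) (DU? 𝒯 A) (between? k Z (∁ (X ∪ W)))
             (λ B ((e , b) , d) → e , Any-core cs b , λ {z} z∈B → x∉p⇒x∈∁p λ z∈W →
                let z∈A , z∈∁Z = x∈p∩q⁻ A (∁ Z) z∈W in
                <⇒≱ d (subst (_≤ ∣ A ∩ B ∣) ∣Z∣ (p⊂q⇒∣p∣<∣q∣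
                    ((λ v∈Z → x∈p∩q⁺ (Z⊆A v∈Z , Any-core cs b v∈Z)) , z , x∈p∩q⁺ (z∈A , z∈B) , x∈∁p⇒x∉p z∈∁Z))))
             (λ B (e , f , g) → e , f , λ z∈B → x∉p⇒x∈∁p λ z∈W → x∈∁p⇒x∉p (g z∈B) (x∈p∪q⁺ (inj₂ z∈W)))
             (λ B ((_ , b) , _) (_ , _ , g) → avoids⇒¬Any (λ z∈B → x∉p⇒x∈∁p λ z∈X → x∈∁p⇒x∉p (g z∈B) (x∈p∪q⁺ (inj₁ z∈X))) av b) ⟩
      # (between? k Z (∁ W))
        ≡⟨ trans (#-core (∁ W) Z⊆∁W) (cong (λ z → bin z (suc c))
            (trans (cong (λ z → suc z ∸ t) (trans (∣∁p∣≡n∸∣p∣ W) (cong (n ∸_) ∣W∣))) (shift′ k≤n))) ⟩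
      bin x (suc c)
        ≡⟨ sym (tel-sum q x c q≤x) ⟩
      w q + bin (x ∸ q) (suc c) ∎)
      where
      open ≤-Reasoning
      shift : k ≤ n → x ≡ suc n ∸ t ∸ suc c
      shift k≤n = sym (trans (∸-+-assoc (suc n) t (suc c)) (cong (suc n ∸_) (+-suc t c)))
      shift′ : k ≤ n → suc (n ∸ suc c) ∸ t ≡ x
      shift′ k≤n = trans (cong (_∸ t) (sym (+-∸-assoc 1 c<n))) (trans (∸-+-assoc n c t) (cong (n ∸_) (+-comm c t)))
        where
        c<n : suc c ≤ n
        c<n = ≤-trans (+-monoˡ-≤ c (subst (1 ≤_) ∣Z∣ (s≤s z≤n))) k≤n

-- Pure families: centres inside a common (t + 1)-set

module PureFamilies (n t c : ℕ) where
  open Stars n t c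
  open Sunflowers n t c

  module _ {Y : Subset n} (∣Y∣ : ∣ Y ∣ ≡ suc t) where

    missing : ∀ {T : Subset n} → ∣ T ∣ ≡ t → T ⊆ Y → ∃[ y ] (y ∈ Y × y ∉ T × T ≡ Y ∩ ∁ ⁅ y ⁆)
    missing {T} ∣T∣ T⊆Y =
      let y , y∈Y , y∉T = ⊈⇒∃ {p = Y} {T} (λ s → <⇒≱ (≤-reflexive (trans (cong suc ∣T∣) (sym ∣Y∣))) (p⊆q⇒∣p∣≤∣q∣ s))
      in y , y∈Y , y∉T , ⊆∧∣∣≥⇒≡ (λ z∈T → x∈p∩q⁺ (T⊆Y z∈T , ∈∁⁅⁆ λ { refl → y∉T z∈T }))
           (≤-trans (≤-pred (≤-trans (p⊂q⇒∣p∣<∣q∣ (p∩q⊆p Y _ , y , y∈Y , λ y∈ → x∈∁p⇒x∉p (p∩q⊆q Y _ y∈) (x∈⁅x⁆ y)))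
               (≤-reflexive ∣Y∣))) (≤-reflexive (sym ∣T∣)))

    -- A t-subset of Y omits a single point, so the point omitted by T belongs to all the other
    -- centres.
    others-avoid : ∀ {T y 𝒯} → T ≡ Y ∩ ∁ ⁅ y ⁆ → ∣ T ∣ ≡ t → Sized 𝒯 → All (_⊆ Y) 𝒯 → All (T ≢_) 𝒯 → All (λ T′ → ¬ T′ ⊆ ∁ ⁅ y ⁆) 𝒯
    others-avoid _ _ [] _ _ = []
    others-avoid e ∣T∣ (∣T′∣ ∷ sz) (i ∷ ins) (ne ∷ nes) =
      (λ s → ne (sym (⊆∧∣∣≥⇒≡ (λ z∈ → subst (_ ∈_) (sym e) (x∈p∩q⁺ (i z∈ , s z∈)))
          (≤-reflexive (trans ∣T∣ (sym ∣T′∣)))))) ∷ others-avoid e ∣T∣ sz ins nes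

    -- Omitting y avoids all the other stars at once, and omitting the at most c points of A outside
    -- Y then forces A ∩ B into A ∩ T. Each star thus contributes the largest summand
    -- `bin (x ∸ 1) c` in place of the decreasing summands of `w`.
    pure-degree : 0 < t → ∀ A 𝒯 → ∣ A ∣ ≡ k → t ≤ ∣ A ∩ Y ∣ → Sized 𝒯 → Unique 𝒯 → All (_⊆ Y) 𝒯 → All (λ T → ¬ T ⊆ A) 𝒯 →
                  length 𝒯 * bin (x ∸ 1) c ≤ # (DU? 𝒯 A)
    pure-degree _ A [] _ _ _ _ _ _ = z≤n
    pure-degree 0<t A (T ∷ 𝒯) ∣A∣ big (∣T∣ ∷ sz) (ne ∷ un) (i ∷ ins) (T⊈A ∷ av) =
      let y , y∈Y , y∉T , e = missing ∣T∣ i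
          V = A ∩ ∁ Y
          ∣V∣ : ∣ V ∣ ≤ c
          ∣V∣ = +-cancelˡ-≤ t _ _ (≤-trans (+-monoˡ-≤ ∣ V ∣ big) (≤-reflexive (trans (sym (∣p∣≡∣p∩q∣+∣p∩∁q∣ A Y)) ∣A∣)))
          Y′ = ∁ V ∩ ∁ ⁅ y ⁆
          size : n ≤ ∣ Y′ ∣ + suc (c + 0)
          size = ≤-trans (cosize-∩ (∁ V) (∁ ⁅ y ⁆) {c} {1}
              (≤-trans (≤-reflexive (trans (sym (∣p∣+∣∁p∣≡n V)) (+-comm ∣ V ∣ _))) (+-monoʳ-≤ ∣ ∁ V ∣ ∣V∣)) (cosize-∁⁅⁆ y))
                         (≤-reflexive (cong (∣ Y′ ∣ +_) (trans (+-comm c 1) (cong suc (sym (+-identityʳ c))))))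
          A∩Y′⊆ : A ∩ Y′ ⊆ A ∩ T
          A∩Y′⊆ = λ {z} z∈ → let a , b = x∈p∩q⁻ A Y′ z∈ ; b₁ , b₂ = x∈p∩q⁻ (∁ V) (∁ ⁅ y ⁆) b in
             x∈p∩q⁺ (a , subst (z ∈_) (sym e) (x∈p∩q⁺ (x∉∁p⇒x∈p (λ z∈∁Y → x∈∁p⇒x∉p b₁ (x∈p∩q⁺ (a , z∈∁Y))) , b₂)))
      in ≤-trans (≤-trans (≤-reflexive (+-comm (bin (x ∸ 1) c) _))
           (+-mono-≤ (pure-degree 0<t A 𝒯 ∣A∣ big sz un ins av) (bin-mono c (cosize⇒ {∣ Y′ ∣} {0} size))))
         (#-DU-cons A T 𝒯 Y′ ∣T∣
           (λ {z} z∈T → x∈p∩q⁺ (x∉p⇒x∈∁p (λ z∈V → x∈∁p⇒x∉p (p∩q⊆q A (∁ Y) z∈V) (i z∈T)) , p∩q⊆q Y _ (subst (z ∈_) e z∈T)))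
           (≤-trans (s≤s (p⊆q⇒∣p∣≤∣q∣ A∩Y′⊆)) (subst (∣ A ∩ T ∣ <_) ∣T∣ (⊈⇒∣∩∣< T⊈A)))
           (All.map (λ a s → a (λ z∈ → p∩q⊆q (∁ V) _ (s z∈))) (others-avoid e ∣T∣ sz ins ne)))

    -- A member of the star of T that also contains the omitted point y contains Y and with it every
    -- other centre, so the new sets are exactly those that avoid y.
    pure-new : ∀ T T₁ 𝒯 → ∣ T ∣ ≡ t → Sized (T₁ ∷ 𝒯) → T ⊆ Y → All (_⊆ Y) (T₁ ∷ 𝒯) → All (T ≢_) (T₁ ∷ 𝒯) →
               # (star? T ∖? U? (T₁ ∷ 𝒯)) ≡ bin (m ∸ 1) c
    pure-new T T₁ 𝒯 ∣T∣ sz@(∣T₁∣ ∷ _) i ins@(i₁ ∷ _) nes@(ne₁ ∷ _) =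
      let y , y∈Y , y∉T , e = missing ∣T∣ i
          T⊆∁y : T ⊆ ∁ ⁅ y ⁆
          T⊆∁y = λ {z} z∈T → p∩q⊆q Y _ (subst (z ∈_) e z∈T)
      in trans (#-cong (star? T ∖? U? (T₁ ∷ 𝒯)) (between? k T (∁ ⁅ y ⁆))
           (λ A ((∣A∣ , s) , ¬u) → ∣A∣ , s , λ {z} z∈A → ∈∁⁅⁆ λ { refl → ¬u
               (∣A∣ , here (λ {v} v∈T₁ → inside e y s z∈A (i₁ v∈T₁))) })
           (λ A (∣A∣ , s , g) → (∣A∣ , s) , λ (_ , a) → avoids⇒¬Any g (others-avoid e ∣T∣ sz ins nes) a))
         (trans (#-Between ∣T∣ T⊆∁y) (cong (λ z → bin z c) (trans (cong (_∸ t) (trans (∣∁p∣≡n∸∣p∣ ⁅ y ⁆) (cong (n ∸_) (∣⁅x⁆∣≡1 y))))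
           (trans (∸-+-assoc n 1 t) (trans (cong (n ∸_) (+-comm 1 t)) (sym (∸-+-assoc n t 1)))))))
      where
      inside : ∀ {A v} → T ≡ Y ∩ ∁ ⁅ v ⁆ → ∀ y → T ⊆ A → v ∈ A → ∀ {z} → z ∈ Y → z ∈ A
      inside {A} {v} e y s v∈A {z} z∈Y with z ∈? ⁅ v ⁆
      ... | yes z∈ = subst (_∈ A) (sym (x∈⁅y⁆⇒x≡y v z∈)) v∈A
      ... | no z∉ = s (subst (z ∈_) (sym e) (x∈p∩q⁺ (z∈Y , x∉p⇒x∈∁p z∉)))

    pure-size : ∀ 𝒯 q → length 𝒯 ≡ suc q → Sized 𝒯 → Unique 𝒯 → All (_⊆ Y) 𝒯 → # (U? 𝒯) ≡ N + q * bin (m ∸ 1) c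
    pure-size (T ∷ []) zero refl (∣T∣ ∷ []) _ _ = trans
        (#-cong (U? (T ∷ [])) (star? T) (λ { A (e , here s) → e , s }) (λ A (e , s) → e , here s))
      (trans (#-star ∣T∣) (sym (+-identityʳ N)))
    pure-size (T ∷ T₁ ∷ 𝒯) (suc q) refl (∣T∣ ∷ sz) (ne ∷ un) (i ∷ ins) =
      trans (U-cons-new T (T₁ ∷ 𝒯)) (trans (cong₂ _+_ (pure-size (T₁ ∷ 𝒯) q refl sz un ins) (pure-new T T₁ 𝒯 ∣T∣ sz i ins ne))
        (trans (+-assoc N _ _) (cong (N +_) (+-comm (q * bin (m ∸ 1) c) _))))

    pure-D-cons : 0 < t → ∀ T T₁ 𝒯 → Sized (T ∷ T₁ ∷ 𝒯) → Unique (T ∷ T₁ ∷ 𝒯) → All (_⊆ Y) (T ∷ T₁ ∷ 𝒯) →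
      D (U? (T₁ ∷ 𝒯)) + 2 * (bin (m ∸ 1) c * (suc (length 𝒯) * bin (x ∸ 1) c)) ≤ D (U? (T ∷ T₁ ∷ 𝒯))
    pure-D-cons 0<t T T₁ 𝒯 (∣T∣ ∷ sz) (ne ∷ un) (i ∷ ins) =
      subst (λ z → D (U? (T₁ ∷ 𝒯)) + 2 * (z * (suc (length 𝒯) * bin (x ∸ 1) c)) ≤ D (U? (T ∷ T₁ ∷ 𝒯)))
          (pure-new T T₁ 𝒯 ∣T∣ sz i ins ne)
        (D-cons T (T₁ ∷ 𝒯) (suc (length 𝒯) * bin (x ∸ 1) c) λ A ((∣A∣ , s) , ¬u) →
          pure-degree 0<t A (T₁ ∷ 𝒯) ∣A∣ (≤-trans (≤-reflexive (sym ∣T∣)) (p⊆q⇒∣p∣≤∣q∣ λ z∈T → x∈p∩q⁺ (s z∈T , i z∈T))) sz un ins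
              (notU⇒ (T₁ ∷ 𝒯) ∣A∣ ¬u))

    -- The union can be larger than `B`, so the argument by size fails. The excess is paid by the
    -- larger degrees of the new sets; sizes are exact here, and `pure-arith` compares the two
    -- increments.
    pure-good : 0 < t → t ≤ n → ∀ 𝒯 q → length 𝒯 ≡ suc q → suc q ≤ x → x ≤ m → Sized 𝒯 → Unique 𝒯 → All (_⊆ Y) 𝒯 → Good (suc q) 𝒯
    pure-good 0<t t≤n (T ∷ []) zero refl q<x x≤m (∣T∣ ∷ []) _ _ =
      good-by-size 0<t [] [] [] z≤n T ∣T∣ [] (≤-reflexive
          (trans (#-cong (U? (T ∷ [])) (star? T) (λ { A (e , here s) → e , s }) (λ A (e , s) → e , here s)) (#-star ∣T∣)))
    pure-good 0<t t≤n (T ∷ T₁ ∷ 𝒯) (suc q′) refl q<x x≤m sz@(∣T∣ ∷ sz′) un@(ne ∷ un′) ins@(i ∷ ins′) = begin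
      2 * ((w q + K) * # (U? (T ∷ T₁ ∷ 𝒯)))  ≡⟨ cong (λ z → 2 * ((w q + K) * z)) (pure-size (T ∷ T₁ ∷ 𝒯) q refl sz un ins) ⟩
      2 * ((w q + K) * (N + q * N′))         ≡⟨ eq₁ (w q) K N q′ N′ ⟩
      2 * (w q * (N + q′ * N′)) + 2 * (N′ * w q + K * (q * N′)) + 2 * (K * N)
        ≤⟨ +-monoˡ-≤ (2 * (K * N)) (+-mono-≤
             (subst (λ z → 2 * (w q * z) ≤ D (U? (T₁ ∷ 𝒯)) + 2 * Λ q) (pure-size (T₁ ∷ 𝒯) q′ refl sz′ un′ ins′)
               (pure-good 0<t t≤n (T₁ ∷ 𝒯) q′ refl (<⇒≤ q<x) x≤m sz′ un′ ins′))
             (*-monoʳ-≤ 2 (pure-arith q m x c K (<⇒≤ q<x) x≤m (bin-mono c (∸-monoʳ-≤ x (s≤s z≤n)))))) ⟩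
      D (U? (T₁ ∷ 𝒯)) + 2 * Λ q + 2 * (N′ * (q * K₁) + K * tel q m c) + 2 * (K * N)
        ≡⟨ eq₂ (D (U? (T₁ ∷ 𝒯))) (Λ q) (N′ * (q * K₁)) K (tel q m c) N ⟩
      (D (U? (T₁ ∷ 𝒯)) + 2 * (N′ * (q * K₁))) + 2 * (Λ q + (N + tel q m c) * K)
        ≡⟨ cong (λ z → (D (U? (T₁ ∷ 𝒯)) + 2 * (N′ * (q * K₁))) + 2 * (Λ q + z * K)) (sym (tel-shift q m c)) ⟩
      (D (U? (T₁ ∷ 𝒯)) + 2 * (N′ * (q * K₁))) + 2 * (Λ q + B (suc q) * K)
        ≤⟨ +-monoˡ-≤ (2 * Λ (suc q)) (pure-D-cons 0<t T T₁ 𝒯 sz un ins) ⟩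
      D (U? (T ∷ T₁ ∷ 𝒯)) + 2 * Λ (suc q) ∎
      where
      open ≤-Reasoning
      q = suc q′
      K = bin (x ∸ suc q) c
      K₁ = bin (x ∸ 1) c
      N′ = bin (m ∸ 1) c
      eq₁ : ∀ a b d q e → 2 * ((a + b) * (d + suc q * e)) ≡ 2 * (a * (d + q * e)) + 2 * (e * a + b * (suc q * e)) + 2 * (b * d)
      eq₁ = solve-∀
      eq₂ : ∀ a b d e f g → a + 2 * b + 2 * (d + e * f) + 2 * (e * g) ≡ (a + 2 * d) + 2 * (b + (g + f) * e)
      eq₂ = solve-∀

#-cover : {P : Subset n → Set} {R : Rel₂ n} (P? : Decidable P) (R? : Decidable₂ R) →
          (∀ B → P B → ∃[ Z ] R Z B) → # P? ≤ ## R?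
#-cover P? R? h = ≤-trans (Σs-mono go) (≤-reflexive (sym (##-swap R?)))
  where
  go : ∀ B → 𝟙 (P? B) ≤ # (λ Z → R? Z B)
  go B with P? B
  ... | no _  = z≤n
  ... | yes p = let Z , r = h B p in #-positive (λ Z → R? Z B) r

-- Pairs of t-intersecting sets across two stars

bin₂≤ : ∀ v → bin v 2 ≤ v * v
bin₂≤ zero    = z≤n
bin₂≤ (suc v) = ≤-trans (+-mono-≤ (bin₁ v) (bin₂≤ v)) (≤-trans (m≤m+n _ (suc v)) (≤-reflexive (eq v)))
  where
  bin₁ : ∀ v → bin v 1 ≤ v
  bin₁ zero    = z≤n
  bin₁ (suc v) = s≤s (bin₁ v)
  eq : ∀ v → v + v * v + suc v ≡ suc v * suc v
  eq = solve-∀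

data HasPair (R : Subset n → Subset n → Set) : List (Subset n) → Set where
  here  : ∀ {T 𝒯} → Any (R T) 𝒯 → HasPair R (T ∷ 𝒯)
  there : ∀ {T 𝒯} → HasPair R 𝒯 → HasPair R (T ∷ 𝒯)

module CrossingPairs (n t c : ℕ) where
  open Stars n t c
  open Sunflowers n t c
  open PureFamilies n t c

  #-⊇₂ : ∀ (Z : Subset n) → ∣ Z ∣ ≡ t + 2 → # (λ B → (∣ B ∣ ≟ k) ×-dec (Z ⊆? B)) ≤ M₂
  #-⊇₂ Z ∣Z∣ = go c refl
    where
    P? = λ (B : Subset n) → (∣ B ∣ ≟ k) ×-dec (Z ⊆? B)
    -- No k-set has t + 2 elements in this case, in agreement with `M₂` being zero by the convention
    -- for `bin⁻`.
    none : c < 2 → # P? ≤ M₂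
    none c<2 = ≤-trans (≤-reflexive (#-empty P? λ B (e , s) →
      <⇒≱ (+-monoʳ-< t c<2) (≤-trans (≤-reflexive (sym ∣Z∣)) (≤-trans (p⊆q⇒∣p∣≤∣q∣ s) (≤-reflexive e))))) z≤n
    go : ∀ d → c ≡ d → # P? ≤ M₂
    go zero          e = none (subst (_< 2) (sym e) z<s)
    go (suc zero)    e = none (subst (_< 2) (sym e) (s<s z<s))
    go (suc (suc j)) e = ≤-reflexive (trans (#-cong P? (between? (∣ Z ∣ + j) Z ⊤)
        (λ B (f , s) → trans f size , s , ⊆⊤) (λ B (f , s , _) → trans f (sym size) , s))
      (trans (#-between Z ⊤ ⊆⊤ j) (trans (cong (λ z → bin z j) (trans (cong₂ _∸_ (∣⊤∣≡n n) ∣Z∣) (sym (∸-+-assoc n t 2))))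
        (cong (λ z → bin⁻ (m ∸ 2) (z ∸ 1)) (sym e)))))
      where
      size : k ≡ ∣ Z ∣ + j
      size = trans (cong (t +_) e) (trans (sym (+-assoc t 2 j)) (cong (_+ j) (sym ∣Z∣)))

  #-star-inter-far : ∀ {T : Subset n} A → ∣ A ∣ ≡ k → ∣ T ∣ ≡ t → 2 + ∣ A ∩ T ∣ ≤ t → # (star? T ∧? Inter? A) ≤ k * k * M₂
  #-star-inter-far {T} A ∣A∣ ∣T∣ far = begin
    # (star? T ∧? Inter? A)                        ≤⟨ #-cover (star? T ∧? Inter? A) R? cover ⟩
    ## R?                                                       ≤⟨ ##-≤ P? R? M₂
        (λ Z (e , _) → ≤-trans (#-mono (R? Z) (λ B → (∣ B ∣ ≟ k) ×-dec (Z ⊆? B)) (λ _ → proj₂))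
        (#-⊇₂ Z (trans e (cong (_+ 2) ∣T∣)))) (λ _ _ → proj₁) ⟩
    # P? * M₂                                                   ≡⟨ cong (_* M₂) (#-between T (T ∪ A) (p⊆p∪q A) 2) ⟩
    bin (∣ T ∪ A ∣ ∸ ∣ T ∣) 2 * M₂                               ≤⟨ *-monoˡ-≤ M₂ (≤-trans (bin-mono 2 small) (bin₂≤ k)) ⟩
    k * k * M₂                                                  ∎
    where
    open ≤-Reasoning
    P? = between? (∣ T ∣ + 2) T (T ∪ A)
    R? : Decidable₂ (λ Z B → Between (∣ T ∣ + 2) T (T ∪ A) Z × ∣ B ∣ ≡ k × Z ⊆ B)
    R? Z B = P? Z ×-dec (∣ B ∣ ≟ k) ×-dec (Z ⊆? B)
    small : ∣ T ∪ A ∣ ∸ ∣ T ∣ ≤ k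
    small = m≤n+o⇒m∸n≤o ∣ T ∪ A ∣ ∣ T ∣ (≤-trans (∣p∪q∣≤∣p∣+∣q∣ T A) (+-monoʳ-≤ ∣ T ∣ (≤-reflexive ∣A∣)))
    -- To share t elements with A, a member of the star needs at least two elements of A outside T.
    -- So it contains one of at most k² sets of size t + 2 between T and T ∪ A, each of which lies
    -- in at most `M₂` k-sets.
    cover : ∀ B → Star T B × t ≤ ∣ A ∩ B ∣ → ∃[ Z ] (Between (∣ T ∣ + 2) T (T ∪ A) Z × ∣ B ∣ ≡ k × Z ⊆ B)
    cover B ((e , s) , i) =
      let Z , ∣Z∣ , T⊆Z , Z⊆ = ∃-between T (T ∪ (A ∩ B)) (p⊆p∪q (A ∩ B)) 2 (+-cancelʳ-≤ ∣ T ∩ (A ∩ B) ∣ _ _ (begin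
            ∣ T ∣ + 2 + ∣ T ∩ (A ∩ B) ∣             ≡⟨ +-assoc ∣ T ∣ 2 _ ⟩
            ∣ T ∣ + (2 + ∣ T ∩ (A ∩ B) ∣)           ≤⟨ +-monoʳ-≤ ∣ T ∣ (+-monoʳ-≤ 2 (p⊆q⇒∣p∣≤∣q∣ λ z∈ → let a , b = x∈p∩q⁻ T (A ∩ B) z∈ in x∈p∩q⁺ (p∩q⊆p A B b , a))) ⟩
            ∣ T ∣ + (2 + ∣ A ∩ T ∣)                 ≤⟨ +-monoʳ-≤ ∣ T ∣ (≤-trans far i) ⟩
            ∣ T ∣ + ∣ A ∩ B ∣                       ≡⟨ sym (∣p∪q∣+∣p∩q∣≡∣p∣+∣q∣ T (A ∩ B)) ⟩
            ∣ T ∪ (A ∩ B) ∣ + ∣ T ∩ (A ∩ B) ∣       ∎))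
      in Z , (∣Z∣ , T⊆Z , λ z∈ → [ (λ a → x∈p∪q⁺ (inj₁ a)) , (λ b → x∈p∪q⁺ (inj₂ (p∩q⊆p A B b))) ]′ (x∈p∪q⁻ T (A ∩ B) (Z⊆ z∈)))
       , e , λ z∈ → [ s , p∩q⊆q A B ]′ (x∈p∪q⁻ T (A ∩ B) (Z⊆ z∈))

  private? : ∀ T T′ → Decidable (λ A → Star T A × ¬ T′ ⊆ A)
  private? T T′ = star? T ∖? (T′ ⊆?_)

  #-private : ∀ {T : Subset n} T′ → ∣ T ∣ ≡ t → # (private? T T′) ≤ N
  #-private {T} T′ ∣T∣ = ≤-trans (#-mono (private? T T′) (star? T) (λ _ → proj₁)) (≤-reflexive (#-star ∣T∣))

  cross : Subset n → Subset n → ℕ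
  cross T T′ = pairs Inter? (private? T T′) (private? T′ T)

  -- B misses an element of T and A misses an element of T′, and the two elements differ. So A ∩ B
  -- has at most t - 1 elements in T ∪ T′, and B must meet one of the at most c elements of A
  -- outside T ∪ T′.
  cross-near : ∀ {T T′ : Subset n} → ∣ T ∣ ≡ t → ∣ T′ ∣ ≡ t → ∣ T ∪ T′ ∣ ≤ suc t → cross T T′ ≤ N * (c * M)
  cross-near {T} {T′} ∣T∣ ∣T′∣ near = ≤-trans
      (pairs-≤ Inter? (private? T T′) (private? T′ T) (c * M) bound) (*-monoˡ-≤ (c * M) (#-private T′ ∣T∣))
    where
    bound : ∀ A → Star T A × ¬ T′ ⊆ A → # (private? T′ T ∧? Inter? A) ≤ c * M
    bound A ((∣A∣ , T⊆A) , T′⊈A) = ≤-trans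
      (#-mono (private? T′ T ∧? Inter? A) (λ B → star? T′ B ×-dec ¬? (B ⊆? ∁ V)) step)
      (≤-trans (#-star-meets V ∣T′∣ (λ z∈ → x∉p⇒x∈∁p λ z∈V → x∈∁p⇒x∉p (p∩q⊆q A _ z∈V) (q⊆p∪q T T′ z∈))) (*-monoˡ-≤ M ∣V∣))
      where
      V = A ∩ ∁ (T ∪ T′)
      ∣V∣ : ∣ V ∣ ≤ c
      ∣V∣ = ≤-trans (p⊆q⇒∣p∣≤∣q∣ {q = A ∩ ∁ T} (λ z∈ → x∈p∩q⁺
          (p∩q⊆p A _ z∈ , x∉p⇒x∈∁p λ z∈T → x∈∁p⇒x∉p (p∩q⊆q A _ z∈) (p⊆p∪q T′ z∈T))))
        (≤-reflexive (+-cancelˡ-≡ t _ _ (trans (cong (_+ ∣ A ∩ ∁ T ∣) (sym ∣T∣)) (trans (sym (∣⊆∣ T⊆A)) ∣A∣))))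
      step : ∀ B → (Star T′ B × ¬ T ⊆ B) × t ≤ ∣ A ∩ B ∣ → Star T′ B × ¬ B ⊆ ∁ V
      step B ((st , T⊈B) , i) = st , λ B⊆ →
        let y , y∈T , y∉B = ⊈⇒∃ {p = T} {B} T⊈B
            y′ , y′∈T′ , y′∉A = ⊈⇒∃ {p = T′} {A} T′⊈A
            Q = T ∪ T′
            Q₁ = Q ∩ ∁ ⁅ y ⁆
            Q₂ = Q₁ ∩ ∁ ⁅ y′ ⁆
            y′≢y : y′ ≢ y
            y′≢y = λ e → y′∉A (subst (_∈ A) (sym e) (T⊆A y∈T))
            drop₁ : ∣ Q₁ ∣ < ∣ Q ∣
            drop₁ = p⊂q⇒∣p∣<∣q∣ (p∩q⊆p Q _ , y , p⊆p∪q T′ y∈T , λ y∈ → x∈∁p⇒x∉p (p∩q⊆q Q _ y∈) (x∈⁅x⁆ y))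
            drop₂ : ∣ Q₂ ∣ < ∣ Q₁ ∣
            drop₂ = p⊂q⇒∣p∣<∣q∣ (p∩q⊆p Q₁ _ , y′ , x∈p∩q⁺ (q⊆p∪q T T′ y′∈T′ , ∈∁⁅⁆ y′≢y) , λ y∈ → x∈∁p⇒x∉p (p∩q⊆q Q₁ _ y∈)
                (x∈⁅x⁆ y′))
            A∩B⊆Q₂ : A ∩ B ⊆ Q₂
            A∩B⊆Q₂ = λ {z} z∈ → let a , b = x∈p∩q⁻ A B z∈ in
              x∈p∩q⁺ (x∈p∩q⁺ (x∉∁p⇒x∈p (λ z∈∁Q → x∈∁p⇒x∉p (B⊆ b)
                  (x∈p∩q⁺ (a , z∈∁Q))) , ∈∁⁅⁆ λ { refl → y∉B b }) , ∈∁⁅⁆ λ { refl → y′∉A a })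
        in <⇒≱ (≤-pred (≤-trans (≤-trans (s≤s (≤-trans (s≤s (p⊆q⇒∣p∣≤∣q∣ A∩B⊆Q₂)) drop₂)) drop₁) near)) i

  κ : ℕ
  κ = (k * k + t * k) * (M * M)

  -- A generic A avoids T′ minus T; it meets T′ in at most t - 2 elements and has O(M₂) partners.
  -- The at most t * M special A have at most k * M partners each, and N * M₂ ≤ M * M brings both
  -- contributions to order M².
  cross-far : N * M₂ ≤ M * M → ∀ {T T′ : Subset n} → ∣ T ∣ ≡ t → ∣ T′ ∣ ≡ t → 2 + ∣ T ∩ T′ ∣ ≤ t → cross T T′ ≤ κ
  cross-far NM₂ {T} {T′} ∣T∣ ∣T′∣ far = begin
    cross T T′
      ≤⟨ ##-union (λ A B → private? T T′ A ×-dec private? T′ T B ×-dec Inter? A B)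
           (λ A B → generic? A ×-dec star? T′ B ×-dec Inter? A B) (λ A B → special? A ×-dec star? T′ B ×-dec Inter? A B) split ⟩
    pairs Inter? generic? (star? T′) + pairs Inter? special? (star? T′)
      ≤⟨ +-mono-≤ (pairs-≤ Inter? generic? (star? T′) (k * k * M₂) (λ A ((∣A∣ , _) , g) → #-star-inter-far A ∣A∣ ∣T′∣ (avoid g)))
                  (pairs-≤ Inter? special? (star? T′) (k * M) (λ A (((∣A∣ , _) , _) , ns) → #-star-inter-≤ A ∣A∣ ∣T′∣ ns)) ⟩
    # generic? * (k * k * M₂) + # special? * (k * M)
      ≤⟨ +-mono-≤ (*-monoˡ-≤ (k * k * M₂) (≤-trans (#-mono generic? (star? T) (λ _ → proj₁)) (≤-reflexive (#-star ∣T∣))))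
                  (*-monoˡ-≤ (k * M) (≤-trans (#-mono special? (λ A → star? T A ×-dec ¬? (A ⊆? ∁ V)) (λ _ → proj₁))
                     (≤-trans (#-star-meets V ∣T∣ (λ z∈T → x∉p⇒x∈∁p λ z∈V → x∈∁p⇒x∉p (p∩q⊆q T′ _ z∈V) z∈T))
                              (*-monoˡ-≤ M (≤-trans (p⊆q⇒∣p∣≤∣q∣ (p∩q⊆p T′ (∁ T))) (≤-reflexive ∣T′∣)))))) ⟩
    N * (k * k * M₂) + t * M * (k * M)   ≡⟨ eq₁ N k M₂ t M ⟩
    (k * k) * (N * M₂) + (t * k) * (M * M) ≤⟨ +-monoˡ-≤ _ (*-monoʳ-≤ (k * k) NM₂) ⟩
    (k * k) * (M * M) + (t * k) * (M * M) ≡⟨ sym (*-distribʳ-+ (M * M) (k * k) _) ⟩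
    κ ∎
    where
    open ≤-Reasoning
    V = T′ ∩ ∁ T
    generic? = star? T ∧? (_⊆? ∁ V)
    special? = λ A → (star? T A ×-dec ¬? (A ⊆? ∁ V)) ×-dec ¬? (T′ ⊆? A)
    split : ∀ A B → (Star T A × ¬ T′ ⊆ A) × (Star T′ B × ¬ T ⊆ B) × t ≤ ∣ A ∩ B ∣ →
            ((Star T A × A ⊆ ∁ V) × Star T′ B × t ≤ ∣ A ∩ B ∣) ⊎ (((Star T A × ¬ A ⊆ ∁ V) × ¬ T′ ⊆ A) × Star T′ B × t ≤ ∣ A ∩ B ∣)
    split A B ((st , ns) , (st′ , _) , i) with A ⊆? ∁ V
    ... | yes s = inj₁ ((st , s) , st′ , i)
    ... | no ¬s = inj₂ (((st , ¬s) , ns) , st′ , i)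
    avoid : ∀ {A} → A ⊆ ∁ V → 2 + ∣ A ∩ T′ ∣ ≤ t
    avoid {A} g = ≤-trans (+-monoʳ-≤ 2 (p⊆q⇒∣p∣≤∣q∣ λ z∈ → let a , b = x∈p∩q⁻ A T′ z∈ in
      x∈p∩q⁺ (x∉∁p⇒x∈p (λ z∈∁T → x∈∁p⇒x∉p (g a) (x∈p∩q⁺ (b , z∈∁T))) , b))) far
    eq₁ : ∀ N k M₂ t M → N * (k * k * M₂) + t * M * (k * M) ≡ (k * k) * (N * M₂) + (t * k) * (M * M)
    eq₁ = solve-∀

  crosses : Subset n → List (Subset n) → ℕ
  crosses T []       = 0
  crosses T (T′ ∷ 𝒯) = cross T T′ + crosses T 𝒯

  pairs-new≤crosses : ∀ T 𝒯 → pairs Inter? (star? T ∖? U? 𝒯) (U? 𝒯 ∖? (T ⊆?_)) ≤ crosses T 𝒯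
  pairs-new≤crosses T [] = ≤-trans (pairs-≤ Inter? (star? T ∖? U? []) (U? [] ∖? (T ⊆?_)) 0
      (λ A _ → ≤-reflexive (#-empty ((U? [] ∖? (T ⊆?_)) ∧? Inter? A) λ { _ (((_ , ()) , _) , _) })))
          (≤-reflexive (*-zeroʳ (# (star? T ∖? U? []))))
  pairs-new≤crosses T (T′ ∷ 𝒯) = ≤-trans
    (##-union (λ A B → (star? T ∖? U? (T′ ∷ 𝒯)) A ×-dec (U? (T′ ∷ 𝒯) ∖? (T ⊆?_)) B ×-dec Inter? A B)
              (λ A B → private? T T′ A ×-dec private? T′ T B ×-dec Inter? A B)
              (λ A B → (star? T ∖? U? 𝒯) A ×-dec (U? 𝒯 ∖? (T ⊆?_)) B ×-dec Inter? A B) split)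
    (+-monoʳ-≤ (cross T T′) (pairs-new≤crosses T 𝒯))
    where
    split : ∀ A B → (Star T A × ¬ U (T′ ∷ 𝒯) A) × (U (T′ ∷ 𝒯) B × ¬ T ⊆ B) × t ≤ ∣ A ∩ B ∣ →
      ((Star T A × ¬ T′ ⊆ A) × (Star T′ B × ¬ T ⊆ B) × t ≤ ∣ A ∩ B ∣) ⊎ ((Star T A × ¬ U 𝒯 A) × (U 𝒯 B × ¬ T ⊆ B) × t ≤ ∣ A ∩ B ∣)
    split A B ((st , ¬u) , ((e , here s) , ns) , i)  = inj₁ ((st , λ T′⊆A → ¬u (proj₁ st , here T′⊆A)) , ((e , s) , ns) , i)
    split A B ((st , ¬u) , ((e , there a) , ns) , i) = inj₂ ((st , λ (e′ , a′) → ¬u (e′ , there a′)) , ((e , a) , ns) , i)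

  -- In a mixed pair of a new and an old set the old one may be assumed not to contain T: otherwise
  -- the pair lies in the star of T and is already part of N * N.
  I-cons : ∀ T 𝒯 → ∣ T ∣ ≡ t → I (U? (T ∷ 𝒯)) ≤ I (U? 𝒯) + N * N + 2 * crosses T 𝒯
  I-cons T 𝒯 ∣T∣ = begin
    I (U? (T ∷ 𝒯))                           ≤⟨ ##-union FF (λ A B → UU A B ⊎-dec SS A B) (λ A B → SU A B ⊎-dec US A B) split ⟩
    ## (λ A B → UU A B ⊎-dec SS A B) + ## (λ A B → SU A B ⊎-dec US A B)
      ≤⟨ +-mono-≤ (##-union (λ A B → UU A B ⊎-dec SS A B) UU SS (λ _ _ z → z))
          (##-union (λ A B → SU A B ⊎-dec US A B) SU US (λ _ _ z → z)) ⟩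
    (I (U? 𝒯) + ## SS) + (## SU + ## US)      ≤⟨ +-mono-≤ (+-monoʳ-≤ (I (U? 𝒯)) SS≤)
        (+-mono-≤ SU≤ (≤-trans (pairs-sym Inter? (U? 𝒯 ∖? (T ⊆?_)) (star? T ∖? U? 𝒯) Inter-sym) SU≤)) ⟩
    (I (U? 𝒯) + N * N) + (crosses T 𝒯 + crosses T 𝒯) ≡⟨ cong (λ z → I (U? 𝒯) + N * N + (crosses T 𝒯 + z)) (sym (+-identityʳ _)) ⟩
    I (U? 𝒯) + N * N + 2 * crosses T 𝒯       ∎
    where
    open ≤-Reasoning
    FF = λ A B → U? (T ∷ 𝒯) A ×-dec U? (T ∷ 𝒯) B ×-dec Inter? A B
    UU = λ A B → U? 𝒯 A ×-dec U? 𝒯 B ×-dec Inter? A B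
    SS = λ A B → star? T A ×-dec star? T B ×-dec Inter? A B
    SU = λ A B → (star? T ∖? U? 𝒯) A ×-dec (U? 𝒯 ∖? (T ⊆?_)) B ×-dec Inter? A B
    US = λ A B → (U? 𝒯 ∖? (T ⊆?_)) A ×-dec (star? T ∖? U? 𝒯) B ×-dec Inter? A B
    SU≤ : ## SU ≤ crosses T 𝒯
    SU≤ = pairs-new≤crosses T 𝒯
    SS≤ : ## SS ≤ N * N
    SS≤ = ≤-trans (pairs-≤ Inter? (star? T) (star? T) N
        (λ A _ → ≤-trans (#-mono (star? T ∧? Inter? A) (star? T) (λ _ → proj₁)) (≤-reflexive (#-star ∣T∣))))
      (≤-reflexive (cong (_* N) (#-star ∣T∣)))
    cons⁻ : ∀ {A} → U (T ∷ 𝒯) A → U 𝒯 A ⊎ Star T A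
    cons⁻ (e , here s)  = inj₂ (e , s)
    cons⁻ (e , there a) = inj₁ (e , a)
    split : ∀ A B → U (T ∷ 𝒯) A × U (T ∷ 𝒯) B × t ≤ ∣ A ∩ B ∣ →
      ((U 𝒯 A × U 𝒯 B × t ≤ ∣ A ∩ B ∣) ⊎ (Star T A × Star T B × t ≤ ∣ A ∩ B ∣)) ⊎
      (((Star T A × ¬ U 𝒯 A) × (U 𝒯 B × ¬ T ⊆ B) × t ≤ ∣ A ∩ B ∣) ⊎ ((U 𝒯 A × ¬ T ⊆ A) × (Star T B × ¬ U 𝒯 B) × t ≤ ∣ A ∩ B ∣))
    split A B (a , b , i) with U? 𝒯 A | U? 𝒯 B | T ⊆? A | T ⊆? B
    ... | yes u | yes u′ | _     | _      = inj₁ (inj₁ (u , u′ , i))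
    ... | _     | _      | yes s | yes s′ = inj₁ (inj₂ ((proj₁ a , s) , (proj₁ b , s′) , i))
    ... | yes u | no ¬u′ | no ¬s | _      = inj₂
        (inj₂ ((u , ¬s) , ([ (λ u′ → ⊥-elim (¬u′ u′)) , (λ st → st) ]′ (cons⁻ b) , ¬u′) , i))
    ... | no ¬u | yes u′ | _     | no ¬s′ = inj₂ (inj₁ (([ (λ u → ⊥-elim (¬u u)) , (λ st → st) ]′ (cons⁻ a) , ¬u) , (u′ , ¬s′) , i))
    ... | no ¬u | _      | no ¬s | _      = ⊥-elim ([ ¬u , (λ (_ , s) → ¬s s) ]′ (cons⁻ a))
    ... | _     | no ¬u′ | _     | no ¬s′ = ⊥-elim ([ ¬u′ , (λ (_ , s) → ¬s′ s) ]′ (cons⁻ b))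

  -- The bound on `cross` for near centres, of order N * M; far centres give only `κ`, of order M².
  Y : ℕ
  Y = N * (c * M)

  Far : Subset n → Subset n → Set
  Far T T′ = 2 + ∣ T ∩ T′ ∣ ≤ t

  near-or-far : ∀ T T′ → ∣ T ∣ ≡ t → ∣ T′ ∣ ≡ t → ∣ T ∪ T′ ∣ ≤ suc t ⊎ Far T T′
  near-or-far T T′ ∣T∣ ∣T′∣ with 2 + ∣ T ∩ T′ ∣ ≤? t
  ... | yes far = inj₂ far
  ... | no ¬far = inj₁ (+-cancelʳ-≤ ∣ T ∩ T′ ∣ _ _ (begin
    ∣ T ∪ T′ ∣ + ∣ T ∩ T′ ∣   ≡⟨ ∣p∪q∣+∣p∩q∣≡∣p∣+∣q∣ T T′ ⟩
    ∣ T ∣ + ∣ T′ ∣           ≡⟨ cong₂ _+_ ∣T∣ ∣T′∣ ⟩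
    t + t                   ≤⟨ +-monoʳ-≤ t (≤-pred (≰⇒> ¬far)) ⟩
    t + suc ∣ T ∩ T′ ∣       ≡⟨ +-suc t _ ⟩
    suc t + ∣ T ∩ T′ ∣       ∎))
    where open ≤-Reasoning

  -- Up to an error of order M², the number of t-intersecting pairs in q stars centred at pairwise near t-sets.
  Ib : ℕ → ℕ
  Ib zero    = 0
  Ib (suc q) = Ib q + N * N + 2 * (q * Y)

  module _ (NM₂ : N * M₂ ≤ M * M) (κ≤Y : κ ≤ Y) where

    cross≤Y : ∀ {T T′ : Subset n} → ∣ T ∣ ≡ t → ∣ T′ ∣ ≡ t → cross T T′ ≤ Y
    cross≤Y {T} {T′} ∣T∣ ∣T′∣ with near-or-far T T′ ∣T∣ ∣T′∣
    ... | inj₁ near = cross-near ∣T∣ ∣T′∣ near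
    ... | inj₂ far  = ≤-trans (cross-far NM₂ ∣T∣ ∣T′∣ far) κ≤Y

    crosses≤ : ∀ T 𝒯 → ∣ T ∣ ≡ t → Sized 𝒯 → crosses T 𝒯 ≤ length 𝒯 * Y
    crosses≤ T [] _ _ = z≤n
    crosses≤ T (T′ ∷ 𝒯) ∣T∣ (∣T′∣ ∷ sz) = +-mono-≤ (cross≤Y ∣T∣ ∣T′∣) (crosses≤ T 𝒯 ∣T∣ sz)

    crosses-far≤ : ∀ T 𝒯 → ∣ T ∣ ≡ t → Sized 𝒯 → Any (Far T) 𝒯 → crosses T 𝒯 + Y ≤ length 𝒯 * Y + κ
    crosses-far≤ T (T′ ∷ 𝒯) ∣T∣ (∣T′∣ ∷ sz) (here far) = ≤-trans
      (+-monoˡ-≤ Y (+-mono-≤ (cross-far NM₂ ∣T∣ ∣T′∣ far) (crosses≤ T 𝒯 ∣T∣ sz))) (≤-reflexive (eq κ (length 𝒯 * Y) Y))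
      where
      eq : ∀ a b d → a + b + d ≡ d + b + a
      eq = solve-∀
    crosses-far≤ T (T′ ∷ 𝒯) ∣T∣ (∣T′∣ ∷ sz) (there far) = ≤-trans (≤-reflexive (+-assoc (cross T T′) _ _))
      (≤-trans (+-mono-≤ (cross≤Y ∣T∣ ∣T′∣) (crosses-far≤ T 𝒯 ∣T∣ sz far)) (≤-reflexive (sym (+-assoc Y _ κ))))

    I-U≤ : ∀ 𝒯 → Sized 𝒯 → I (U? 𝒯) ≤ Ib (length 𝒯)
    I-U≤ [] _ = ≤-trans (pairs-≤ Inter? (U? []) (U? []) 0 (λ { _ (_ , ()) })) (≤-reflexive (*-zeroʳ (# (U? []))))
    I-U≤ (T ∷ 𝒯) (∣T∣ ∷ sz) = ≤-trans (I-cons T 𝒯 ∣T∣)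
      (+-mono-≤ (+-monoˡ-≤ (N * N) (I-U≤ 𝒯 sz)) (*-monoʳ-≤ 2 (crosses≤ T 𝒯 ∣T∣ sz)))

    -- One far pair replaces a `Y` by a `κ`, twice because pairs are ordered.
    I-U-far≤ : ∀ 𝒯 → Sized 𝒯 → HasPair Far 𝒯 → I (U? 𝒯) + 2 * Y ≤ Ib (length 𝒯) + 2 * κ
    I-U-far≤ (T ∷ 𝒯) (∣T∣ ∷ sz) (here far) = begin
      I (U? (T ∷ 𝒯)) + 2 * Y                            ≤⟨ +-monoˡ-≤ (2 * Y) (I-cons T 𝒯 ∣T∣) ⟩
      I (U? 𝒯) + N * N + 2 * crosses T 𝒯 + 2 * Y        ≡⟨ eq (I (U? 𝒯)) (N * N) (crosses T 𝒯) Y ⟩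
      I (U? 𝒯) + N * N + 2 * (crosses T 𝒯 + Y)          ≤⟨ +-mono-≤ (+-monoˡ-≤ (N * N) (I-U≤ 𝒯 sz))
          (*-monoʳ-≤ 2 (crosses-far≤ T 𝒯 ∣T∣ sz far)) ⟩
      Ib (length 𝒯) + N * N + 2 * (length 𝒯 * Y + κ)    ≡⟨ sym (eq (Ib (length 𝒯)) (N * N) (length 𝒯 * Y) κ) ⟩
      Ib (suc (length 𝒯)) + 2 * κ                       ∎
      where
      open ≤-Reasoning
      eq : ∀ a b d e → a + b + 2 * d + 2 * e ≡ a + b + 2 * (d + e)
      eq = solve-∀
    I-U-far≤ (T ∷ 𝒯) (∣T∣ ∷ sz) (there far) = begin
      I (U? (T ∷ 𝒯)) + 2 * Y                            ≤⟨ +-monoˡ-≤ (2 * Y) (I-cons T 𝒯 ∣T∣) ⟩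
      I (U? 𝒯) + N * N + 2 * crosses T 𝒯 + 2 * Y        ≡⟨ eq (I (U? 𝒯)) (N * N) (crosses T 𝒯) (2 * Y) ⟩
      (I (U? 𝒯) + 2 * Y) + N * N + 2 * crosses T 𝒯      ≤⟨ +-mono-≤ (+-monoˡ-≤ (N * N) (I-U-far≤ 𝒯 sz far))
          (*-monoʳ-≤ 2 (crosses≤ T 𝒯 ∣T∣ sz)) ⟩
      (Ib (length 𝒯) + 2 * κ) + N * N + 2 * (length 𝒯 * Y) ≡⟨ sym (eq (Ib (length 𝒯)) (N * N) (length 𝒯 * Y) (2 * κ)) ⟩
      Ib (suc (length 𝒯)) + 2 * κ                       ∎
      where
      open ≤-Reasoning
      eq : ∀ a b d e → a + b + 2 * d + e ≡ (a + e) + b + 2 * d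
      eq = solve-∀

-- Error terms and expansions in N, M and M₂

module ErrorTerms (c : ℕ) where

  -- `δ` and `ε` are the accumulated coefficients of M₂ in `B-w` and `tel-w`, and `er` that of M² in
  -- `Λ-lower`; each increment is the one that the corresponding induction produces.
  δ ε er : ℕ → ℕ
  δ zero    = 0
  δ (suc j) = δ j + suc c * (j + suc c)
  ε zero    = 0
  ε (suc j) = ε j + c * (suc j + c)
  er zero    = 0
  er (suc q) = er q + ((c + suc q) * (c + suc q) + 2 * (q * c) * (c + suc q) + 2 * δ (suc q))

module Estimates (n t c′ : ℕ) where
  c : ℕ
  c = suc c′
  open ErrorTerms c public
  open Stars n t c
  open Sunflowers n t c
  open PureFamilies n t c
  open CrossingPairs n t c

  x∸ : ∀ j → x ∸ j ≡ m ∸ (c + j)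
  x∸ j = trans (cong (_∸ j) (sym (∸-+-assoc n t c))) (∸-+-assoc m c j)

  K-lower : ∀ j → N ≤ bin (x ∸ j) c + (c + j) * M
  K-lower j = subst (λ z → N ≤ bin z c + (c + j) * M) (sym (x∸ j)) (bin-upper m (c + j) c)

  -- Each of the b steps from m - a - b up to m - a gains at least the increment at the lower end,
  -- which is M up to (a + b) * M₂.
  drop : ∀ a b → a + b ≤ m → bin (m ∸ (a + b)) c + b * M ≤ bin (m ∸ a) c + b * (a + b) * M₂
  drop a b a+b≤m = begin
    bin (m ∸ (a + b)) c + b * M
      ≤⟨ +-monoʳ-≤ (bin (m ∸ (a + b)) c) (*-monoʳ-≤ b M≤) ⟩
    bin (m ∸ (a + b)) c + b * (bin (m ∸ (a + b)) c′ + (a + b) * M₂)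
      ≡⟨ eq (bin (m ∸ (a + b)) c) b (bin (m ∸ (a + b)) c′) (a + b) M₂ ⟩
    (bin (m ∸ (a + b)) c + b * bin (m ∸ (a + b)) c′) + b * (a + b) * M₂
      ≤⟨ +-monoˡ-≤ _ (bin-lower (m ∸ (a + b)) b c) ⟩
    bin (b + (m ∸ (a + b))) c + b * (a + b) * M₂
      ≡⟨ cong (λ z → bin z c + b * (a + b) * M₂) back ⟩
    bin (m ∸ a) c + b * (a + b) * M₂ ∎
    where
    open ≤-Reasoning
    eq : ∀ u b v a M → u + b * (v + a * M) ≡ (u + b * v) + b * a * M
    eq = solve-∀
    back : b + (m ∸ (a + b)) ≡ m ∸ a
    back = trans (cong (b +_) (sym (∸-+-assoc m a b))) (m+[n∸m]≡n (m+n≤o⇒m≤o∸n b (subst (_≤ m) (+-comm a b) a+b≤m)))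
    M≤ : M ≤ bin (m ∸ (a + b)) c′ + (a + b) * M₂
    M≤ = begin
      bin (m ∸ 1) c′                                             ≤⟨ bin-upper (m ∸ 1) (a + b) c′ ⟩
      bin (m ∸ 1 ∸ (a + b)) c′ + (a + b) * bin⁻ (m ∸ 1 ∸ 1) c′   ≤⟨ +-mono-≤ (bin-mono c′ (∸-monoˡ-≤ (a + b) (m∸n≤m m 1)))
          (≤-reflexive (cong (λ z → (a + b) * bin⁻ z c′) (∸-+-assoc m 1 1))) ⟩
      bin (m ∸ (a + b)) c′ + (a + b) * M₂                        ∎

  -- Corresponding summands of `w` and `B` have upper indices c + 1 apart, so they differ by at
  -- least (c + 1) * M up to a multiple of M₂.
  B-w : ∀ j → c + j ≤ m → w j + j * suc c * M ≤ B j + δ j * M₂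
  B-w zero    _    = z≤n
  B-w (suc j) room = begin
    w j + bin (x ∸ suc j) c + suc j * suc c * M          ≡⟨ cong (λ z → w j + bin z c + suc j * suc c * M)
        (trans (x∸ (suc j)) (cong (m ∸_) (trans (+-suc c j) (+-comm (suc c) j)))) ⟩
    w j + bin (m ∸ (j + suc c)) c + suc j * suc c * M    ≡⟨ eq₁ (w j) (bin (m ∸ (j + suc c)) c) j (suc c) M ⟩
    (w j + j * suc c * M) + (bin (m ∸ (j + suc c)) c + suc c * M)
      ≤⟨ +-mono-≤ (B-w j (≤-trans (+-monoʳ-≤ c (n≤1+n j)) room))
          (drop j (suc c) (≤-trans (≤-reflexive (trans (+-comm j (suc c)) (sym (+-suc c j)))) room)) ⟩
    (B j + δ j * M₂) + (bin (m ∸ j) c + suc c * (j + suc c) * M₂) ≡⟨ eq₂ (B j) (δ j) M₂ (bin (m ∸ j) c) (suc c * (j + suc c)) ⟩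
    B (suc j) + δ (suc j) * M₂ ∎
    where
    open ≤-Reasoning
    eq₁ : ∀ w b j d M → w + b + suc j * d * M ≡ (w + j * d * M) + (b + d * M)
    eq₁ = solve-∀
    eq₂ : ∀ B e M b f → (B + e * M) + (b + f * M) ≡ (B + b) + (e + f) * M
    eq₂ = solve-∀

  -- The same comparison once the first summand N of `B` is split off, which shortens the distance
  -- of the indices to c.
  tel-w : ∀ j → c + j ≤ m → w j + j * c * M ≤ tel j m c + ε j * M₂
  tel-w zero    _    = z≤n
  tel-w (suc j) room = begin
    w j + bin (x ∸ suc j) c + suc j * c * M          ≡⟨ cong (λ z → w j + bin z c + suc j * c * M)
        (trans (x∸ (suc j)) (cong (m ∸_) (+-comm c (suc j)))) ⟩
    w j + bin (m ∸ (suc j + c)) c + suc j * c * M    ≡⟨ eq₁ (w j) (bin (m ∸ (suc j + c)) c) j c M ⟩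
    (w j + j * c * M) + (bin (m ∸ (suc j + c)) c + c * M)
      ≤⟨ +-mono-≤ (tel-w j (≤-trans (+-monoʳ-≤ c (n≤1+n j)) room))
          (drop (suc j) c (≤-trans (≤-reflexive (+-comm (suc j) c)) room)) ⟩
    (tel j m c + ε j * M₂) + (bin (m ∸ suc j) c + c * (suc j + c) * M₂) ≡⟨ eq₂ (tel j m c) (ε j) M₂ (bin (m ∸ suc j) c)
        (c * (suc j + c)) ⟩
    tel (suc j) m c + ε (suc j) * M₂ ∎
    where
    open ≤-Reasoning
    eq₁ : ∀ w b j d M → w + b + suc j * d * M ≡ (w + j * d * M) + (b + d * M)
    eq₁ = solve-∀
    eq₂ : ∀ B e M b f → (B + e * M) + (b + f * M) ≡ (B + b) + (e + f) * M
    eq₂ = solve-∀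

  w≤qN : ∀ q → w q ≤ q * N
  w≤qN q = ≤-trans (tel-≤ q x c) (*-monoʳ-≤ q (bin-mono c (≤-trans (m∸n≤m x 1) (∸-monoʳ-≤ n (m≤m+n t c)))))

  -- Each of the q summands of `w` falls short of N by at most (c + q) * M.
  w-lower : ∀ q → q * N ≤ w q + q * (c + q) * M
  w-lower q = ≤-trans (go q) (+-monoʳ-≤ (w q) (*-monoˡ-≤ M (er≤ q)))
    where
    open ≤-Reasoning
    s : ℕ → ℕ
    s zero    = 0
    s (suc j) = s j + (c + suc j)
    er≤ : ∀ j → s j ≤ j * (c + j)
    er≤ zero    = z≤n
    er≤ (suc j) = ≤-trans (+-monoˡ-≤ (c + suc j) (≤-trans (er≤ j) (*-monoʳ-≤ j (+-monoʳ-≤ c (n≤1+n j)))))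
        (≤-reflexive (+-comm _ (c + suc j)))
    go : ∀ j → j * N ≤ w j + s j * M
    go zero    = z≤n
    go (suc j) = ≤-trans (+-mono-≤ (K-lower (suc j)) (go j)) (≤-reflexive (eq (bin (x ∸ suc j) c) (c + suc j) M (w j) (s j)))
      where
      eq : ∀ b d M w s → b + d * M + (w + s * M) ≡ (w + b) + (s + d) * M
      eq = solve-∀

  module _ (NM₂ : N * M₂ ≤ M * M) where

    -- Both sides grow by amounts that can be expanded around K: the left one through N ≤ K + a * M,
    -- the right one through `B-w`. The terms of order K² and K * M agree exactly, and only
    -- multiples of M² remain.
    Λ-lower : ∀ q → c + q ≤ m → w q * w q + Ib q ≤ 2 * Λ q + er q * (M * M)
    Λ-lower zero    _    = z≤n
    Λ-lower (suc q) room = begin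
      (w q + K) * (w q + K) + (Ib q + N * N + 2 * (q * (N * (c * M))))
        ≡⟨ eq₁ (w q) K (Ib q) N q c M ⟩
      (w q * w q + Ib q) + (K * (2 * w q + K) + (N * N + 2 * (q * c) * (N * M)))
        ≤⟨ +-mono-≤ (Λ-lower q (≤-trans (+-monoʳ-≤ c (n≤1+n q)) room))
            (+-monoʳ-≤ (K * (2 * w q + K)) (+-mono-≤ (*-mono-≤ kl kl) (*-monoʳ-≤ (2 * (q * c)) (*-monoˡ-≤ M kl)))) ⟩
      (2 * Λ q + er q * (M * M)) + (K * (2 * w q + K) + ((K + a * M) * (K + a * M) + 2 * (q * c) * ((K + a * M) * M)))
        -- The coefficients of K * M agree because (c + q + 1) + q * c = (q + 1) * (c + 1).
        ≡⟨ eq₂ (2 * Λ q + er q * (M * M)) K (w q) M q c ⟩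
      (2 * Λ q + er q * (M * M)) + (2 * ((w q + K + suc q * suc c * M) * K) + (a * a + 2 * (q * c) * a) * (M * M))
        ≤⟨ +-monoʳ-≤ (2 * Λ q + er q * (M * M)) (+-monoˡ-≤ _ (*-monoʳ-≤ 2 (*-monoˡ-≤ K (B-w (suc q) room)))) ⟩
      (2 * Λ q + er q * (M * M)) + (2 * ((B (suc q) + δ (suc q) * M₂) * K) + (a * a + 2 * (q * c) * a) * (M * M))
        ≡⟨ eq₃ (Λ q) (er q) (M * M) (B (suc q)) (δ (suc q)) M₂ K (a * a + 2 * (q * c) * a) ⟩
      2 * (Λ q + B (suc q) * K) + (er q + (a * a + 2 * (q * c) * a)) * (M * M) + 2 * δ (suc q) * (K * M₂)
        ≤⟨ +-monoʳ-≤ (2 * Λ (suc q) + (er q + (a * a + 2 * (q * c) * a)) * (M * M))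
            (*-monoʳ-≤ (2 * δ (suc q)) (≤-trans (*-monoˡ-≤ M₂ K≤N) NM₂)) ⟩
      2 * Λ (suc q) + (er q + (a * a + 2 * (q * c) * a)) * (M * M) + 2 * δ (suc q) * (M * M)
        ≡⟨ eq₄ (2 * Λ (suc q)) (er q) (a * a + 2 * (q * c) * a) (M * M) (2 * δ (suc q)) ⟩
      2 * Λ (suc q) + er (suc q) * (M * M) ∎
      where
      open ≤-Reasoning
      K = bin (x ∸ suc q) c
      a = c + suc q
      kl : N ≤ K + a * M
      kl = K-lower (suc q)
      K≤N : K ≤ N
      K≤N = bin-mono c (≤-trans (m∸n≤m x (suc q)) (∸-monoʳ-≤ n (m≤m+n t c)))
      eq₁ : ∀ w K I N q c M → (w + K) * (w + K) + (I + N * N + 2 * (q * (N * (c * M)))) ≡ (w * w + I) +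
          (K * (2 * w + K) + (N * N + 2 * (q * c) * (N * M)))
      eq₁ = solve-∀
      eq₂ : ∀ L K w M q c → L + (K * (2 * w + K) +
          ((K + (c + suc q) * M) * (K + (c + suc q) * M) + 2 * (q * c) * ((K + (c + suc q) * M) * M)))
          ≡ L + (2 * ((w + K + suc q * suc c * M) * K) + ((c + suc q) * (c + suc q) + 2 * (q * c) * (c + suc q)) * (M * M))
      eq₂ = solve-∀
      eq₃ : ∀ L e MM B d M₂ K f → (2 * L + e * MM) + (2 * ((B + d * M₂) * K) + f * MM) ≡ 2 * (L + B * K) + (e + f) * MM + 2 * d *
          (K * M₂)
      eq₃ = solve-∀
      eq₄ : ∀ L e f MM d → L + (e + f) * MM + d * MM ≡ L + (e + (f + d)) * MM
      eq₄ = solve-∀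

-- Tangent inequalities for squares

square-tangent-≤ : ∀ u w → 2 * (w * u) ≤ u * u + w * w
square-tangent-≤ u w with ≤-total u w
... | inj₁ u≤w with m≤n⇒∃[o]m+o≡n u≤w
...   | v , refl = ≤-trans (m≤m+n _ (v * v)) (≤-reflexive (eq u v))
  where
  eq : ∀ u v → 2 * ((u + v) * u) + v * v ≡ u * u + (u + v) * (u + v)
  eq = solve-∀
square-tangent-≤ u w | inj₂ w≤u with m≤n⇒∃[o]m+o≡n w≤u
...   | v , refl = ≤-trans (m≤m+n _ (v * v)) (≤-reflexive (eq w v))
  where
  eq : ∀ w v → 2 * (w * (w + v)) + v * v ≡ (w + v) * (w + v) + w * w
  eq = solve-∀

square-shift : ∀ S θ E → S ≤ θ + E → S * S ≤ θ * θ + 2 * (E * S)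
square-shift S θ E h with ≤-total S θ
... | inj₁ S≤θ = ≤-trans (*-mono-≤ S≤θ S≤θ) (m≤m+n _ _)
... | inj₂ θ≤S with m≤n⇒∃[o]m+o≡n θ≤S
...   | r , refl = begin
    (θ + r) * (θ + r)                      ≤⟨ m≤m+n _ (r * r) ⟩
    (θ + r) * (θ + r) + r * r              ≡⟨ eq θ r ⟩
    θ * θ + 2 * (r * (θ + r))              ≤⟨ +-monoʳ-≤ (θ * θ) (*-monoʳ-≤ 2 (*-monoˡ-≤ (θ + r) (+-cancelˡ-≤ θ r E h))) ⟩
    θ * θ + 2 * (E * (θ + r))              ∎
  where
  open ≤-Reasoning
  eq : ∀ θ r → (θ + r) * (θ + r) + r * r ≡ θ * θ + 2 * (r * (θ + r))
  eq = solve-∀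

-- The tangent inequality discards (u - w)². If u ≥ w, this square is at least S² - 2ES; if u ≤ w,
-- the hypothesis gives S ≤ E and hence S² ≤ ES.
square-tangent-gap : ∀ u w S E → w + S ≤ u + E → 2 * (w * u) + S * S ≤ u * u + w * w + 2 * (E * S)
square-tangent-gap u w S E h with ≤-total u w
... | inj₁ u≤w with m≤n⇒∃[o]m+o≡n u≤w
...   | v , refl = begin
    2 * ((u + v) * u) + S * S                      ≤⟨ +-monoʳ-≤ (2 * ((u + v) * u)) (*-monoˡ-≤ S S≤E) ⟩
    2 * ((u + v) * u) + E * S                      ≤⟨ m≤m+n _ (v * v + E * S) ⟩
    2 * ((u + v) * u) + E * S + (v * v + E * S)    ≡⟨ eq u v (E * S) ⟩
    u * u + (u + v) * (u + v) + 2 * (E * S)        ∎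
  where
  open ≤-Reasoning
  S≤E : S ≤ E
  S≤E = ≤-trans (m≤n+m S v) (+-cancelˡ-≤ u _ _ (≤-trans (≤-reflexive (sym (+-assoc u v S))) h))
  eq : ∀ u v e → 2 * ((u + v) * u) + e + (v * v + e) ≡ u * u + (u + v) * (u + v) + 2 * e
  eq = solve-∀
square-tangent-gap u w S E h | inj₂ w≤u with m≤n⇒∃[o]m+o≡n w≤u
...   | θ , refl = begin
    2 * (w * (w + θ)) + S * S                        ≤⟨ +-monoʳ-≤ (2 * (w * (w + θ)))
        (square-shift S θ E (+-cancelˡ-≤ w _ _ (≤-trans h (≤-reflexive (+-assoc w θ E))))) ⟩
    2 * (w * (w + θ)) + (θ * θ + 2 * (E * S))        ≡⟨ eq w θ (2 * (E * S)) ⟩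
    (w + θ) * (w + θ) + w * w + 2 * (E * S)          ∎
  where
  open ≤-Reasoning
  eq : ∀ w θ e → 2 * (w * (w + θ)) + (θ * θ + e) ≡ (w + θ) * (w + θ) + w * w + e
  eq = solve-∀

-- Configurations of centres

module Shapes (n t c′ : ℕ) where
  open Estimates n t c′
  open Stars n t c
  open Sunflowers n t c
  open PureFamilies n t c
  open CrossingPairs n t c

  square≤D+I : {P : Subset n → Set} (P? : Decidable P) → # P? * # P? ≤ D P? + I P?
  square≤D+I {P} P? = ≤-trans
    (##-≥ P? (λ A B → P? A ×-dec P? B) (# P?) (λ A p → #-mono P? (λ B → P? A ×-dec P? B) (λ B → p ,_)))
    (##-union (λ A B → P? A ×-dec P? B) (λ A B → P? A ×-dec P? B ×-dec Disj? A B) (λ A B → P? A ×-dec P? B ×-dec Inter? A B) split)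
    where
    split : ∀ A B → P A × P B → (P A × P B × ∣ A ∩ B ∣ < t) ⊎ (P A × P B × t ≤ ∣ A ∩ B ∣)
    split A B (a , b) with <-≤-connex ∣ A ∩ B ∣ t
    ... | inj₁ d = inj₁ (a , b , d)
    ... | inj₂ i = inj₂ (a , b , i)

  -- `Good` with a surplus of N * M, out of which the sets missing from almost full stars are paid.
  Gap : ℕ → List (Subset n) → Set
  Gap q 𝒯 = 2 * (w q * # (U? 𝒯)) + N * M ≤ D (U? 𝒯) + 2 * Λ q

  -- A set outside the older stars has at least `w q` disjoint partners in their union, so one more
  -- star keeps the inequality at the old slope.
  good-extend : 0 < t → ∀ T 𝒯 → Sized (T ∷ 𝒯) → Unique (T ∷ 𝒯) → Good (length 𝒯) 𝒯 → Good (length 𝒯) (T ∷ 𝒯)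
  good-extend 0<t T 𝒯 (∣T∣ ∷ sz) (ne ∷ un) g = begin
    2 * (w q * # (U? (T ∷ 𝒯)))                       ≡⟨ cong (λ z → 2 * (w q * z)) (U-cons-new T 𝒯) ⟩
    2 * (w q * (u + v))                              ≡⟨ eq₁ (w q) u v ⟩
    2 * (w q * u) + 2 * (v * w q)                    ≤⟨ +-monoˡ-≤ (2 * (v * w q)) g ⟩
    D (U? 𝒯) + 2 * Λ q + 2 * (v * w q)               ≡⟨ eq₂ (D (U? 𝒯)) (2 * Λ q) (2 * (v * w q)) ⟩
    D (U? 𝒯) + 2 * (v * w q) + 2 * Λ q               ≤⟨ +-monoˡ-≤ (2 * Λ q)
        (D-cons T 𝒯 (w q) λ A ((e , _) , ¬u) → disj-U-≥ 0<t A 𝒯 e sz un (notU⇒ 𝒯 e ¬u)) ⟩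
    D (U? (T ∷ 𝒯)) + 2 * Λ q                         ∎
    where
    open ≤-Reasoning
    q = length 𝒯
    u = # (U? 𝒯)
    v = # (star? T ∖? U? 𝒯)
    eq₁ : ∀ a u v → 2 * (a * (u + v)) ≡ 2 * (a * u) + 2 * (v * a)
    eq₁ = solve-∀
    eq₂ : ∀ a b d → a + b + d ≡ a + d + b
    eq₂ = solve-∀

  Far-sym : ∀ {T T′} → Far T T′ → Far T′ T
  Far-sym {T} {T′} = subst (λ z → 2 + ∣ z ∣ ≤ t) (∩-comm T T′)

  hasPair : ∀ {T T′ 𝒯} → T ∈ₗ 𝒯 → T′ ∈ₗ 𝒯 → Far T T′ → ∣ T ∣ ≡ t → HasPair Far 𝒯
  hasPair {T} (here refl) (here refl) far ∣T∣ = ⊥-elim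
      (<⇒≱ (≤-trans (n≤1+n _) far) (≤-trans (≤-reflexive (sym ∣T∣)) (∣p∩q∣≥∣q∣ {p = T} {q = T} ⊆-refl)))
  hasPair (here refl) (there b) far _ = here (Any.map (λ { refl → far }) b)
  hasPair {T} {T′} (there a) (here refl) far _ = here (Any.map (λ { refl → Far-sym {T} {T′} far }) a)
  hasPair (there a) (there b) far ∣T∣ = there (hasPair a b far ∣T∣)

  data Shape (𝒯 : List (Subset n)) : Set where
    sunflower : ∀ {Z} → suc ∣ Z ∣ ≡ t → All (Z ⊆_) 𝒯 → Shape 𝒯
    pure      : ∀ {Y} → ∣ Y ∣ ≡ suc t → All (_⊆ Y) 𝒯 → 3 ≤ length 𝒯 → Shape 𝒯
    far       : HasPair Far 𝒯 → Shape 𝒯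

  private
    near-∩ : ∀ {T T′ : Subset n} → ∣ T ∣ ≡ t → ∣ T′ ∣ ≡ t → ∣ T ∪ T′ ∣ ≤ suc t → t ≤ suc ∣ T ∩ T′ ∣
    near-∩ {T} {T′} ∣T∣ ∣T′∣ near = +-cancelˡ-≤ t _ _ (begin
      t + t                      ≡⟨ cong₂ _+_ (sym ∣T∣) (sym ∣T′∣) ⟩
      ∣ T ∣ + ∣ T′ ∣              ≡⟨ sym (∣p∪q∣+∣p∩q∣≡∣p∣+∣q∣ T T′) ⟩
      ∣ T ∪ T′ ∣ + ∣ T ∩ T′ ∣     ≤⟨ +-monoˡ-≤ ∣ T ∩ T′ ∣ near ⟩
      suc t + ∣ T ∩ T′ ∣         ≡⟨ sym (+-suc t _) ⟩
      t + suc ∣ T ∩ T′ ∣         ∎)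
      where open ≤-Reasoning

    -- A set T that does not contain T₁ ∩ T₂ meets it in at most t - 2 elements, and
    -- inclusion-exclusion places at least 2 (t - 1) - (t - 2) = t elements of T in T₁ ∪ T₂.
    ⊆-union : ∀ {T T₁ T₂ : Subset n} → ∣ T ∣ ≡ t → suc ∣ T₁ ∩ T₂ ∣ ≡ t → t ≤ suc ∣ T ∩ T₁ ∣ → t ≤ suc ∣ T ∩ T₂ ∣ →
              ¬ T₁ ∩ T₂ ⊆ T → T ⊆ T₁ ∪ T₂
    ⊆-union {T} {T₁} {T₂} ∣T∣ ∣Z∣ n₁ n₂ Z⊈T {z} z∈T = p∩q⊆q T V
        (subst (z ∈_) (sym (⊆∧∣∣≥⇒≡ (p∩q⊆p T V) (≤-trans (≤-reflexive ∣T∣) big))) z∈T)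
      where
      open ≤-Reasoning
      Z = T₁ ∩ T₂
      V = T₁ ∪ T₂
      small : suc (suc ∣ T ∩ Z ∣) ≤ t
      small = ≤-trans (s≤s (⊈⇒∣∩∣< Z⊈T)) (≤-reflexive ∣Z∣)
      big : t ≤ ∣ T ∩ V ∣
      big = +-cancelʳ-≤ (suc (suc ∣ T ∩ Z ∣)) _ _ (begin
        t + suc (suc ∣ T ∩ Z ∣)                       ≤⟨ +-monoʳ-≤ t small ⟩
        t + t                                         ≤⟨ +-mono-≤ n₁ n₂ ⟩
        suc ∣ T ∩ T₁ ∣ + suc ∣ T ∩ T₂ ∣                ≡⟨ cong suc (+-suc ∣ T ∩ T₁ ∣ _) ⟩
        suc (suc (∣ T ∩ T₁ ∣ + ∣ T ∩ T₂ ∣))            ≡⟨ cong (λ v → suc (suc v)) (sym (∣p∪q∣+∣p∩q∣≡∣p∣+∣q∣ (T ∩ T₁) (T ∩ T₂))) ⟩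
        suc (suc (∣ (T ∩ T₁) ∪ (T ∩ T₂) ∣ + ∣ (T ∩ T₁) ∩ (T ∩ T₂) ∣))
          ≤⟨ s≤s (s≤s (+-mono-≤ (p⊆q⇒∣p∣≤∣q∣ λ v∈ → [ (λ a → x∈p∩q⁺ (p∩q⊆p T T₁ a , x∈p∪q⁺ (inj₁ (p∩q⊆q T T₁ a)))) ,
              (λ b → x∈p∩q⁺ (p∩q⊆p T T₂ b , x∈p∪q⁺ (inj₂ (p∩q⊆q T T₂ b)))) ]′ (x∈p∪q⁻ (T ∩ T₁) (T ∩ T₂) v∈))
               (p⊆q⇒∣p∣≤∣q∣ λ v∈ → let a , b = x∈p∩q⁻ (T ∩ T₁) (T ∩ T₂) v∈ in x∈p∩q⁺ (p∩q⊆p T T₁ a , x∈p∩q⁺ (p∩q⊆q T T₁ a , p∩q⊆q T T₂ b))))) ⟩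
        suc (suc (∣ T ∩ V ∣ + ∣ T ∩ Z ∣))              ≡⟨ sym (trans (+-suc _ _) (cong suc (+-suc _ _))) ⟩
        ∣ T ∩ V ∣ + suc (suc ∣ T ∩ Z ∣)               ∎)

    -- V ∩ T′ contains Z and is smaller than T′, hence it equals Z. So T ∩ T′ lies in T ∩ Z, which
    -- is a proper part of Z.
    far-apart : ∀ {T T′ Z V : Subset n} → suc ∣ Z ∣ ≡ t → Z ⊆ V → T ⊆ V → ¬ Z ⊆ T → Z ⊆ T′ → ∣ T′ ∣ ≡ t → ¬ T′ ⊆ V → Far T T′
    far-apart {T} {T′} {Z} {V} ∣Z∣ Z⊆V T⊆V Z⊈T Z⊆T′ ∣T′∣ T′⊈V =
      ≤-trans (s≤s (≤-trans (s≤s (p⊆q⇒∣p∣≤∣q∣ λ {z} z∈ → let a , b = x∈p∩q⁻ T T′ z∈ in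
          x∈p∩q⁺ (a , subst (z ∈_) (sym Y∩T′≡Z) (x∈p∩q⁺ (T⊆V a , b))))) (⊈⇒∣∩∣< Z⊈T))) (≤-reflexive ∣Z∣)
      where
      Y∩T′≡Z : Z ≡ V ∩ T′
      Y∩T′≡Z = ⊆∧∣∣≥⇒≡ (λ z∈ → x∈p∩q⁺ (Z⊆V z∈ , Z⊆T′ z∈)) (≤-pred (≤-trans (⊈⇒∣∩∣< T′⊈V) (≤-reflexive (trans ∣T′∣ (sym ∣Z∣)))))

  -- Two near centres leave one candidate each for the core and for the enclosing set, Z and V. A
  -- centre near to both that does not contain Z lies in V. If both descriptions fail, there is a
  -- far pair with T₁ or T₂, or a centre in V without Z and another with Z outside V, and these two
  -- are far.
  classify : ∀ T₁ T₂ 𝒯 → Sized (T₁ ∷ T₂ ∷ 𝒯) → Unique (T₁ ∷ T₂ ∷ 𝒯) → Shape (T₁ ∷ T₂ ∷ 𝒯)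
  classify T₁ T₂ 𝒯 sz@(∣T₁∣ ∷ ∣T₂∣ ∷ _) ((T₁≢T₂ ∷ _) ∷ _) = go (near-or-far T₁ T₂ ∣T₁∣ ∣T₂∣)
    where
    Z = T₁ ∩ T₂
    V = T₁ ∪ T₂
    ℱ = T₁ ∷ T₂ ∷ 𝒯
    go : ∣ V ∣ ≤ suc t ⊎ Far T₁ T₂ → Shape ℱ
    go (inj₂ f) = far (here (here f))
    go (inj₁ near) = cases (All.all? (Z ⊆?_) ℱ) (All.all? (_⊆? V) ℱ)
      where
      ∣Z∣ : suc ∣ Z ∣ ≡ t
      ∣Z∣ = ≤-antisym (≤-trans (⊈⇒∣∩∣< {A = T₁} {T₂} λ s → T₁≢T₂ (sym (⊆∧∣∣≥⇒≡ s (≤-reflexive (trans ∣T₁∣ (sym ∣T₂∣))))))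
          (≤-reflexive ∣T₂∣)) (near-∩ {T₁} {T₂} ∣T₁∣ ∣T₂∣ near)
      ∣V∣ : ∣ V ∣ ≡ suc t
      ∣V∣ = +-cancelʳ-≡ ∣ Z ∣ _ _ (trans (∣p∪q∣+∣p∩q∣≡∣p∣+∣q∣ T₁ T₂)
          (trans (cong₂ _+_ ∣T₁∣ (trans ∣T₂∣ (sym ∣Z∣))) (+-suc t ∣ Z ∣)))
      inside : ∀ {T} → T ∈ₗ ℱ → ¬ Z ⊆ T → T ⊆ V ⊎ HasPair Far ℱ
      inside {T} T∈ Z⊈T with near-or-far T T₁ (All.lookup sz T∈) ∣T₁∣ | near-or-far T T₂ (All.lookup sz T∈) ∣T₂∣
      ... | inj₁ n₁ | inj₁ n₂ = inj₁ (⊆-union ∣T∣ ∣Z∣ (near-∩ {T} {T₁} ∣T∣ ∣T₁∣ n₁) (near-∩ {T} {T₂} ∣T∣ ∣T₂∣ n₂) Z⊈T)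
        where ∣T∣ = All.lookup sz T∈
      ... | inj₂ f  | _       = inj₂ (hasPair T∈ (here refl) f (All.lookup sz T∈))
      ... | inj₁ _  | inj₂ f  = inj₂ (hasPair T∈ (there (here refl)) f (All.lookup sz T∈))
      -- Two centres always contain their intersection, so the pure case is left with at least
      -- three, as `pure-gap` requires.
      three : ∀ 𝒯′ → ¬ All (Z ⊆_) (T₁ ∷ T₂ ∷ 𝒯′) → 3 ≤ length (T₁ ∷ T₂ ∷ 𝒯′)
      three []      ¬all = ⊥-elim (¬all (p∩q⊆p T₁ T₂ ∷ p∩q⊆q T₁ T₂ ∷ []))
      three (_ ∷ _) _    = s≤s (s≤s (s≤s z≤n))
      cases : Dec (All (Z ⊆_) ℱ) → Dec (All (_⊆ V) ℱ) → Shape ℱ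
      cases (yes all) _         = sunflower ∣Z∣ all
      cases (no ¬all) (yes all) = pure ∣V∣ all (three 𝒯 ¬all)
      cases (no ¬Z)   (no ¬V)   with find (¬All⇒Any¬ (Z ⊆?_) ℱ ¬Z) | find (¬All⇒Any¬ (_⊆? V) ℱ ¬V)
      ... | T , T∈ , Z⊈T | T′ , T′∈ , T′⊈V with inside T∈ Z⊈T | Z ⊆? T′
      ...   | inj₂ f | _ = far f
      ...   | inj₁ T⊆V | yes Z⊆T′ = far (hasPair T∈ T′∈
          (far-apart ∣Z∣ (λ z∈ → p⊆p∪q T₂ (p∩q⊆p T₁ T₂ z∈)) T⊆V Z⊈T Z⊆T′ (All.lookup sz T′∈) T′⊈V) (All.lookup sz T∈))
      ...   | inj₁ T⊆V | no Z⊈T′ with inside T′∈ Z⊈T′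
      ...     | inj₂ f = far f
      ...     | inj₁ T′⊆V = ⊥-elim (T′⊈V T′⊆V)

  module Large (q : ℕ) (0<t : 0 < t) (room : k + suc q ≤ n) (NM₂ : N * M₂ ≤ M * M) (κ≤Y : κ ≤ Y)
    (far-large : er q * (M * M) + 2 * (ε q * M₂ * (N + q * c * M)) + 2 * κ + N * M ≤ 2 * Y)
    (pure-large : 2 * (2 + c) * (M * M) ≤ N * M) where

    k≤n : k ≤ n
    k≤n = m+n≤o⇒m≤o k room

    t≤n : t ≤ n
    t≤n = ≤-trans (m≤m+n t c) k≤n

    q<x : suc q ≤ x
    q<x = m+n≤o⇒m≤o∸n (suc q) (subst (_≤ n) (+-comm k (suc q)) room)

    c+q<m : c + suc q ≤ m
    c+q<m = m+n≤o⇒m≤o∸n (c + suc q) (subst (_≤ n) (trans (+-assoc t c (suc q)) (+-comm t _)) room)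

    c+q≤m : c + q ≤ m
    c+q≤m = ≤-trans (+-monoʳ-≤ c (n≤1+n q)) c+q<m

    x≤m : x ≤ m
    x≤m = ∸-monoʳ-≤ n (m≤m+n t c)

    -- The size of the union only enters through (|U| − w q)² ≥ 0, and a far pair of centres loses 2 * Y t-intersecting pairs.
    far-good : ∀ 𝒯 → length 𝒯 ≡ q → Sized 𝒯 → HasPair Far 𝒯 → Good q 𝒯
    far-good 𝒯 refl sz f = +-cancelʳ-≤ (I (U? 𝒯) + (Ib q + w q * w q + er q * (M * M) + 2 * Y + 2 * κ)) _ _ (begin
      2 * (w q * u) + (I (U? 𝒯) + (Ib q + w q * w q + er q * (M * M) + 2 * Y + 2 * κ))
        ≡⟨ eq₁ (2 * (w q * u)) (I (U? 𝒯)) (Ib q) (w q * w q) (er q * (M * M)) (2 * Y) (2 * κ) ⟩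
      2 * (w q * u) + (I (U? 𝒯) + 2 * Y) + (w q * w q + Ib q) + (er q * (M * M) + 2 * κ)
        ≤⟨ +-mono-≤ (+-mono-≤ (+-mono-≤ (≤-trans (square-tangent-≤ u (w q)) (+-monoˡ-≤ (w q * w q) (square≤D+I (U? 𝒯))))
             (I-U-far≤ NM₂ κ≤Y 𝒯 sz f)) (Λ-lower NM₂ q c+q≤m)) small ⟩
      (D (U? 𝒯) + I (U? 𝒯) + w q * w q) + (Ib q + 2 * κ) + (2 * Λ q + er q * (M * M)) + 2 * Y
        ≡⟨ eq₂ (D (U? 𝒯)) (I (U? 𝒯)) (w q * w q) (Ib q) (2 * κ) (2 * Λ q) (er q * (M * M)) (2 * Y) ⟩
      D (U? 𝒯) + 2 * Λ q + (I (U? 𝒯) + (Ib q + w q * w q + er q * (M * M) + 2 * Y + 2 * κ)) ∎)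
      where
      open ≤-Reasoning
      u = # (U? 𝒯)
      small : er q * (M * M) + 2 * κ ≤ 2 * Y
      small = ≤-trans (+-monoˡ-≤ (2 * κ) (m≤m+n (er q * (M * M)) (2 * (ε q * M₂ * (N + q * c * M)))))
          (≤-trans (m≤m+n _ (N * M)) far-large)
      eq₁ : ∀ a i b ww e y k → a + (i + (b + ww + e + y + k)) ≡ a + (i + y) + (ww + b) + (e + k)
      eq₁ = solve-∀
      eq₂ : ∀ d i ww b k l e y → (d + i + ww) + (b + k) + (l + e) + y ≡ d + l + (i + (b + ww + e + y + k))
      eq₂ = solve-∀

    -- With q + 1 stars at slope `w q`, the size of U exceeds `w q` by about S. The square that
    -- `far-good` gives away now pays for the increment from `Ib q` to `Ib (suc q)`, and the far
    -- pair leaves 2 * Y against errors of order M² and the surplus N * M.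
    far-gap : ∀ 𝒯 → length 𝒯 ≡ suc q → Sized 𝒯 → Unique 𝒯 → HasPair Far 𝒯 → Gap q 𝒯
    far-gap 𝒯 len sz un f = +-cancelʳ-≤ rest _ _ (begin
      2 * (w q * u) + N * M + rest
        ≡⟨ eq₁ (2 * (w q * u)) (N * M) i (2 * Y) (w q * w q) (Ib q) (S * S) (N * N + 2 * (q * Y)) (er q * (M * M)) (2 * (E * S))
            (2 * κ) (u * u) ⟩
      u * u + (i + 2 * Y) + (w q * w q + Ib q) + (2 * (w q * u) + S * S) + (N * N + 2 * (q * Y)) +
          (er q * (M * M) + 2 * (E * S) + 2 * κ + N * M)
        ≤⟨ +-mono-≤ (+-mono-≤ (+-mono-≤ (+-mono-≤ (+-mono-≤ (square≤D+I (U? 𝒯)) I≤) (Λ-lower NM₂ q c+q≤m))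
             (square-tangent-gap u (w q) S E size)) S²) far-large ⟩
      (D (U? 𝒯) + i) + (Ib q + N * N + 2 * (q * Y) + 2 * κ) + (2 * Λ q + er q * (M * M)) +
          (u * u + w q * w q + 2 * (E * S)) + S * S + 2 * Y
        ≡⟨ eq₂ (D (U? 𝒯)) (2 * Λ q) i (2 * Y) (w q * w q) (Ib q) (S * S) (N * N) (2 * (q * Y)) (er q * (M * M)) (2 * (E * S))
            (2 * κ) (u * u) ⟩
      D (U? 𝒯) + 2 * Λ q + rest ∎)
      where
      open ≤-Reasoning
      u = # (U? 𝒯)
      i = I (U? 𝒯)
      -- Chosen so that S² covers N * N + 2 * (q * Y), the contribution of one more star to `Ib`.
      S = N + q * c * M
      E = ε q * M₂
      rest = i + 2 * Y + w q * w q + Ib q + S * S + (N * N + 2 * (q * Y)) + er q * (M * M) + 2 * (E * S) + 2 * κ + u * u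
      I≤ : i + 2 * Y ≤ Ib q + N * N + 2 * (q * Y) + 2 * κ
      I≤ = subst (λ z → i + 2 * Y ≤ Ib z + 2 * κ) len (I-U-far≤ NM₂ κ≤Y 𝒯 sz f)
      S² : N * N + 2 * (q * Y) ≤ S * S
      S² = ≤-trans (m≤m+n _ (q * c * M * (q * c * M))) (≤-reflexive (eq N q c M))
        where
        eq : ∀ N q c M → N * N + 2 * (q * (N * (c * M))) + q * c * M * (q * c * M) ≡ (N + q * c * M) * (N + q * c * M)
        eq = solve-∀
      size : w q + S ≤ u + E
      size = begin
        w q + (N + q * c * M)      ≡⟨ eq (w q) N (q * c * M) ⟩
        N + (w q + q * c * M)      ≤⟨ +-monoʳ-≤ N (tel-w q c+q≤m) ⟩
        N + (tel q m c + E)        ≡⟨ sym (+-assoc N _ E) ⟩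
        N + tel q m c + E          ≡⟨ cong (_+ E) (sym (tel-shift q m c)) ⟩
        B (suc q) + E              ≤⟨ +-monoˡ-≤ E (subst (λ z → B z ≤ u) len (B-≤-#-U 𝒯 sz un)) ⟩
        u + E                      ∎
        where
        eq : ∀ a b d → a + (b + d) ≡ b + (a + d)
        eq = solve-∀
      eq₁ : ∀ a g i y ww b s n e f k u → a + g + (i + y + ww + b + s + n + e + f + k + u) ≡ u + (i + y) + (ww + b) + (a + s) + n +
          (e + f + k + g)
      eq₁ = solve-∀
      eq₂ : ∀ d l i y ww b s n p e f k u → (d + i) + (b + n + p + k) + (l + e) + (u + ww + f) + s + y ≡ d + l +
          (i + y + ww + b + s + (n + p) + e + f + k + u)
      eq₂ = solve-∀

    -- The newest star brings N′ sets of degree at least q * K₁, while the slope accounts for `w q`.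
    -- From q = 2 on these differ by at least μ, and 2 * (N′ * μ) is at least N * M by `pure-large`.
    pure-gap : ∀ {Y′} → ∣ Y′ ∣ ≡ suc t → ∀ 𝒯 → length 𝒯 ≡ suc q → 3 ≤ length 𝒯 → Sized 𝒯 → Unique 𝒯 → All (_⊆ Y′) 𝒯 → Gap q 𝒯
    pure-gap {Y′} ∣Y′∣ (T ∷ T₁ ∷ 𝒯) refl (s≤s 2≤q) sz@(∣T∣ ∷ sz′) un@(ne ∷ un′) ins@(i ∷ ins′) = begin
      2 * (w q * # (U? (T ∷ T₁ ∷ 𝒯))) + N * M
        ≡⟨ cong (λ z → 2 * (w q * z) + N * M) (trans (U-cons-new T (T₁ ∷ 𝒯))
            (cong (# (U? (T₁ ∷ 𝒯)) +_) (pure-new ∣Y′∣ T T₁ 𝒯 ∣T∣ sz′ i ins′ ne))) ⟩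
      2 * (w q * (u + N′)) + N * M
        ≡⟨ eq₁ (w q) u N′ (N * M) ⟩
      2 * (w q * u) + (2 * (w q * N′) + N * M)
        ≤⟨ +-mono-≤ (pure-good ∣Y′∣ 0<t t≤n (T₁ ∷ 𝒯) (length 𝒯) refl (<⇒≤ q<x) x≤m sz′ un′ ins′) gain ⟩
      D (U? (T₁ ∷ 𝒯)) + 2 * Λ q + 2 * (N′ * (q * K₁))
        ≡⟨ eq₂ (D (U? (T₁ ∷ 𝒯))) (2 * Λ q) (2 * (N′ * (q * K₁))) ⟩
      D (U? (T₁ ∷ 𝒯)) + 2 * (N′ * (q * K₁)) + 2 * Λ q
        ≤⟨ +-monoˡ-≤ (2 * Λ q) (pure-D-cons ∣Y′∣ 0<t T T₁ 𝒯 sz un ins) ⟩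
      D (U? (T ∷ T₁ ∷ 𝒯)) + 2 * Λ q ∎
      where
      open ≤-Reasoning
      u  = # (U? (T₁ ∷ 𝒯))
      N′ = bin (m ∸ 1) c
      K₁ = bin (x ∸ 1) c
      μ  = bin (x ∸ 2) c′
      eq₁ : ∀ a u v g → 2 * (a * (u + v)) + g ≡ 2 * (a * u) + (2 * (a * v) + g)
      eq₁ = solve-∀
      eq₂ : ∀ a b d → a + b + d ≡ a + d + b
      eq₂ = solve-∀
      eq₃ : ∀ a b d → 2 * (a * b) + 2 * (b * d) ≡ 2 * (b * (a + d))
      eq₃ = solve-∀
      eq₄ : ∀ N′ μ c M₂ M → 2 * (N′ * (μ + suc c * M₂)) + 2 * (M * M) ≡ 2 * (N′ * μ) + (2 * suc c * (N′ * M₂) + 2 * (M * M))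
      eq₄ = solve-∀
      eq₅ : ∀ c MM → 2 * suc c * MM + 2 * MM ≡ 2 * (2 + c) * MM
      eq₅ = solve-∀
      eq₆ : ∀ M N′ → (M + N′) * M + (M + N′) * M ≡ 2 * (N′ * M) + 2 * (M * M)
      eq₆ = solve-∀
      bin-pred : ∀ z → 1 ≤ z → bin z c ≡ bin (z ∸ 1) c′ + bin (z ∸ 1) c
      bin-pred (suc z) _ = refl
      N≡ : N ≡ M + N′
      N≡ = bin-pred m (≤-trans (s≤s z≤n) c+q<m)
      -- For two stars the difference is exactly μ by Pascal's rule; every further summand of `w` is
      -- at most K₁.
      w+μ : ∀ j → 2 ≤ j → w j + μ ≤ j * K₁
      w+μ (suc zero) (s≤s ())
      w+μ (suc (suc zero)) _ = ≤-reflexive (trans (+-assoc K₁ (bin (x ∸ 2) c) μ)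
        (cong (K₁ +_) (trans (+-comm (bin (x ∸ 2) c) μ)
            (sym (trans (+-identityʳ K₁) (trans (bin-pred (x ∸ 1) (m+n≤o⇒m≤o∸n 1 (≤-trans (s≤s (≤-trans (s≤s z≤n) 2≤q)) q<x)))
          (cong₂ (λ a b → bin a c′ + bin b c) (∸-+-assoc x 1 1) (∸-+-assoc x 1 1))))))))
      w+μ (suc (suc (suc j))) _ = ≤-trans (≤-reflexive (eq (w (suc (suc j))) (bin (x ∸ suc (suc (suc j))) c) μ))
        (+-mono-≤ (bin-mono c (∸-monoʳ-≤ x (s≤s z≤n))) (w+μ (suc (suc j)) (s≤s (s≤s z≤n))))
        where
        eq : ∀ a b d → a + b + d ≡ b + (a + d)
        eq = solve-∀
      M≤ : M ≤ μ + suc c * M₂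
      M≤ = begin
        bin (m ∸ 1) c′                                           ≤⟨ bin-upper (m ∸ 1) (suc c) c′ ⟩
        bin (m ∸ 1 ∸ suc c) c′ + suc c * bin⁻ (m ∸ 1 ∸ 1) c′     ≡⟨ cong₂ (λ a b → bin a c′ + suc c * bin⁻ b c′)
            (trans (∸-+-assoc m 1 (suc c)) (sym (trans (x∸ 2) (cong (m ∸_) (+-comm c 2))))) (∸-+-assoc m 1 1) ⟩
        μ + suc c * M₂                                           ∎
      gain′ : N * M ≤ 2 * (N′ * μ)
      gain′ = +-cancelʳ-≤ (N * M) _ _ (begin
        N * M + N * M                                       ≡⟨ cong (λ z → z * M + z * M) N≡ ⟩
        (M + N′) * M + (M + N′) * M                         ≡⟨ eq₆ M N′ ⟩
        2 * (N′ * M) + 2 * (M * M)                          ≤⟨ +-monoˡ-≤ (2 * (M * M)) (*-monoʳ-≤ 2 (*-monoʳ-≤ N′ M≤)) ⟩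
        2 * (N′ * (μ + suc c * M₂)) + 2 * (M * M)           ≡⟨ eq₄ N′ μ c M₂ M ⟩
        2 * (N′ * μ) + (2 * suc c * (N′ * M₂) + 2 * (M * M)) ≤⟨ +-monoʳ-≤ (2 * (N′ * μ))
            (+-monoˡ-≤ (2 * (M * M)) (*-monoʳ-≤ (2 * suc c)
            (≤-trans (*-monoˡ-≤ M₂ (≤-trans (m≤n+m N′ M) (≤-reflexive (sym N≡)))) NM₂))) ⟩
        2 * (N′ * μ) + (2 * suc c * (M * M) + 2 * (M * M))  ≡⟨ cong (2 * (N′ * μ) +_) (eq₅ c (M * M)) ⟩
        2 * (N′ * μ) + 2 * (2 + c) * (M * M)                ≤⟨ +-monoʳ-≤ (2 * (N′ * μ)) pure-large ⟩
        2 * (N′ * μ) + N * M                                ∎)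
      gain : 2 * (w q * N′) + N * M ≤ 2 * (N′ * (q * K₁))
      gain = begin
        2 * (w q * N′) + N * M            ≤⟨ +-monoʳ-≤ (2 * (w q * N′)) gain′ ⟩
        2 * (w q * N′) + 2 * (N′ * μ)     ≡⟨ eq₃ (w q) N′ μ ⟩
        2 * (N′ * (w q + μ))              ≤⟨ *-monoʳ-≤ 2 (*-monoʳ-≤ N′ (w+μ q 2≤q)) ⟩
        2 * (N′ * (q * K₁))               ∎

    good : ∀ 𝒯 → length 𝒯 ≡ q → Sized 𝒯 → Unique 𝒯 → Good q 𝒯
    good [] refl _ _ = z≤n
    good (T ∷ []) refl (∣T∣ ∷ []) _ = good-by-size 0<t [] [] [] z≤n T ∣T∣ []
      (≤-trans (#-U-≤ (T ∷ []) (∣T∣ ∷ [])) (≤-reflexive (+-identityʳ N)))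
    good (T₁ ∷ T₂ ∷ 𝒯) refl sz un with classify T₁ T₂ 𝒯 sz un
    ... | sunflower ∣Z∣ cs = sunflower-good ∣Z∣ 0<t (T₁ ∷ T₂ ∷ 𝒯) sz un cs t≤n (≤-trans (<⇒≤ q<x) x≤m)
    ... | pure ∣Y∣ ins _   = pure-good ∣Y∣ 0<t t≤n (T₁ ∷ T₂ ∷ 𝒯) (suc (length 𝒯)) refl (<⇒≤ q<x) x≤m sz un ins
    ... | far f            = far-good (T₁ ∷ T₂ ∷ 𝒯) refl sz f

    sunflower-or-gap : 0 < q → ∀ 𝒯 → length 𝒯 ≡ suc q → Sized 𝒯 → Unique 𝒯 →
      (∃[ Z ] (suc ∣ Z ∣ ≡ t × All (Z ⊆_) 𝒯)) ⊎ Gap q 𝒯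
    sunflower-or-gap 0<q (T ∷ []) refl _ _ = ⊥-elim (<-irrefl refl 0<q)
    sunflower-or-gap 0<q (T₁ ∷ T₂ ∷ 𝒯) len sz un with classify T₁ T₂ 𝒯 sz un
    ... | sunflower ∣Z∣ cs = inj₁ (_ , ∣Z∣ , cs)
    ... | pure ∣Y∣ ins 3≤  = inj₂ (pure-gap ∣Y∣ (T₁ ∷ T₂ ∷ 𝒯) len 3≤ sz un ins)
    ... | far f            = inj₂ (far-gap (T₁ ∷ T₂ ∷ 𝒯) len sz un f)

-- Enumerating subsets by lists

_≟ₛ_ : (A B : Subset n) → Dec (A ≡ B)
_≟ₛ_ = ≡-dec Bool._≟_

sum-map-allSubsets : (f : Subset n → ℕ) → sum (map f (allSubsetsLex n)) ≡ Σs f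
sum-map-allSubsets {zero}  f = +-identityʳ _
sum-map-allSubsets {suc n} f = trans (cong sum (map-++ f (map (true ∷ᵥ_) (allSubsetsLex n)) _))
  (trans (sum-++ (map f (map (true ∷ᵥ_) (allSubsetsLex n))) _)
    (cong₂ _+_ (trans (cong sum (sym (map-∘ (allSubsetsLex n)))) (sum-map-allSubsets (f ∘ (true ∷ᵥ_))))
               (trans (cong sum (sym (map-∘ (allSubsetsLex n)))) (sum-map-allSubsets (f ∘ (false ∷ᵥ_))))))

∈-allSubsets : (A : Subset n) → A ∈ₗ allSubsetsLex n
∈-allSubsets []ᵥ           = here refl
∈-allSubsets (true ∷ᵥ A)  = ∈-++⁺ˡ (∈-map⁺ (true ∷ᵥ_) (∈-allSubsets A))
∈-allSubsets (false ∷ᵥ A) = ∈-++⁺ʳ _ (∈-map⁺ (false ∷ᵥ_) (∈-allSubsets A))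

allSubsets-unique : ∀ n → Unique (allSubsetsLex n)
allSubsets-unique zero    = [] ∷ []
allSubsets-unique (suc n) = Unique.++⁺ (Unique.map⁺ (λ { refl → refl }) (allSubsets-unique n))
    (Unique.map⁺ (λ { refl → refl }) (allSubsets-unique n))
  (λ { (a , b) → case (∈-map⁻ (true ∷ᵥ_) a) (∈-map⁻ (false ∷ᵥ_) b) })
  where
  case : ∀ {A : Subset (suc n)} → ∃[ B ] (B ∈ₗ allSubsetsLex n × A ≡ true ∷ᵥ B) → ¬ (∃[ B ] (B ∈ₗ allSubsetsLex n × A ≡ false ∷ᵥ B))
  case (_ , _ , refl) (_ , _ , ())

module _ {P : Subset n → Set} (P? : Decidable P) where

  members : List (Subset n)
  members = filter P? (allSubsetsLex n)

  members-unique : Unique members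
  members-unique = Unique.filter⁺ P? (allSubsets-unique n)

  members-All : {Q : Subset n → Set} → (∀ {A} → P A → Q A) → All Q members
  members-All h = All.map h (All.all-filter P? (allSubsetsLex n))

  ∈-members⁺ : ∀ {A} → P A → A ∈ₗ members
  ∈-members⁺ p = ∈-filter⁺ P? (∈-allSubsets _) p

  sum-members : (f : Subset n → ℕ) → sum (map f members) ≡ Σs (λ A → 𝟙 (P? A) * f A)
  sum-members f = trans (go (allSubsetsLex n)) (sum-map-allSubsets (λ A → 𝟙 (P? A) * f A))
    where
    go : ∀ xs → sum (map f (filter P? xs)) ≡ sum (map (λ A → 𝟙 (P? A) * f A) xs)
    go []       = refl
    go (A ∷ xs) with P? A
    ... | yes _ = cong₂ _+_ (sym (+-identityʳ (f A))) (go xs)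
    ... | no _  = go xs

  length-members : length members ≡ # P?
  length-members = trans (ones members) (trans (sum-members (λ _ → 1)) (Σs-cong (λ A → *-identityʳ (𝟙 (P? A)))))
    where
    ones : (xs : List (Subset n)) → length xs ≡ sum (map (λ _ → 1) xs)
    ones []       = refl
    ones (_ ∷ xs) = cong suc (ones xs)

#-singleton : (A : Subset n) → # (_≟ₛ A) ≤ 1
#-singleton A = ≤-trans (#-mono (_≟ₛ A) (between? (∣ A ∣ + 0) A A) (λ { _ refl → sym (+-identityʳ _) , ⊆-refl , ⊆-refl }))
  (≤-reflexive (#-between A A ⊆-refl 0))

-- Degrees of t-sets in a family

module Degrees (n t c′ : ℕ) where
  open Estimates n t c′
  open Stars n t c
  open Sunflowers n t c
  open PureFamilies n t c
  open CrossingPairs n t c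
  open Shapes n t c′

  module Family {F : Subset n → Set} (F? : Decidable F) (sized : ∀ {A : Subset n} → F A → ∣ A ∣ ≡ k) where

    s : ℕ
    s = # F?

    d ideg : Subset n → ℕ
    d T    = # (F? ∧? (T ⊆?_))
    ideg A = # (F? ∧? Inter? A)

    d≤N : ∀ {T : Subset n} → ∣ T ∣ ≡ t → d T ≤ N
    d≤N {T} ∣T∣ = ≤-trans (#-mono (F? ∧? (T ⊆?_)) (star? T) (λ _ (f , g) → sized f , g)) (≤-reflexive (#-star ∣T∣))

    d≤ideg : ∀ {T A : Subset n} → ∣ T ∣ ≡ t → T ⊆ A → d T ≤ ideg A
    d≤ideg {T} {A} ∣T∣ T⊆A = #-mono (F? ∧? (T ⊆?_)) (F? ∧? Inter? A)
      (λ B (f , T⊆B) → f , ≤-trans (≤-reflexive (sym ∣T∣)) (p⊆q⇒∣p∣≤∣q∣ λ z∈ → x∈p∩q⁺ (T⊆A z∈ , T⊆B z∈)))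

    Full : Subset n → Set
    Full T = ∣ T ∣ ≡ t × N ≤ d T

    full? : Decidable Full
    full? T = (∣ T ∣ ≟ t) ×-dec (N ≤? d T)

    full⇒ : ∀ {T : Subset n} → Full T → ∀ A → Star T A → F A
    full⇒ {T} (∣T∣ , N≤) A st = proj₁ (#-⊇ (F? ∧? (T ⊆?_)) (star? T) (λ _ (f , g) → sized f , g)
        (≤-trans (≤-reflexive (#-star ∣T∣)) N≤) A st)

    C₀ : ℕ
    C₀ = bin k t

    subs? : ∀ (A : Subset n) → Decidable (λ T → ∣ T ∣ ≡ t × T ⊆ A)
    subs? A T = (∣ T ∣ ≟ t) ×-dec (T ⊆? A)

    #-subs : ∀ {A : Subset n} → ∣ A ∣ ≡ k → # (subs? A) ≡ C₀
    #-subs {A} ∣A∣ = trans (#-cong (subs? A) (between? (∣ ∅ {n} ∣ + t) ∅ A)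
        (λ T (e , s) → trans e (cong (_+ t) (sym (∣⊥∣≡0 n))) , ⊆-min T , s) (λ T (e , _ , s) → trans e (cong (_+ t) (∣⊥∣≡0 n)) , s))
      (trans (#-between ∅ A (⊆-min A) t) (cong₂ (λ a b → bin (a ∸ b) t) ∣A∣ (∣⊥∣≡0 n)))

    witness : ∀ {A B : Subset n} → t ≤ ∣ A ∩ B ∣ → ∃[ T ] (∣ T ∣ ≡ t × T ⊆ A × T ⊆ B)
    witness {A} {B} i =
      let T , e , _ , s = ∃-between ∅ (A ∩ B) (⊆-min (A ∩ B)) t (≤-trans (≤-reflexive (cong (_+ t) (∣⊥∣≡0 n))) i)
      in T , trans e (cong (_+ t) (∣⊥∣≡0 n)) , (λ z∈ → p∩q⊆p A B (s z∈)) , (λ z∈ → p∩q⊆q A B (s z∈))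

    ideg-cover : ∀ A → ideg A ≤ Σs (λ T → # (λ B → subs? A T ×-dec F? B ×-dec (T ⊆? B)))
    ideg-cover A = #-cover (F? ∧? Inter? A) (λ T B → subs? A T ×-dec F? B ×-dec (T ⊆? B))
      (λ B (f , i) → let T , e , a , b = witness {A} {B} i in T , (e , a) , f , b)

    ideg≤ : ∀ {A : Subset n} → ∣ A ∣ ≡ k → ideg A ≤ C₀ * N
    ideg≤ {A} ∣A∣ = ≤-trans (ideg-cover A) (≤-trans
      (##-≤ (subs? A) (λ T B → subs? A T ×-dec F? B ×-dec (T ⊆? B)) N
        (λ T (e , _) → ≤-trans (#-mono (λ B → subs? A T ×-dec F? B ×-dec (T ⊆? B)) (F? ∧? (T ⊆?_)) (λ _ → proj₂)) (d≤N e))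
            (λ _ _ → proj₁))
      (≤-reflexive (cong (_* N) (#-subs {A} ∣A∣))))

    -- Extending the degree by zero to sets of other sizes allows sums over all subsets of [n].
    d₀? : ∀ T → Decidable (λ A → ∣ T ∣ ≡ t × F A × T ⊆ A)
    d₀? T A = (∣ T ∣ ≟ t) ×-dec F? A ×-dec (T ⊆? A)

    d₀ : Subset n → ℕ
    d₀ T = # (d₀? T)

    d₀≤d : ∀ T → d₀ T ≤ d T
    d₀≤d T = #-mono (d₀? T) (F? ∧? (T ⊆?_)) (λ _ → proj₂)

    d₀-zero : ∀ {T : Subset n} → ∣ T ∣ ≢ t → d₀ T ≡ 0
    d₀-zero {T} ne = #-empty (d₀? T) (λ _ (e , _) → ne e)

    d≤d₀ : ∀ {T : Subset n} → ∣ T ∣ ≡ t → d T ≤ d₀ T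
    d≤d₀ {T} e = #-mono (F? ∧? (T ⊆?_)) (d₀? T) (λ _ → e ,_)

    Σd₀≤ : Σs d₀ ≤ C₀ * s
    Σd₀≤ = ≤-trans (≤-reflexive (##-swap d₀?)) (≤-trans
      (##-≤ F? (λ A T → d₀? T A) C₀ (λ A f → ≤-trans (#-mono (λ T → d₀? T A) (subs? A) (λ T (e , _ , s) → e , s))
          (≤-reflexive (#-subs {A} (sized f)))) (λ A T (_ , f , _) → f))
      (≤-reflexive (*-comm s C₀)))

    -- A pair with at least t common elements has a common t-subset and is counted in the square of
    -- its degree.
    I≤Σd₀² : I F? ≤ Σs (λ T → d₀ T * d₀ T)
    I≤Σd₀² = ≤-trans (Σs-mono (λ A → #-cover (λ B → F? A ×-dec F? B ×-dec Inter? A B) (λ T B → R? A T B)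
        (λ B (f , g , i) → let T , e , a , b = witness {A} {B} i in T , (e , f , a) , (e , g , b))))
      (≤-trans (≤-reflexive (Σs-swap (λ A T → # (R? A T)))) (Σs-mono (λ T →
        ##-≤ (d₀? T) (λ A B → R? A T B) (d₀ T) (λ A _ → #-mono (R? A T) (d₀? T) (λ _ → proj₂)) (λ _ _ → proj₁))))
      where
      R? : ∀ (A T B : Subset n) → Dec ((∣ T ∣ ≡ t × F A × T ⊆ A) × (∣ T ∣ ≡ t × F B × T ⊆ B))
      R? A T B = d₀? T A ×-dec d₀? T B

    sumd : List (Subset n) → ℕ
    sumd 𝒯 = sum (map d 𝒯)

    overlap-≤ : ∀ T 𝒯 → ∣ T ∣ ≡ t → Sized 𝒯 → All (T ≢_) 𝒯 → # (star? T ∧? U? 𝒯) ≤ length 𝒯 * M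
    overlap-≤ T [] _ _ _ = ≤-reflexive (#-empty (star? T ∧? U? []) λ { _ (_ , _ , ()) })
    overlap-≤ T (T′ ∷ 𝒯) ∣T∣ (∣T′∣ ∷ sz) (ne ∷ nes) = ≤-trans
      (#-union (star? T ∧? U? (T′ ∷ 𝒯)) (λ A → star? T A ×-dec (T′ ⊆? A)) (star? T ∧? U? 𝒯)
        (λ { A (st , _ , here s) → inj₁ (st , s) ; A (st , e , there a) → inj₂ (st , e , a) }))
      (+-mono-≤ (#-two-stars ∣T∣ ∣T′∣ (λ e → ne (sym e))) (overlap-≤ T 𝒯 ∣T∣ sz nes))

    -- Inclusion-exclusion up to pairs: a star shares at most M sets with the star of each other
    -- centre.
    sumd≤ : ∀ 𝒯 → Sized 𝒯 → Unique 𝒯 → sumd 𝒯 ≤ # (F? ∧? U? 𝒯) + length 𝒯 * (length 𝒯 * M)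
    sumd≤ [] _ _ = z≤n
    sumd≤ (T ∷ 𝒯) (∣T∣ ∷ sz) (ne ∷ un) = begin
      d T + sumd 𝒯
        ≤⟨ +-mono-≤ d≤ (sumd≤ 𝒯 sz un) ⟩
      (l * M + v) + (u + l * (l * M))
        ≡⟨ eq (l * M) v u (l * (l * M)) ⟩
      (u + v) + (l * M + l * (l * M))
        ≤⟨ +-mono-≤ (#-disjoint (F? ∧? U? (T ∷ 𝒯)) (F? ∧? U? 𝒯) ((F? ∧? (T ⊆?_)) ∖? U? 𝒯)
             (λ _ (f , e , a) → f , e , there a) (λ _ ((f , s) , _) → f , sized f , here s) (λ _ (_ , b) (_ , ¬b) → ¬b b))
             (+-mono-≤ (*-monoˡ-≤ M (n≤1+n l)) (*-monoʳ-≤ l (*-monoˡ-≤ M (n≤1+n l)))) ⟩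
      # (F? ∧? U? (T ∷ 𝒯)) + suc l * (suc l * M) ∎
      where
      open ≤-Reasoning
      l = length 𝒯
      u = # (F? ∧? U? 𝒯)
      v = # ((F? ∧? (T ⊆?_)) ∖? U? 𝒯)
      eq : ∀ a v u b → (a + v) + (u + b) ≡ (u + v) + (a + b)
      eq = solve-∀
      d≤ : d T ≤ l * M + v
      d≤ = ≤-trans (≤-reflexive (#-split (F? ∧? (T ⊆?_)) (U? 𝒯)))
        (+-monoˡ-≤ v (≤-trans (#-mono ((F? ∧? (T ⊆?_)) ∧? U? 𝒯) (star? T ∧? U? 𝒯) (λ _ ((f , s) , u) → (sized f , s) , u))
            (overlap-≤ T 𝒯 ∣T∣ sz ne)))

    s≤sumd : ∀ 𝒯 → # (F? ∧? U? 𝒯) ≤ sumd 𝒯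
    s≤sumd [] = ≤-reflexive (#-empty (F? ∧? U? []) λ { _ (_ , _ , ()) })
    s≤sumd (T ∷ 𝒯) = ≤-trans (#-union (F? ∧? U? (T ∷ 𝒯)) (F? ∧? (T ⊆?_)) (F? ∧? U? 𝒯)
        (λ { A (f , _ , here s) → inj₁ (f , s) ; A (f , e , there a) → inj₂ (f , e , a) }))
      (+-monoʳ-≤ (d T) (s≤sumd 𝒯))

    Optimal : ℕ → Set
    Optimal q = 2 * (w q * s) ≤ D F? + 2 * Λ q

    optimal-⊇ : ∀ {q} → 0 < t → ∀ 𝒯 → length 𝒯 ≡ q → Sized 𝒯 → Unique 𝒯 → All Full 𝒯 → Good q 𝒯 → Optimal q
    optimal-⊇ {q} 0<t 𝒯 len sz un fulls g = begin
      2 * (w q * s)                                     ≡⟨ cong (λ z → 2 * (w q * z)) s≡ ⟩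
      2 * (w q * (u + r))                               ≡⟨ eq₁ (w q) u r ⟩
      2 * (w q * u) + 2 * (r * w q)                     ≤⟨ +-mono-≤ g (*-monoʳ-≤ 2 (pairs-≥ Disj? rest (U? 𝒯) (w q)
           (λ A (f , ¬u) → subst (λ z → w z ≤ # (DU? 𝒯 A)) len (disj-U-≥ 0<t A 𝒯 (sized f) sz un (notU⇒ 𝒯 (sized f) ¬u))))) ⟩
      D (U? 𝒯) + 2 * Λ q + 2 * pairs Disj? rest (U? 𝒯)  ≡⟨ eq₂ (D (U? 𝒯)) (2 * Λ q) (2 * pairs Disj? rest (U? 𝒯)) ⟩
      D (U? 𝒯) + 2 * pairs Disj? rest (U? 𝒯) + 2 * Λ q  ≤⟨ +-monoˡ-≤ (2 * Λ q) (≤-trans (m≤m+n _ (D rest))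
           (pairs-square-≥ Disj? F? (U? 𝒯) rest Disj-sym U⊆F (λ _ → proj₁) (λ _ u (_ , ¬u) → ¬u u))) ⟩
      D F? + 2 * Λ q                                    ∎
      where
      open ≤-Reasoning
      rest = F? ∖? U? 𝒯
      u = # (U? 𝒯)
      r = # rest
      any-full : ∀ {A : Subset n} {𝒮} → All Full 𝒮 → ∣ A ∣ ≡ k → Any (_⊆ A) 𝒮 → F A
      any-full (f ∷ _)  e (here s)  = full⇒ f _ (e , s)
      any-full (_ ∷ fs) e (there a) = any-full fs e a
      U⊆F : ∀ A → U 𝒯 A → F A
      U⊆F A (e , a) = any-full fulls e a
      s≡ : s ≡ u + r
      s≡ = trans (#-split F? (U? 𝒯)) (cong (_+ r) (#-cong (F? ∧? U? 𝒯) (U? 𝒯) (λ _ → proj₂) (λ A u → U⊆F A u , u)))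
      eq₁ : ∀ a u v → 2 * (a * (u + v)) ≡ 2 * (a * u) + 2 * (v * a)
      eq₁ = solve-∀
      eq₂ : ∀ a b d → a + b + d ≡ a + d + b
      eq₂ = solve-∀

    module _ {𝒯 : List (Subset n)} (F⊆U : ∀ A → F A → U 𝒯 A) where

      miss? : Decidable (λ A → U 𝒯 A × ¬ F A)
      miss? = U? 𝒯 ∖? F?

      #-U-miss : # (U? 𝒯) ≡ s + # miss?
      #-U-miss = trans (#-split (U? 𝒯) F?) (cong (_+ # miss?) (#-cong (U? 𝒯 ∧? F?) F? (λ _ → proj₂) (λ A f → F⊆U A f , f)))

      D-U-miss : ∀ β → (∀ A → U 𝒯 A → # (DU? 𝒯 A) ≤ β) → D (U? 𝒯) ≤ D F? + 2 * (# miss? * β)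
      D-U-miss β h = begin
        D (U? 𝒯)                                              ≤⟨ pairs-square-≤ Disj? (U? 𝒯) F? miss? Disj-sym split ⟩
        -- The second copy of b completes a + b to the disjoint pairs between missing sets and the
        -- whole union.
        D F? + 2 * a + b                                      ≤⟨ m≤m+n _ b ⟩
        D F? + 2 * a + b + b                                  ≡⟨ eq (D F?) a b ⟩
        D F? + 2 * (a + b)                                    ≤⟨ +-monoʳ-≤ (D F?) (*-monoʳ-≤ 2 (≤-trans
             (##-disjoint (λ A B → miss? A ×-dec U? 𝒯 B ×-dec Disj? A B) (λ A B → miss? A ×-dec F? B ×-dec Disj? A B)
                 (λ A B → miss? A ×-dec miss? B ×-dec Disj? A B)
               (λ A B (m , f , j) → m , F⊆U B f , j) (λ A B (m , (u , _) , j) → m , u , j)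
                   (λ A B (_ , f , _) (_ , (_ , ¬f) , _) → ¬f f))
             (pairs-≤ Disj? miss? (U? 𝒯) β (λ A (u , _) → h A u)))) ⟩
        D F? + 2 * (# miss? * β)                              ∎
        where
        open ≤-Reasoning
        a = pairs Disj? miss? F?
        b = D miss?
        eq : ∀ x a b → x + 2 * a + b + b ≡ x + 2 * (a + b)
        eq = solve-∀
        split : ∀ A → U 𝒯 A → F A ⊎ (U 𝒯 A × ¬ F A)
        split A u with F? A
        ... | yes f = inj₁ f
        ... | no ¬f = inj₂ (u , ¬f)

      -- Restoring a missing set adds at most `2 * w q` to D, which is what the slope allows, so
      -- `Good` for the union passes down to F.
      optimal-miss : ∀ {q} → (∀ A → U 𝒯 A → # (DU? 𝒯 A) ≤ w q) → Good q 𝒯 → Optimal q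
      optimal-miss {q} h g = +-cancelʳ-≤ (2 * (# miss? * w q)) _ _ (begin
        2 * (w q * s) + 2 * (# miss? * w q)       ≡⟨ eq₁ (w q) s (# miss?) ⟩
        2 * (w q * (s + # miss?))                 ≡⟨ cong (λ z → 2 * (w q * z)) (sym #-U-miss) ⟩
        2 * (w q * # (U? 𝒯))                      ≤⟨ g ⟩
        D (U? 𝒯) + 2 * Λ q                        ≤⟨ +-monoˡ-≤ (2 * Λ q) (D-U-miss (w q) h) ⟩
        D F? + 2 * (# miss? * w q) + 2 * Λ q      ≡⟨ eq₂ (D F?) (2 * (# miss? * w q)) (2 * Λ q) ⟩
        D F? + 2 * Λ q + 2 * (# miss? * w q)      ∎)
        where
        open ≤-Reasoning
        eq₁ : ∀ a s v → 2 * (a * s) + 2 * (v * a) ≡ 2 * (a * (s + v))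
        eq₁ = solve-∀
        eq₂ : ∀ a b d → a + b + d ≡ a + d + b
        eq₂ = solve-∀

      -- Restoring a set may here exceed the slope by Z * M; the surplus N * M of `Gap` pays for all
      -- the excesses together.
      optimal-miss-gap : ∀ {q} Z → (∀ A → U 𝒯 A → # (DU? 𝒯 A) ≤ w q + Z * M) → 2 * (# miss? * Z) ≤ N → Gap q 𝒯 → Optimal q
      optimal-miss-gap {q} Z h small g = +-cancelʳ-≤ (2 * (# miss? * w q) + N * M) _ _ (begin
        2 * (w q * s) + (2 * (# miss? * w q) + N * M)      ≡⟨ eq₁ (w q) s (# miss?) (N * M) ⟩
        2 * (w q * (s + # miss?)) + N * M                  ≡⟨ cong (λ z → 2 * (w q * z) + N * M) (sym #-U-miss) ⟩
        2 * (w q * # (U? 𝒯)) + N * M                       ≤⟨ g ⟩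
        D (U? 𝒯) + 2 * Λ q                                 ≤⟨ +-monoˡ-≤ (2 * Λ q) (D-U-miss (w q + Z * M) h) ⟩
        D F? + 2 * (# miss? * (w q + Z * M)) + 2 * Λ q     ≡⟨ eq₂ (D F?) (# miss?) (w q) Z M (2 * Λ q) ⟩
        D F? + 2 * Λ q + (2 * (# miss? * w q) + 2 * (# miss? * Z) * M) ≤⟨ +-monoʳ-≤ (D F? + 2 * Λ q)
            (+-monoʳ-≤ (2 * (# miss? * w q)) (*-monoˡ-≤ M small)) ⟩
        D F? + 2 * Λ q + (2 * (# miss? * w q) + N * M)     ∎)
        where
        open ≤-Reasoning
        eq₁ : ∀ a s v g → 2 * (a * s) + (2 * (v * a) + g) ≡ 2 * (a * (s + v)) + g
        eq₁ = solve-∀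
        eq₂ : ∀ a v w Z M l → a + 2 * (v * (w + Z * M)) + l ≡ a + l + (2 * (v * w) + 2 * (v * Z) * M)
        eq₂ = solve-∀

-- Arithmetic for θ away from N

Σs-*ʳ : ∀ {n} (f : Subset n → ℕ) c → Σs (λ A → f A * c) ≡ Σs f * c
Σs-*ʳ f c = trans (Σs-cong (λ A → *-comm (f A) c)) (trans (Σs-*ˡ c f) (*-comm c _))

-- A deviation Δ of at least 2N / Q is worth two units of N² / Q: one covers the t-sets of small
-- degree, the other all errors with a factor M.
error-absorbed : ∀ {Q N M Δ a PP e} → 1 ≤ a → M ≤ N → Q * (PP + e) * M ≤ N → 2 * N ≤ Q * Δ →
                 Q * (PP * M * N) + N * N + Q * (e * (M * M)) ≤ Q * (a * (N * Δ))
error-absorbed {Q} {N} {M} {Δ} {a} {PP} {e} 1≤a M≤N small big = begin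
  Q * (PP * M * N) + N * N + Q * (e * (M * M))   ≤⟨ +-monoʳ-≤ (Q * (PP * M * N) + N * N)
      (*-monoʳ-≤ Q (*-monoʳ-≤ e (*-monoʳ-≤ M M≤N))) ⟩
  Q * (PP * M * N) + N * N + Q * (e * (M * N))   ≡⟨ eq₁ Q PP M N e ⟩
  Q * (PP + e) * M * N + N * N                   ≤⟨ +-monoˡ-≤ (N * N) (*-monoˡ-≤ N small) ⟩
  N * N + N * N                                  ≡⟨ eq₂ N ⟩
  2 * N * N                                      ≤⟨ *-monoˡ-≤ N big ⟩
  Q * Δ * N                                      ≡⟨ eq₃ Q Δ N ⟩
  Q * (1 * (N * Δ))                              ≤⟨ *-monoʳ-≤ Q (*-monoˡ-≤ (N * Δ) 1≤a) ⟩
  Q * (a * (N * Δ))                              ∎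
  where
  open ≤-Reasoning
  eq₁ : ∀ Q PP M N e → Q * (PP * M * N) + N * N + Q * (e * (M * N)) ≡ Q * (PP + e) * M * N + N * N
  eq₁ = solve-∀
  eq₂ : ∀ N → N * N + N * N ≡ 2 * N * N
  eq₂ = solve-∀
  eq₃ : ∀ Q Δ N → Q * Δ * N ≡ Q * (1 * (N * Δ))
  eq₃ = solve-∀

-- Up to the error in M, S * θ stays below θ² + a N² by a * N * Δ, because θ = N - Δ.
below-threshold : ∀ {Q N M θ Δ a PP e S} → 1 ≤ a → M ≤ N → Q * (PP + e) * M ≤ N → 2 * N ≤ Q * Δ →
  S ≤ a * N + θ + PP * M → θ + Δ ≡ N → Q * (S * θ) + N * N + Q * (e * (M * M)) ≤ Q * (θ * θ + a * (N * N))
below-threshold {Q} {N} {M} {θ} {Δ} {a} {PP} {e} {S} 1≤a M≤N small big S≤ refl = begin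
  Q * (S * θ) + N * N + R                              ≤⟨ +-monoˡ-≤ R (+-monoˡ-≤ (N * N) (*-monoʳ-≤ Q (*-monoˡ-≤ θ S≤))) ⟩
  Q * ((a * N + θ + PP * M) * θ) + N * N + R           ≡⟨ eq₁ Q a N θ PP M R ⟩
  Q * (θ * θ + a * (N * θ)) + (Q * (PP * M * θ) + N * N + R) ≤⟨ +-monoʳ-≤ (Q * (θ * θ + a * (N * θ)))
      (≤-trans (+-monoˡ-≤ R (+-monoˡ-≤ (N * N) (*-monoʳ-≤ Q (*-monoʳ-≤ (PP * M) (m≤m+n θ Δ)))))
      (error-absorbed {Q} {N} {M} {Δ} {a} {PP} {e} 1≤a M≤N small big)) ⟩
  Q * (θ * θ + a * (N * θ)) + Q * (a * (N * Δ))        ≡⟨ eq₂ Q θ a N Δ ⟩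
  Q * (θ * θ + a * (N * (θ + Δ)))                      ∎
  where
  open ≤-Reasoning
  R = Q * (e * (M * M))
  eq₁ : ∀ Q a N θ PP M R → Q * ((a * N + θ + PP * M) * θ) + N * N + R ≡ Q * (θ * θ + a * (N * θ)) + (Q * (PP * M * θ) + N * N + R)
  eq₁ = solve-∀
  eq₂ : ∀ Q θ a N Δ → Q * (θ * θ + a * (N * θ)) + Q * (a * (N * Δ)) ≡ Q * (θ * θ + a * (N * (θ + Δ)))
  eq₂ = solve-∀

-- Degrees are bounded by N instead of θ here, and the gain is θ² - θ N, which is at least N * Δ.
above-threshold : ∀ {Q N M θ Δ a PP e S} → 1 ≤ a → M ≤ N → Q * (PP + e) * M ≤ N → 2 * N ≤ Q * Δ →
  S ≤ a * N + θ + PP * M → N + Δ ≡ θ → Q * (S * N) + N * N + Q * (e * (M * M)) ≤ Q * (θ * θ + a * (N * N))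
above-threshold {Q} {N} {M} {θ} {Δ} {a} {PP} {e} {S} 1≤a M≤N small big S≤ refl = begin
  Q * (S * N) + N * N + R                              ≤⟨ +-monoˡ-≤ R (+-monoˡ-≤ (N * N) (*-monoʳ-≤ Q (*-monoˡ-≤ N S≤))) ⟩
  Q * ((a * N + (N + Δ) + PP * M) * N) + N * N + R     ≡⟨ eq₁ Q a N Δ PP M R ⟩
  Q * ((N + Δ) * N + a * (N * N)) + (Q * (PP * M * N) + N * N + R) ≤⟨ +-monoʳ-≤ (Q * ((N + Δ) * N + a * (N * N)))
      (error-absorbed {Q} {N} {M} {Δ} {1} {PP} {e} ≤-refl M≤N small big) ⟩
  Q * ((N + Δ) * N + a * (N * N)) + Q * (1 * (N * Δ))  ≤⟨ m≤m+n _ (Q * (Δ * Δ)) ⟩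
  Q * ((N + Δ) * N + a * (N * N)) + Q * (1 * (N * Δ)) + Q * (Δ * Δ) ≡⟨ eq₂ Q N Δ a ⟩
  Q * ((N + Δ) * (N + Δ) + a * (N * N))                ∎
  where
  open ≤-Reasoning
  R = Q * (e * (M * M))
  eq₁ : ∀ Q a N Δ PP M R → Q * ((a * N + (N + Δ) + PP * M) * N) + N * N + R ≡ Q * ((N + Δ) * N + a * (N * N)) +
      (Q * (PP * M * N) + N * N + R)
  eq₁ = solve-∀
  eq₂ : ∀ Q N Δ a → Q * ((N + Δ) * N + a * (N * N)) + Q * (1 * (N * Δ)) + Q * (Δ * Δ) ≡ Q * ((N + Δ) * (N + Δ) + a * (N * N))
  eq₂ = solve-∀

-- Constants of the degree argument

module Constants (t c q : ℕ) where

  abstract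

    -- `Γ * N` bounds the size of F. `cut` lets the degrees below N / cut contribute at most N² /
    -- scale to the sum of squares, and `bound` limits the number of larger degrees. `scale` is just
    -- large enough to exclude q + 2 almost full stars. `C₁ * M` bounds q * N - w q, and `C₂ * M`
    -- the sets missing from an almost full star.
    Γ scale cut bound C₁ C₂ : ℕ
    Γ     = q + bin (t + c) t
    scale = 3 * q + 10
    cut   = bin (t + c) t * Γ * scale
    bound = cut * bin (t + c) t * Γ
    C₁    = q * (c + q)
    C₂    = C₁ + suc q * (t + c)

    Γ≡ : Γ ≡ q + bin (t + c) t
    Γ≡ = refl

    scale≡ : scale ≡ 3 * q + 10
    scale≡ = refl

    cut≡ : cut ≡ bin (t + c) t * Γ * scale
    cut≡ = refl

    bound≡ : bound ≡ cut * bin (t + c) t * Γ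
    bound≡ = refl

    C₁≡ : C₁ ≡ q * (c + q)
    C₁≡ = refl

    C₂≡ : C₂ ≡ C₁ + suc q * (t + c)
    C₂≡ = refl

-- Popular t-sets and the sum of squared degrees

module Popularity (n t c′ : ℕ) where
  open Estimates n t c′
  open Stars n t c
  open Sunflowers n t c
  open PureFamilies n t c
  open CrossingPairs n t c
  open Shapes n t c′
  open Degrees n t c′

  module Local {F : Subset n → Set} (F? : Decidable F) (sized : ∀ {A} → F A → ∣ A ∣ ≡ k) (q : ℕ) where

    open Family F? sized
    open Constants t c q

    Pop : Subset n → Set
    Pop T = ∣ T ∣ ≡ t × N ≤ cut * d T

    pop? : Decidable Pop
    pop? T = (∣ T ∣ ≟ t) ×-dec (N ≤? cut * d T)

    𝒫 : List (Subset n)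
    𝒫 = members pop?

    ℓ : ℕ
    ℓ = length 𝒫

    𝒫-sized : Sized 𝒫
    𝒫-sized = members-All pop? proj₁

    𝒫-unique : Unique 𝒫
    𝒫-unique = members-unique pop?

    partial? : Decidable (λ T → Pop T × ¬ Full T)
    partial? = pop? ∖? full?

    full-mass : ℕ
    full-mass = # full?

    partial-degree? : ∀ T → Decidable (λ A → (Pop T × ¬ Full T) × F A × T ⊆ A)
    partial-degree? T A = partial? T ×-dec F? A ×-dec (T ⊆? A)

    partial-mass : ℕ
    partial-mass = ## partial-degree?

    unpopular : ∀ {T} → ∣ T ∣ ≡ t → ¬ Pop T → cut * d T ≤ N
    unpopular ∣T∣ ¬p = <⇒≤ (≰⇒> λ h → ¬p (∣T∣ , h))

    module _ (cut>0 : 0 < cut) where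

      full⇒pop : ∀ {T} → Full T → Pop T
      full⇒pop {T} (∣T∣ , h) = ∣T∣ , ≤-trans h (≤-trans (≤-reflexive (sym (*-identityˡ (d T)))) (*-monoˡ-≤ (d T) cut>0))

      -- A squared degree d² is at most N * N for a full star, d * θ for a popular partial one, and
      -- d * N / cut otherwise; the last kind sums to at most C₀ * s * N / cut by double counting.
      -- Multiplication by `cut` avoids the division.
      I-estimate : ∀ θ → (∀ {T} → ∣ T ∣ ≡ t → ¬ Full T → d T ≤ θ) →
                   cut * I F? ≤ cut * (full-mass * (N * N) + partial-mass * θ) + N * (C₀ * s)
      I-estimate θ h = begin
        cut * I F?                                     ≤⟨ *-monoʳ-≤ cut I≤Σd₀² ⟩
        cut * Σs (λ T → d₀ T * d₀ T)                   ≡⟨ sym (Σs-*ˡ cut (λ T → d₀ T * d₀ T)) ⟩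
        Σs (λ T → cut * (d₀ T * d₀ T))                 ≤⟨ Σs-mono pointwise ⟩
        Σs (λ T → cut * (f₁ T + f₂ T) + N * d₀ T)      ≡⟨ Σs-+ (λ T → cut * (f₁ T + f₂ T)) (λ T → N * d₀ T) ⟩
        Σs (λ T → cut * (f₁ T + f₂ T)) + Σs (λ T → N * d₀ T)
          ≡⟨ cong₂ _+_ (trans (Σs-*ˡ cut (λ T → f₁ T + f₂ T)) (cong (cut *_) (trans (Σs-+ f₁ f₂)
               (cong₂ _+_ (Σs-*ʳ (λ T → 𝟙 (full? T)) (N * N)) (Σs-*ʳ (λ T → # (partial-degree? T)) θ))))) (Σs-*ˡ N d₀) ⟩
        cut * (full-mass * (N * N) + partial-mass * θ) + N * Σs d₀ ≤⟨ +-monoʳ-≤ (cut * (full-mass * (N * N) + partial-mass * θ))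
            (*-monoʳ-≤ N Σd₀≤) ⟩
        cut * (full-mass * (N * N) + partial-mass * θ) + N * (C₀ * s) ∎
        where
        open ≤-Reasoning
        f₁ f₂ : Subset n → ℕ
        f₁ T = 𝟙 (full? T) * (N * N)
        f₂ T = # (partial-degree? T) * θ
        pointwise : ∀ T → cut * (d₀ T * d₀ T) ≤ cut * (f₁ T + f₂ T) + N * d₀ T
        pointwise T = by-cases (full? T) (pop? T) (∣ T ∣ ≟ t)
          where
          by-cases : Dec (Full T) → Dec (Pop T) → Dec (∣ T ∣ ≡ t) → cut * (d₀ T * d₀ T) ≤ cut * (f₁ T + f₂ T) + N * d₀ T
          by-cases (yes fl) _ _ = ≤-trans (*-monoʳ-≤ cut
              (≤-trans (*-mono-≤ d₀≤N d₀≤N) (≤-trans (≤-reflexive (sym one)) (m≤m+n (f₁ T) (f₂ T))))) (m≤m+n _ _)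
            where
            d₀≤N : d₀ T ≤ N
            d₀≤N = ≤-trans (d₀≤d T) (d≤N (proj₁ fl))
            one : f₁ T ≡ N * N
            one = trans (cong (_* (N * N)) (𝟙-yes (full? T) fl)) (*-identityˡ (N * N))
          by-cases (no ¬fl) (yes p) _ = ≤-trans (*-monoʳ-≤ cut
              (≤-trans (*-mono-≤ d₀≤ (≤-trans (d₀≤d T) (h (proj₁ p) ¬fl))) (m≤n+m (f₂ T) (f₁ T)))) (m≤m+n _ _)
            where
            d₀≤ : d₀ T ≤ # (partial-degree? T)
            d₀≤ = #-mono (d₀? T) (partial-degree? T) (λ _ (_ , f , s) → (p , ¬fl) , f , s)
          by-cases (no ¬fl) (no ¬p) (yes ∣T∣) = ≤-trans (≤-reflexive (sym (*-assoc cut (d₀ T) (d₀ T))))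
              (≤-trans (*-monoˡ-≤ (d₀ T) (≤-trans (*-monoʳ-≤ cut (d₀≤d T)) (unpopular ∣T∣ ¬p))) (m≤n+m _ _))
          by-cases (no ¬fl) (no ¬p) (no ne) = ≤-trans
              (≤-reflexive (trans (cong (λ z → cut * (z * z)) (d₀-zero ne)) (*-zeroʳ cut))) z≤n

      masses : partial-mass + full-mass * N ≤ sumd 𝒫
      masses = begin
        partial-mass + full-mass * N                                     ≡⟨ cong (partial-mass +_)
            (sym (Σs-*ʳ (λ T → 𝟙 (full? T)) N)) ⟩
        Σs (λ T → # (partial-degree? T)) + Σs (λ T → 𝟙 (full? T) * N)     ≡⟨ sym
            (Σs-+ (λ T → # (partial-degree? T)) (λ T → 𝟙 (full? T) * N)) ⟩
        Σs (λ T → # (partial-degree? T) + 𝟙 (full? T) * N)               ≤⟨ Σs-mono pointwise ⟩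
        Σs (λ T → 𝟙 (pop? T) * d T)                                      ≡⟨ sym (sum-members pop? d) ⟩
        sumd 𝒫                                                           ∎
        where
        open ≤-Reasoning
        pointwise : ∀ T → # (partial-degree? T) + 𝟙 (full? T) * N ≤ 𝟙 (pop? T) * d T
        pointwise T = by-cases (full? T) (pop? T)
          where
          by-cases : (f : Dec (Full T)) (p : Dec (Pop T)) → # (partial-degree? T) + 𝟙 f * N ≤ 𝟙 p * d T
          by-cases (yes fl) (yes p) = ≤-trans (≤-reflexive
              (cong₂ _+_ (#-empty (partial-degree? T) (λ _ ((_ , ¬fl) , _) → ¬fl fl)) refl)) (*-monoʳ-≤ 1 (proj₂ fl))
          by-cases (yes fl) (no ¬p) = contradiction (full⇒pop fl) ¬p
          by-cases (no ¬fl) (yes p) = ≤-trans (≤-reflexive (+-identityʳ _))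
              (≤-trans (#-mono (partial-degree? T) (F? ∧? (T ⊆?_)) (λ _ → proj₂)) (≤-reflexive (sym (*-identityˡ (d T)))))
          by-cases (no ¬fl) (no ¬p) = ≤-reflexive (trans (+-identityʳ _) (#-empty (partial-degree? T) (λ _ ((p , _) , _) → ¬p p)))

    sumd-𝒫≤ : sumd 𝒫 ≤ s + ℓ * (ℓ * M)
    sumd-𝒫≤ = ≤-trans (sumd≤ 𝒫 𝒫-sized 𝒫-unique) (+-monoˡ-≤ (ℓ * (ℓ * M)) (#-mono (F? ∧? U? 𝒫) F? (λ _ → proj₁)))

    -- Markov's inequality: the degrees sum to at most `C₀ * s`, and each popular set takes at least
    -- N / cut of it.
    ℓN≤ : ℓ * N ≤ cut * (C₀ * s)
    ℓN≤ = ≤-trans (≤-reflexive (cong (_* N) (length-members pop?))) (≤-trans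
      (Σs-≥-const pop? (λ T → cut * d₀ T) N (λ T (∣T∣ , h) → ≤-trans h (*-monoʳ-≤ cut (d≤d₀ ∣T∣))))
      (≤-trans (≤-reflexive (Σs-*ˡ cut d₀)) (*-monoʳ-≤ cut Σd₀≤)))

-- Locally optimal families

module LocalOptima (n t c′ : ℕ) where
  open Estimates n t c′
  open Stars n t c
  open Sunflowers n t c
  open PureFamilies n t c
  open CrossingPairs n t c
  open Shapes n t c′
  open Degrees n t c′
  open Popularity n t c′

  module LocalOptimum (q : ℕ) (0<q : 0 < q) (0<t : 0 < t) (room : k + suc q ≤ n) (NM₂ : N * M₂ ≤ M * M) (κ≤Y : κ ≤ Y)
    (far-large : er q * (M * M) + 2 * (ε q * M₂ * (N + q * c * M)) + 2 * κ + N * M ≤ 2 * Y)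
    (pure-large : 2 * (2 + c) * (M * M) ≤ N * M) (M≤N : M ≤ N)
    (large₁ : Constants.scale t c q * (Constants.bound t c q * Constants.bound t c q + er q) * M ≤ N)
    (large₂ : Constants.cut t c q * (Constants.bound t c q * M) < N)
    (large₃ : Constants.scale t c q * (Constants.C₁ t c q * M) ≤ N)
    (large₄ : 2 * (suc q * (Constants.C₂ t c q * M) * Constants.C₁ t c q) ≤ N)
    {F : Subset n → Set} (F? : Decidable F) (sized : ∀ {A} → F A → ∣ A ∣ ≡ k)
    (removal  : ∀ {A} → F A → # F? ≤ w q + # (F? ∧? Inter? A))
    (addition : ∀ {A} → ∣ A ∣ ≡ k → ¬ F A → # (F? ∧? Inter? A) + w q ≤ # F?) where

    open Large q 0<t room NM₂ κ≤Y far-large pure-large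
    open Family F? sized
    open Constants t c q
    open Local F? sized q

    N>0 : 0 < N
    N>0 = ≤-trans (s≤s z≤n) large₂

    instance
      N≢0 : NonZero N
      N≢0 = >-nonZero N>0

    C₀>0 : 0 < C₀
    C₀>0 = bin-pos (m≤m+n t c)

    Γ>0 : 0 < Γ
    Γ>0 = subst (0 <_) (sym Γ≡) (≤-trans C₀>0 (m≤n+m C₀ q))

    scale≥4 : 4 ≤ scale
    scale≥4 = subst (4 ≤_) (sym scale≡) (≤-trans (m≤m+n 4 6) (m≤n+m 10 (3 * q)))

    cut>0 : 0 < cut
    cut>0 = subst (0 <_) (sym cut≡) (*-mono-≤ (*-mono-≤ C₀>0 Γ>0) (≤-trans (s≤s z≤n) scale≥4))

    instance
      cut≢0 : NonZero cut
      cut≢0 = >-nonZero cut>0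
      scale≢0 : NonZero scale
      scale≢0 = >-nonZero (≤-trans (s≤s z≤n) scale≥4)

    -- One member suffices: s is at most `w q` plus the number of its t-intersecting partners, each
    -- of which contains one of its `C₀` t-subsets, of degree at most N.
    s≤ΓN : s ≤ Γ * N
    s≤ΓN = by-cases (0 <? s)
      where
      open ≤-Reasoning
      by-cases : Dec (0 < s) → s ≤ Γ * N
      by-cases (no s≯0)  = ≤-trans (≮⇒≥ s≯0) z≤n
      by-cases (yes s>0) = let A , f = #-exists F? s>0 in begin
        s                 ≤⟨ removal {A} f ⟩
        w q + ideg A      ≤⟨ +-mono-≤ (w≤qN q) (ideg≤ {A} (sized f)) ⟩
        q * N + C₀ * N    ≡⟨ trans (sym (*-distribʳ-+ N q C₀)) (cong (_* N) (sym Γ≡)) ⟩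
        Γ * N             ∎

    ℓ≤bound : ℓ ≤ bound
    ℓ≤bound = *-cancelʳ-≤ ℓ bound N (≤-trans ℓN≤
        (≤-trans (*-monoʳ-≤ cut (*-monoʳ-≤ C₀ s≤ΓN)) (≤-reflexive (trans (eq cut C₀ Γ N) (cong (_* N) (sym bound≡))))))
      where
      eq : ∀ a b d e → a * (b * (d * e)) ≡ a * b * d * e
      eq = solve-∀

    -- A star that is not full lacks some k-set A. All members of F in the star t-intersect A, and
    -- adding A brings no improvement.
    partial-bound : ∀ {T} → ∣ T ∣ ≡ t → ¬ Full T → d T + w q ≤ s
    partial-bound {T} ∣T∣ ¬fl =
      let A , st , ¬f = #-exists-∖ (star? T) (F? ∧? (T ⊆?_)) (subst (d T <_) (sym (#-star ∣T∣)) (≰⇒> λ h → ¬fl (∣T∣ , h)))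
      in ≤-trans (+-monoˡ-≤ (w q) (d≤ideg ∣T∣ (proj₂ st))) (addition (proj₁ st) (λ f → ¬f (f , proj₂ st)))

    enough-full : q ≤ full-mass → Optimal q
    enough-full q≤p = optimal-⊇ 0<t (take q (members full?)) len (All.take⁺ q (members-All full? proj₁))
        (Unique.take⁺ q (members-unique full?))
        (All.take⁺ q (members-All full? (λ f → f)))
            (good (take q (members full?)) len (All.take⁺ q (members-All full? proj₁)) (Unique.take⁺ q (members-unique full?)))
      where
      len : length (take q (members full?)) ≡ q
      len = trans (length-take q (members full?)) (m≤n⇒m⊓n≡m (≤-trans q≤p (≤-reflexive (sym (length-members full?)))))

    -- There are at least q sets of size t, so one of them is not full and `partial-bound` applies
    -- to it. This makes θ = s - w q a natural number.
    w≤s : full-mass < q → w q ≤ s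
    w≤s p<q =
      let T , ∣T∣ , ¬fl = #-exists-∖ (λ (T : Subset n) → ∣ T ∣ ≟ t) full? (≤-trans p<q q≤)
      in ≤-trans (m≤n+m (w q) (d T)) (partial-bound {T} ∣T∣ ¬fl)
      where
      q≤n∸t : q ≤ n ∸ t
      q≤n∸t = ≤-trans (≤-trans (m≤n+m q (suc c)) (≤-reflexive (sym (+-suc c q)))) c+q<m
      bin-big : ∀ t′ → 0 < t′ → t′ ≤ n → q ≤ n ∸ t′ → q ≤ bin n t′
      bin-big (suc t′) _ t≤n h = ≤-trans (≤-trans h (n≤1+n _))
          (subst (λ z → suc (n ∸ suc t′) ≤ bin z (suc t′)) (m+[n∸m]≡n t≤n) (bin-≥ (n ∸ suc t′) t′))
      q≤ : q ≤ # (λ (T : Subset n) → ∣ T ∣ ≟ t)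
      q≤ = ≤-trans (bin-big t 0<t t≤n q≤n∸t) (≤-reflexive (sym (trans
        (#-cong (λ (T : Subset n) → ∣ T ∣ ≟ t) (between? (∣ ∅ {n} ∣ + t) ∅ ⊤)
            (λ T e → trans e (cong (_+ t) (sym (∣⊥∣≡0 n))) , ⊆-min T , ⊆⊤) (λ T (e , _) → trans e (cong (_+ t) (∣⊥∣≡0 n))))
        (trans (#-between (∅ {n}) ⊤ ⊆⊤ t) (cong₂ (λ a b → bin (a ∸ b) t) (∣⊤∣≡n n) (∣⊥∣≡0 n))))))

    module Few (a : ℕ) (0<a : 0 < a) (q≡ : full-mass + a ≡ q) (θ : ℕ) (s≡ : w q + θ ≡ s) where

      p : ℕ
      p = full-mass

      θ≤ideg : ∀ {A} → F A → θ ≤ ideg A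
      θ≤ideg {A} f = +-cancelˡ-≤ (w q) _ _ (subst (_≤ w q + ideg A) (sym s≡) (removal {A} f))

      d≤θ : ∀ {T} → ∣ T ∣ ≡ t → ¬ Full T → d T ≤ θ
      d≤θ {T} ∣T∣ ¬fl = +-cancelʳ-≤ (w q) _ _ (≤-trans (partial-bound {T} ∣T∣ ¬fl) (≤-reflexive (trans (sym s≡) (+-comm (w q) θ))))

      sumd≤θ : sumd 𝒫 ≤ w q + θ + bound * bound * M
      sumd≤θ = ≤-trans sumd-𝒫≤ (+-mono-≤ (≤-reflexive (sym s≡))
          (≤-trans (*-mono-≤ ℓ≤bound (*-monoˡ-≤ M ℓ≤bound)) (≤-reflexive (sym (*-assoc bound bound M)))))

      partial≤ : partial-mass ≤ a * N + θ + bound * bound * M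
      partial≤ = +-cancelʳ-≤ (p * N) _ _ (begin
        partial-mass + p * N                               ≤⟨ masses cut>0 ⟩
        sumd 𝒫                                             ≤⟨ sumd≤θ ⟩
        w q + θ + bound * bound * M                        ≤⟨ +-monoˡ-≤ (bound * bound * M)
            (+-monoˡ-≤ θ (≤-trans (w≤qN q) (≤-reflexive (cong (_* N) (sym q≡))))) ⟩
        (p + a) * N + θ + bound * bound * M                ≡⟨ eq p a N θ (bound * bound * M) ⟩
        a * N + θ + bound * bound * M + p * N              ∎)
        where
        open ≤-Reasoning
        eq : ∀ p a N θ r → (p + a) * N + θ + r ≡ a * N + θ + r + p * N
        eq = solve-∀

      -- With s = w q + θ the claim reads I F? ≤ θ² − (w q)² + 2 Λ q, and Λ-lower turns the right side into θ² + q N² − O (M²).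
      from-I : ∀ θ′ → (∀ {T} → ∣ T ∣ ≡ t → ¬ Full T → d T ≤ θ′) →
               scale * (partial-mass * θ′) + N * N + scale * (er q * (M * M)) ≤ scale * (θ * θ + a * (N * N)) → Optimal q
      from-I θ′ h dense = +-cancelʳ-≤ (θ * θ + (I F? + er q * (M * M)) + Ib q + q * (N * N)) _ _ (begin
        2 * (w q * s) + (θ * θ + (I F? + er q * (M * M)) + Ib q + q * (N * N))
          ≡⟨ trans (cong (λ z → 2 * (w q * z) + (θ * θ + (I F? + er q * (M * M)) + Ib q + q * (N * N))) (sym s≡))
              (eq₁ (w q) θ (I F? + er q * (M * M)) (Ib q) (q * (N * N))) ⟩
        (w q + θ) * (w q + θ) + (I F? + er q * (M * M)) + (w q * w q + Ib q) + q * (N * N)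
          ≤⟨ +-mono-≤ (+-mono-≤ (+-mono-≤ (subst (λ z → z * z ≤ D F? + I F?) (sym s≡) (square≤D+I F?)) I≤) (Λ-lower NM₂ q c+q≤m))
              (q≤Ib q) ⟩
        (D F? + I F?) + (θ * θ + q * (N * N)) + (2 * Λ q + er q * (M * M)) + Ib q
          ≡⟨ eq₂ (D F?) (I F?) (θ * θ) (q * (N * N)) (2 * Λ q) (er q * (M * M)) (Ib q) ⟩
        D F? + 2 * Λ q + (θ * θ + (I F? + er q * (M * M)) + Ib q + q * (N * N)) ∎)
        where
        open ≤-Reasoning
        eq₁ : ∀ w θ i b r → 2 * (w * (w + θ)) + (θ * θ + i + b + r) ≡ (w + θ) * (w + θ) + i + (w * w + b) + r
        eq₁ = solve-∀
        eq₂ : ∀ d i x r l e b → (d + i) + (x + r) + (l + e) + b ≡ d + l + (x + (i + e) + b + r)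
        eq₂ = solve-∀
        eq₃ : ∀ E Q i e → E * (Q * i + Q * e) ≡ Q * (E * i) + E * (Q * e)
        eq₃ = solve-∀
        eq₄ : ∀ E Q p NN S y e → Q * (E * (p * NN + S) + y) + E * (Q * e) ≡ E * (Q * (p * NN) + (Q * S + Q * e)) + Q * y
        eq₄ = solve-∀
        eq₅ : ∀ E Q pNN S NN e → E * (Q * pNN + (Q * S + Q * e)) + E * NN ≡ E * (Q * pNN + (Q * S + NN + Q * e))
        eq₅ = solve-∀
        eq₆ : ∀ Q p a NN x → Q * (p * NN) + Q * (x + a * NN) ≡ Q * (x + (p + a) * NN)
        eq₆ = solve-∀
        eq₇ : ∀ Q N Z G → Q * (N * (Z * (G * N))) ≡ Z * G * Q * (N * N)
        eq₇ = solve-∀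
        q≤Ib : ∀ j → j * (N * N) ≤ Ib j
        q≤Ib zero    = z≤n
        q≤Ib (suc j) = ≤-trans (≤-trans (≤-reflexive (+-comm (N * N) _)) (+-monoˡ-≤ (N * N) (q≤Ib j))) (m≤m+n _ _)
        I≤ : I F? + er q * (M * M) ≤ θ * θ + q * (N * N)
        I≤ = *-cancelˡ-≤ scale (*-cancelˡ-≤ cut (begin
          cut * (scale * (I F? + er q * (M * M)))   ≡⟨ trans (cong (cut *_) (*-distribˡ-+ scale (I F?) _))
              (eq₃ cut scale (I F?) (er q * (M * M))) ⟩
          scale * (cut * I F?) + cut * (scale * (er q * (M * M)))
            ≤⟨ +-monoˡ-≤ _ (*-monoʳ-≤ scale (I-estimate cut>0 θ′ h)) ⟩
          scale * (cut * (p * (N * N) + partial-mass * θ′) + N * (C₀ * s)) + cut * (scale * (er q * (M * M)))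
            ≡⟨ eq₄ cut scale p (N * N) (partial-mass * θ′) (N * (C₀ * s)) (er q * (M * M)) ⟩
          cut * (scale * (p * (N * N)) + (scale * (partial-mass * θ′) + scale * (er q * (M * M)))) + scale * (N * (C₀ * s))
            ≤⟨ +-monoʳ-≤ (cut * (scale * (p * (N * N)) + (scale * (partial-mass * θ′) + scale * (er q * (M * M)))))
                (≤-trans (*-monoʳ-≤ scale (*-monoʳ-≤ N (*-monoʳ-≤ C₀ s≤ΓN)))
                (≤-reflexive (trans (eq₇ scale N C₀ Γ) (cong (_* (N * N)) (sym cut≡))))) ⟩
          cut * (scale * (p * (N * N)) + (scale * (partial-mass * θ′) + scale * (er q * (M * M)))) + cut * (N * N)
            ≡⟨ eq₅ cut scale (p * (N * N)) (partial-mass * θ′) (N * N) (er q * (M * M)) ⟩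
          cut * (scale * (p * (N * N)) + (scale * (partial-mass * θ′) + N * N + scale * (er q * (M * M))))
            ≤⟨ *-monoʳ-≤ cut (+-monoʳ-≤ (scale * (p * (N * N))) dense) ⟩
          cut * (scale * (p * (N * N)) + scale * (θ * θ + a * (N * N)))
            ≡⟨ cong (cut *_) (trans (eq₆ scale p a (N * N) (θ * θ)) (cong (λ z → scale * (θ * θ + z * (N * N))) q≡)) ⟩
          cut * (scale * (θ * θ + q * (N * N))) ∎))

      -- Here F consists of exactly q + 1 stars of which only O (M) sets are missing.
      module Near (lo : scale * N ≤ scale * θ + 2 * N) (hi : scale * θ ≤ scale * N + 2 * N) where

        not-tiny : ¬ scale * θ ≤ N
        not-tiny h = <⇒≱ (≤-trans (m≤m+n 4 0) scale≥4) (*-cancelʳ-≤ scale 3 N (≤-trans lo (+-monoˡ-≤ (2 * N) h)))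

        -- Since `cut` contains the factors C₀ and Γ, the unpopular t-subsets of a set add at most N
        -- at the scale `scale`.
        cut-θ : ∀ {b} → cut * θ ≤ cut * b + C₀ * N → scale * θ ≤ scale * b + N
        cut-θ {b} h = *-cancelˡ-≤ Γ ⦃ >-nonZero Γ>0 ⦄ (*-cancelˡ-≤ C₀ ⦃ >-nonZero C₀>0 ⦄ (begin
          C₀ * (Γ * (scale * θ))              ≡⟨ trans (eq₁ C₀ Γ scale θ) (cong (_* θ) (sym cut≡)) ⟩
          cut * θ                             ≤⟨ h ⟩
          cut * b + C₀ * N                    ≤⟨ +-monoʳ-≤ (cut * b)
              (*-monoʳ-≤ C₀ (≤-trans (≤-reflexive (sym (*-identityˡ N))) (*-monoˡ-≤ N Γ>0))) ⟩
          cut * b + C₀ * (Γ * N)              ≡⟨ trans (cong (λ z → z * b + C₀ * (Γ * N)) cut≡) (eq₂ C₀ Γ scale b N) ⟩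
          C₀ * (Γ * (scale * b + N))          ∎))
          where
          open ≤-Reasoning
          eq₁ : ∀ Z G Q θ → Z * (G * (Q * θ)) ≡ Z * G * Q * θ
          eq₁ = solve-∀
          eq₂ : ∀ Z G Q b N → Z * G * Q * b + Z * (G * N) ≡ Z * (G * (Q * b + N))
          eq₂ = solve-∀

        term? : ∀ (A T : Subset n) → Decidable (λ B → (∣ T ∣ ≡ t × T ⊆ A) × F B × T ⊆ B)
        term? A T B = subs? A T ×-dec F? B ×-dec (T ⊆? B)

        cut-ideg : ∀ {A} → F A → cut * ideg A ≤ Σs (λ T → cut * # (term? A T))
        cut-ideg {A} f = ≤-trans (*-monoʳ-≤ cut (ideg-cover A)) (≤-reflexive (sym (Σs-*ˡ cut (λ T → # (term? A T)))))

        term≤N : ∀ {A T} → Dec (∣ T ∣ ≡ t × T ⊆ A) → ¬ (T ⊆ A × Pop T) → cut * # (term? A T) ≤ 𝟙 (subs? A T) * N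
        term≤N {A} {T} (yes (e , sb)) ¬p = ≤-trans (*-monoʳ-≤ cut (#-mono (term? A T) (F? ∧? (T ⊆?_)) (λ _ → proj₂)))
          (≤-trans (unpopular e (λ p → ¬p (sb , p)))
              (≤-reflexive (sym (trans (cong (_* N) (𝟙-yes (subs? A T) (e , sb))) (*-identityˡ N)))))
        term≤N {A} {T} (no ¬sub) ¬p = ≤-trans (≤-reflexive
            (trans (cong (cut *_) (#-empty (term? A T) (λ _ (sub , _) → ¬sub sub))) (*-zeroʳ cut))) z≤n

        Σ-subs : ∀ {A} → F A → Σs (λ T → 𝟙 (subs? A T) * N) ≡ C₀ * N
        Σ-subs {A} f = trans (Σs-*ʳ (λ T → 𝟙 (subs? A T)) N) (cong (_* N) (#-subs {A} (sized f)))

        -- Without a popular t-subset, A would have too few t-intersecting partners to reach θ.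
        covered : ∀ A → F A → U 𝒫 A
        covered A f with any? (_⊆? A) 𝒫
        ... | yes a = sized f , a
        ... | no ¬a = contradiction (≤-trans (cut-θ {0} (≤-trans (*-monoʳ-≤ cut (θ≤ideg f)) (≤-trans (cut-ideg f)
            (≤-trans (Σs-mono (λ T → term≤N {A} {T} (subs? A T) (λ (sb , p) → ¬a (lose {P = _⊆ A} (∈-members⁺ pop? p) sb))))
              (≤-trans (≤-reflexive (Σ-subs f)) (m≤n+m _ _)))))) (≤-reflexive (cong (_+ N) (*-zeroʳ scale)))) not-tiny

        Other : Subset n → Subset n → Set
        Other T A = Any (λ T′ → T′ ≢ T × T′ ⊆ A) 𝒫

        other? : ∀ (T : Subset n) 𝒯 (A : Subset n) → Dec (Any (λ T′ → T′ ≢ T × T′ ⊆ A) 𝒯)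
        other? T 𝒯 A = any? (λ T′ → ¬? (T′ ≟ₛ T) ×-dec (T′ ⊆? A)) 𝒯

        other-count : ∀ T 𝒯 → ∣ T ∣ ≡ t → Sized 𝒯 → # (star? T ∧? other? T 𝒯) ≤ length 𝒯 * M
        other-count T [] _ _ = ≤-reflexive (#-empty (star? T ∧? other? T []) λ { _ (_ , ()) })
        other-count T (T′ ∷ 𝒯) ∣T∣ (∣T′∣ ∷ sz) = by-cases (T′ ≟ₛ T)
          where
          by-cases : Dec (T′ ≡ T) → # (star? T ∧? other? T (T′ ∷ 𝒯)) ≤ M + length 𝒯 * M
          by-cases (yes e) = ≤-trans (#-mono (star? T ∧? other? T (T′ ∷ 𝒯)) (star? T ∧? other? T 𝒯)
                (λ { A (st , here (ne , _)) → ⊥-elim (ne e) ; A (st , there o) → st , o }))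
            (≤-trans (other-count T 𝒯 ∣T∣ sz) (m≤n+m _ M))
          by-cases (no ne) = ≤-trans (#-union (star? T ∧? other? T (T′ ∷ 𝒯)) (λ A → star? T A ×-dec (T′ ⊆? A))
              (star? T ∧? other? T 𝒯)
                (λ { A (st , here (_ , sb)) → inj₁ (st , sb) ; A (st , there o) → inj₂ (st , o) }))
            (+-mono-≤ (#-two-stars ∣T∣ ∣T′∣ ne) (other-count T 𝒯 ∣T∣ sz))

        -- By `large₂` a popular degree exceeds bound * M, while at most M sets are shared with each
        -- of the other popular stars.
        generic : ∀ {T : Subset n} → Pop T → ∃[ A ] (F A × T ⊆ A × ¬ Other T A)
        generic {T} (∣T∣ , h) =
          let A , (f , sb) , ¬o = #-exists-∖ (F? ∧? (T ⊆?_)) (star? T ∧? other? T 𝒫)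
                (≤-trans (s≤s (≤-trans (other-count T 𝒫 ∣T∣ 𝒫-sized) (*-monoˡ-≤ M ℓ≤bound)))
                    (*-cancelˡ-< cut _ _ (≤-trans large₂ h)))
          in A , f , sb , λ o → ¬o ((sized f , sb) , o)

        -- A generic member finds nearly all of its at least θ partners in the star of T, because
        -- its other t-subsets are unpopular.
        pop-degree : ∀ {T : Subset n} → Pop T → scale * N ≤ scale * d T + 3 * N
        pop-degree {T} p =
          let A , f , sb , ¬o = generic p in begin
          scale * N                   ≤⟨ lo ⟩
          scale * θ + 2 * N           ≤⟨ +-monoˡ-≤ (2 * N)
              (cut-θ (≤-trans (*-monoʳ-≤ cut (θ≤ideg f)) (≤-trans (cut-ideg f) (terms A f ¬o)))) ⟩
          scale * d T + N + 2 * N     ≡⟨ +-assoc (scale * d T) N (2 * N) ⟩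
          scale * d T + 3 * N         ∎
          where
          open ≤-Reasoning
          terms : ∀ A → F A → ¬ Other T A → Σs (λ T′ → cut * # (term? A T′)) ≤ cut * d T + C₀ * N
          terms A f ¬o = begin
            Σs (λ T′ → cut * # (term? A T′))                                ≤⟨ Σs-mono pointwise ⟩
            Σs (λ T′ → 𝟙 (T′ ≟ₛ T) * (cut * d T) + 𝟙 (subs? A T′) * N)       ≡⟨ Σs-+ (λ T′ → 𝟙 (T′ ≟ₛ T) * (cut * d T))
                (λ T′ → 𝟙 (subs? A T′) * N) ⟩
            Σs (λ T′ → 𝟙 (T′ ≟ₛ T) * (cut * d T)) + Σs (λ T′ → 𝟙 (subs? A T′) * N) ≡⟨ cong₂ _+_
                (Σs-*ʳ (λ T′ → 𝟙 (T′ ≟ₛ T)) (cut * d T)) (Σ-subs f) ⟩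
            # (_≟ₛ T) * (cut * d T) + C₀ * N                                ≤⟨ +-monoˡ-≤ (C₀ * N)
                (≤-trans (*-monoˡ-≤ (cut * d T) (#-singleton T)) (≤-reflexive (*-identityˡ _))) ⟩
            cut * d T + C₀ * N                                             ∎
            where
            pointwise : ∀ T′ → cut * # (term? A T′) ≤ 𝟙 (T′ ≟ₛ T) * (cut * d T) + 𝟙 (subs? A T′) * N
            pointwise T′ = by-cases (T′ ≟ₛ T)
              where
              by-cases : Dec (T′ ≡ T) → cut * # (term? A T′) ≤ 𝟙 (T′ ≟ₛ T) * (cut * d T) + 𝟙 (subs? A T′) * N
              by-cases (yes e) = ≤-trans (*-monoʳ-≤ cut
                  (#-mono (term? A T′) (F? ∧? (T ⊆?_)) (λ B (_ , g , sb) → g , subst (_⊆ B) e sb)))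
                (≤-trans (≤-reflexive (sym (trans (cong (_* (cut * d T)) (𝟙-yes (T′ ≟ₛ T) e)) (*-identityˡ _)))) (m≤m+n _ _))
              by-cases (no ne) = ≤-trans (term≤N {A} {T′} (subs? A T′)
                  (λ (sb , p′) → ¬o (lose {P = λ T″ → T″ ≢ T × T″ ⊆ A} (∈-members⁺ pop? p′) (ne , sb)))) (m≤n+m _ _)

        -- The popular degrees sum to at most (q + 1) * N + 3 * N / scale, and each is at least N -
        -- 3 * N / scale. With q + 2 or more of them, scale would be at most 3 * q + 9.
        ℓ≤ : ℓ ≤ suc q
        ℓ≤ = ≮⇒≥ λ h → let r , e = m≤n⇒∃[o]m+o≡n h in
          <⇒≱ (≤-reflexive (trans (eq₁ q) (sym scale≡)))
              (slack r (subst (λ z → z * scale ≤ scale * suc q + 3 + 3 * z) (sym e) total))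
          where
          open ≤-Reasoning
          eq₁ : ∀ q → suc (3 * q + 9) ≡ 3 * q + 10
          eq₁ = solve-∀
          lower : ∀ 𝒯 → All Pop 𝒯 → length 𝒯 * (scale * N) ≤ scale * sumd 𝒯 + length 𝒯 * (3 * N)
          lower [] [] = ≤-reflexive (sym (cong (_+ 0) (*-zeroʳ scale)))
          lower (T ∷ 𝒯) (p ∷ ps) = ≤-trans (+-mono-≤ (pop-degree p) (lower 𝒯 ps))
              (≤-reflexive (eq scale (d T) (3 * N) (sumd 𝒯) (length 𝒯 * (3 * N))))
            where
            eq : ∀ Q a b d e → Q * a + b + (Q * d + e) ≡ Q * (a + d) + (b + e)
            eq = solve-∀
          total : ℓ * scale ≤ scale * suc q + 3 + 3 * ℓ
          total = *-cancelʳ-≤ (ℓ * scale) (scale * suc q + 3 + 3 * ℓ) N (begin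
            ℓ * scale * N                                                ≡⟨ *-assoc ℓ scale N ⟩
            ℓ * (scale * N)                                              ≤⟨ lower 𝒫 (members-All pop? (λ p → p)) ⟩
            scale * sumd 𝒫 + ℓ * (3 * N)                                 ≤⟨ +-monoˡ-≤ (ℓ * (3 * N)) (*-monoʳ-≤ scale sumd≤θ) ⟩
            scale * (w q + θ + bound * bound * M) + ℓ * (3 * N)          ≡⟨ eq₂ scale (w q) θ (bound * bound) M (ℓ * (3 * N)) ⟩
            scale * w q + scale * θ + scale * (bound * bound) * M + ℓ * (3 * N)
              ≤⟨ +-monoˡ-≤ (ℓ * (3 * N)) (+-mono-≤ (+-mono-≤ (*-monoʳ-≤ scale (w≤qN q)) hi)
                  (≤-trans (*-monoˡ-≤ M (*-monoʳ-≤ scale (m≤m+n (bound * bound) (er q)))) large₁)) ⟩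
            scale * (q * N) + (scale * N + 2 * N) + N + ℓ * (3 * N)      ≡⟨ eq₃ scale q N ℓ ⟩
            (scale * suc q + 3 + 3 * ℓ) * N                              ∎)
            where
            eq₂ : ∀ Q w θ b M r → Q * (w + θ + b * M) + r ≡ Q * w + Q * θ + Q * b * M + r
            eq₂ = solve-∀
            eq₃ : ∀ Q q N l → Q * (q * N) + (Q * N + 2 * N) + N + l * (3 * N) ≡ (Q * suc q + 3 + 3 * l) * N
            eq₃ = solve-∀
          slack : ∀ r → (suc (suc q) + r) * scale ≤ scale * suc q + 3 + 3 * (suc (suc q) + r) → scale ≤ 3 * q + 9
          slack r h = +-cancelʳ-≤ (scale * suc q + r * 3) _ _ (begin
            scale + (scale * suc q + r * 3)        ≤⟨ +-monoʳ-≤ scale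
                (+-monoʳ-≤ (scale * suc q) (*-monoʳ-≤ r (≤-trans (n≤1+n 3) scale≥4))) ⟩
            scale + (scale * suc q + r * scale)    ≡⟨ eq₄ scale q r ⟩
            (suc (suc q) + r) * scale              ≤⟨ h ⟩
            scale * suc q + 3 + 3 * (suc (suc q) + r) ≡⟨ eq₅ (scale * suc q) q r ⟩
            3 * q + 9 + (scale * suc q + r * 3)    ∎)
            where
            eq₄ : ∀ Q q r → Q + (Q * suc q + r * Q) ≡ (suc (suc q) + r) * Q
            eq₄ = solve-∀
            eq₅ : ∀ Qq q r → Qq + 3 + 3 * (suc (suc q) + r) ≡ 3 * q + 9 + (Qq + r * 3)
            eq₅ = solve-∀

        s≤U : s ≤ # (F? ∧? U? 𝒫)
        s≤U = #-mono F? (F? ∧? U? 𝒫) (λ A f → f , covered A f)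

        w-close : q * N ≤ w q + C₁ * M
        w-close = subst (λ z → q * N ≤ w q + z * M) (sym C₁≡) (w-lower q)

        -- At most q stars hold no more than q * N ≤ w q + C₁ * M sets, which would push θ down to
        -- the order of M.
        ℓ≥ : suc q ≤ ℓ
        ℓ≥ = ≰⇒> λ ℓ≤q → not-tiny (+-cancelˡ-≤ (scale * w q) _ _ (begin
          scale * w q + scale * θ             ≡⟨ trans (sym (*-distribˡ-+ scale (w q) θ)) (cong (scale *_) s≡) ⟩
          scale * s                           ≤⟨ *-monoʳ-≤ scale
              (≤-trans s≤U (≤-trans (#-mono (F? ∧? U? 𝒫) (U? 𝒫) (λ _ → proj₂)) (≤-trans (#-U-≤ 𝒫 𝒫-sized) (*-monoˡ-≤ N ℓ≤q)))) ⟩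
          scale * (q * N)                     ≤⟨ *-monoʳ-≤ scale w-close ⟩
          scale * (w q + C₁ * M)              ≡⟨ *-distribˡ-+ scale (w q) (C₁ * M) ⟩
          scale * w q + scale * (C₁ * M)      ≤⟨ +-monoʳ-≤ (scale * w q) large₃ ⟩
          scale * w q + N                     ∎))
          where open ≤-Reasoning

        ℓ≡ : ℓ ≡ suc q
        ℓ≡ = ≤-antisym ℓ≤ ℓ≥

        -- For θ ≤ N, counting s by degrees allows p full stars and q + 1 - p stars of degree at
        -- most θ. Raising q - p - 1 of the latter to N leaves two copies of θ, one of which cancels
        -- against s = w q + θ.
        θ-close : N ≤ θ + C₁ * M
        θ-close with ≤-total N θ
        ... | inj₁ N≤θ = ≤-trans N≤θ (m≤m+n θ _)
        ... | inj₂ θ≤N = +-cancelʳ-≤ (p * N + b * N) _ _ (begin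
          N + (p * N + b * N)                  ≡⟨ trans (eq₁ N p b) (cong (_* N) q≡′) ⟩
          q * N                                ≤⟨ w-close ⟩
          w q + C₁ * M                         ≤⟨ +-monoˡ-≤ (C₁ * M) w≤ ⟩
          p * N + b * N + θ + C₁ * M           ≡⟨ eq₂ (p * N) (b * N) θ (C₁ * M) ⟩
          θ + C₁ * M + (p * N + b * N)         ∎)
          where
          open ≤-Reasoning
          b : ℕ
          b = a ∸ 1
          q≡′ : p + suc b ≡ q
          q≡′ = trans (cong (p +_) (m+[n∸m]≡n 0<a)) q≡
          eq₁ : ∀ N p b → N + (p * N + b * N) ≡ (p + suc b) * N
          eq₁ = solve-∀
          eq₂ : ∀ a b θ r → a + b + θ + r ≡ θ + r + (a + b)
          eq₂ = solve-∀
          eq₃ : ∀ p b N θ → p * N + suc (suc b) * θ ≡ p * N + b * θ + θ + θ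
          eq₃ = solve-∀
          #partial : # partial? ≡ suc (suc b)
          #partial = +-cancelˡ-≡ p _ _ (begin-equality
            p + # partial?                            ≡⟨ cong (_+ # partial?)
                (#-cong full? (pop? ∧? full?) (λ T fl → full⇒pop cut>0 fl , fl) (λ _ → proj₂)) ⟩
            # (pop? ∧? full?) + # partial?            ≡⟨ sym (#-split pop? full?) ⟩
            # pop?                                    ≡⟨ trans (sym (length-members pop?)) ℓ≡ ⟩
            suc q                                     ≡⟨ cong suc (sym q≡′) ⟩
            suc (p + suc b)                           ≡⟨ sym (+-suc p (suc b)) ⟩
            p + suc (suc b)                           ∎)
          sumd-bound : sumd 𝒫 ≤ p * N + # partial? * θ
          sumd-bound = begin
            sumd 𝒫                                                      ≡⟨ sum-members pop? d ⟩
            Σs (λ T → 𝟙 (pop? T) * d T)                                 ≤⟨ Σs-mono (λ T → by-cases T (full? T) (pop? T)) ⟩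
            Σs (λ T → 𝟙 (full? T) * N + 𝟙 (partial? T) * θ)             ≡⟨ Σs-+ (λ T → 𝟙 (full? T) * N) (λ T → 𝟙 (partial? T) * θ) ⟩
            Σs (λ T → 𝟙 (full? T) * N) + Σs (λ T → 𝟙 (partial? T) * θ)  ≡⟨ cong₂ _+_ (Σs-*ʳ (λ T → 𝟙 (full? T)) N)
                (Σs-*ʳ (λ T → 𝟙 (partial? T)) θ) ⟩
            p * N + # partial? * θ                                      ∎
            where
            by-cases : ∀ T → Dec (Full T) → Dec (Pop T) → 𝟙 (pop? T) * d T ≤ 𝟙 (full? T) * N + 𝟙 (partial? T) * θ
            by-cases T (yes fl) (yes pp) = ≤-trans (≤-reflexive
                (cong (_* d T) (trans (𝟙-yes (pop? T) pp) (sym (𝟙-yes (full? T) fl)))))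
              (≤-trans (*-monoʳ-≤ (𝟙 (full? T)) (d≤N (proj₁ fl))) (m≤m+n _ _))
            by-cases T (no ¬fl) (yes pp) = ≤-trans (≤-reflexive
                (cong (_* d T) (trans (𝟙-yes (pop? T) pp) (sym (𝟙-yes (partial? T) (pp , ¬fl))))))
              (≤-trans (*-monoʳ-≤ (𝟙 (partial? T)) (d≤θ (proj₁ pp) ¬fl)) (m≤n+m _ _))
            by-cases T _ (no ¬pp) = ≤-trans (≤-reflexive (cong (_* d T) (𝟙-no (pop? T) ¬pp))) z≤n
          w≤ : w q ≤ p * N + b * N + θ
          w≤ = +-cancelʳ-≤ θ _ _ (begin
            w q + θ                           ≡⟨ s≡ ⟩
            s                                 ≤⟨ ≤-trans s≤U (s≤sumd 𝒫) ⟩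
            sumd 𝒫                            ≤⟨ sumd-bound ⟩
            p * N + # partial? * θ            ≡⟨ cong (λ z → p * N + z * θ) #partial ⟩
            p * N + suc (suc b) * θ           ≡⟨ eq₃ p b N θ ⟩
            p * N + b * θ + θ + θ             ≤⟨ +-monoˡ-≤ θ (+-monoˡ-≤ θ (+-monoʳ-≤ (p * N) (*-monoʳ-≤ b θ≤N))) ⟩
            p * N + b * N + θ + θ             ∎)

        inter-other : ∀ {A} T 𝒯 → F A → Sized 𝒯 → ¬ Any (λ T′ → T′ ≢ T × T′ ⊆ A) 𝒯 →
                      # (λ B → (∣ B ∣ ≟ k) ×-dec other? T 𝒯 B ×-dec Inter? A B) ≤ length 𝒯 * (k * M)
        inter-other {A} T [] _ _ _ = ≤-reflexive (#-empty
            (λ B → (∣ B ∣ ≟ k) ×-dec other? T [] B ×-dec Inter? A B) λ { _ (_ , () , _) })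
        inter-other {A} T (T′ ∷ 𝒯) f (∣T′∣ ∷ sz) ¬o = by-cases (T′ ≟ₛ T)
          where
          rec : # (λ B → (∣ B ∣ ≟ k) ×-dec other? T 𝒯 B ×-dec Inter? A B) ≤ length 𝒯 * (k * M)
          rec = inter-other {A} T 𝒯 f sz (λ o → ¬o (there o))
          by-cases : Dec (T′ ≡ T) → # (λ B → (∣ B ∣ ≟ k) ×-dec other? T (T′ ∷ 𝒯) B ×-dec Inter? A B) ≤ length (T′ ∷ 𝒯) * (k * M)
          by-cases (yes e) = ≤-trans (#-mono (λ B → (∣ B ∣ ≟ k) ×-dec other? T (T′ ∷ 𝒯) B ×-dec Inter? A B)
              (λ B → (∣ B ∣ ≟ k) ×-dec other? T 𝒯 B ×-dec Inter? A B)
              (λ { B (_ , here (ne , _) , _) → ⊥-elim (ne e) ; B (eq , there o , i) → eq , o , i }))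
            (≤-trans rec (m≤n+m _ (k * M)))
          by-cases (no ne) = ≤-trans (#-union (λ B → (∣ B ∣ ≟ k) ×-dec other? T (T′ ∷ 𝒯) B ×-dec Inter? A B)
              (star? T′ ∧? Inter? A) (λ B → (∣ B ∣ ≟ k) ×-dec other? T 𝒯 B ×-dec Inter? A B)
              (λ { B (eq , here (_ , sb) , i) → inj₁ ((eq , sb) , i) ; B (eq , there o , i) → inj₂ (eq , o , i) }))
            (+-mono-≤ (#-star-inter-≤ A (sized f) ∣T′∣ (λ sb → ¬o (here (ne , sb)))) rec)

        -- For a generic A, a t-intersecting member outside the star of T lies in another popular
        -- star whose centre is not contained in A; each such star contributes at most k * M.
        degree-close : ∀ {T : Subset n} → Pop T → N ≤ d T + C₂ * M
        degree-close {T} pp =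
          let A , f , sb , ¬o = generic pp in begin
          N                                           ≤⟨ θ-close ⟩
          θ + C₁ * M                                  ≤⟨ +-monoˡ-≤ (C₁ * M) (≤-trans (θ≤ideg f) (≤-trans
              (#-union (F? ∧? Inter? A) (F? ∧? (T ⊆?_)) (λ B → (∣ B ∣ ≟ k) ×-dec other? T 𝒫 B ×-dec Inter? A B)
                  (λ B (g , i) → split {A} B g i))
              (+-monoʳ-≤ (d T) (inter-other {A} T 𝒫 f 𝒫-sized ¬o)))) ⟩
          d T + ℓ * (k * M) + C₁ * M                  ≡⟨ cong (λ z → d T + z * (k * M) + C₁ * M) ℓ≡ ⟩
          d T + suc q * (k * M) + C₁ * M              ≡⟨ trans (eq (d T) (suc q) k M C₁) (cong (λ z → d T + z * M) (sym C₂≡)) ⟩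
          d T + C₂ * M                                ∎
          where
          open ≤-Reasoning
          eq : ∀ a b k M e → a + b * (k * M) + e * M ≡ a + (e + b * k) * M
          eq = solve-∀
          split : ∀ {A} B → F B → t ≤ ∣ A ∩ B ∣ → (F B × T ⊆ B) ⊎ (∣ B ∣ ≡ k × Other T B × t ≤ ∣ A ∩ B ∣)
          split B g i with T ⊆? B
          ... | yes s = inj₁ (g , s)
          ... | no ¬s = inj₂ (sized g , Any.map {P = _⊆ B} {Q = λ T′ → T′ ≢ T × T′ ⊆ B} (λ sb → (λ { refl → ¬s sb }) , sb)
              (proj₂ (covered B g)) , i)

        missing-count : ∀ 𝒯 → All Pop 𝒯 → # (U? 𝒯 ∖? F?) ≤ length 𝒯 * (C₂ * M)
        missing-count [] [] = ≤-reflexive (#-empty (U? [] ∖? F?) λ { _ ((_ , ()) , _) })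
        missing-count (T ∷ 𝒯) (pp ∷ ps) = ≤-trans (#-union (U? (T ∷ 𝒯) ∖? F?) (star? T ∖? F?) (U? 𝒯 ∖? F?)
            (λ { A ((e , here s) , ¬f) → inj₁ ((e , s) , ¬f) ; A ((e , there a) , ¬f) → inj₂ ((e , a) , ¬f) }))
          (+-mono-≤ (+-cancelˡ-≤ (d T) _ _ (≤-trans
              (+-monoˡ-≤ (# (star? T ∖? F?)) (#-mono (F? ∧? (T ⊆?_)) (star? T ∧? F?) (λ _ (f , s) → (sized f , s) , f)))
            (≤-trans (≤-reflexive (sym (#-split (star? T) F?))) (≤-trans (≤-reflexive (#-star (proj₁ pp))) (degree-close pp)))))
                (missing-count 𝒯 ps))

        -- The N sets of a star through A all t-intersect A, so at most q * N of the at most (q + 1)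
        -- * N sets of the union remain.
        disj-U≤ : ∀ A → U 𝒫 A → # (DU? 𝒫 A) ≤ w q + C₁ * M
        disj-U≤ A (e , a) = let T , T∈ , T⊆A = find a ; ∣T∣ = All.lookup 𝒫-sized T∈ in
          ≤-trans (+-cancelʳ-≤ N _ _ (begin
            # (DU? 𝒫 A) + N                 ≡⟨ cong (# (DU? 𝒫 A) +_) (sym (#-star ∣T∣)) ⟩
            # (DU? 𝒫 A) + # (star? T)       ≤⟨ #-disjoint (U? 𝒫) (DU? 𝒫 A) (star? T) (λ _ → proj₁)
                (λ B (e′ , s) → e′ , lose {P = _⊆ B} T∈ s)
                 (λ B (_ , dj) (_ , T⊆B) → <⇒≱ dj (≤-trans (≤-reflexive (sym ∣T∣)) (p⊆q⇒∣p∣≤∣q∣ λ z∈ → x∈p∩q⁺ (T⊆A z∈ , T⊆B z∈)))) ⟩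
            # (U? 𝒫)                        ≤⟨ #-U-≤ 𝒫 𝒫-sized ⟩
            ℓ * N                           ≡⟨ trans (cong (_* N) ℓ≡) (+-comm N (q * N)) ⟩
            q * N + N                       ∎)) w-close
          where open ≤-Reasoning

        tail-good : ∀ 𝒯 → length 𝒯 ≡ suc q → Sized 𝒯 → Unique 𝒯 → Good q 𝒯
        tail-good (T ∷ 𝒯) refl sz@(_ ∷ sz′) un@(_ ∷ un′) = good-extend 0<t T 𝒯 sz un (good 𝒯 refl sz′ un′)

        optimal : Optimal q
        optimal = [ from-sunflower , from-gap ]′ (sunflower-or-gap 0<q 𝒫 ℓ≡ 𝒫-sized 𝒫-unique)
          where
          from-sunflower : ∃[ Z ] (suc ∣ Z ∣ ≡ t × All (Z ⊆_) 𝒫) → Optimal q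
          from-sunflower (_ , ∣Z∣ , cs) = optimal-miss {𝒫} covered {q} (λ A → sunflower-degree ∣Z∣ A 𝒫 𝒫-sized cs ℓ≡ (<⇒≤ q<x) k≤n)
                                            (tail-good 𝒫 ℓ≡ 𝒫-sized 𝒫-unique)
          from-gap : Gap q 𝒫 → Optimal q
          from-gap = optimal-miss-gap {𝒫} covered {q} C₁ disj-U≤
              (≤-trans (*-monoʳ-≤ 2 (*-monoˡ-≤ C₁ (≤-trans (missing-count 𝒫 (members-All pop? (λ pp → pp)))
                  (≤-reflexive (cong (_* (C₂ * M)) ℓ≡))))) large₄)

      few : Optimal q
      few = [ (λ θ≤N → let Δ , e = m≤n⇒∃[o]m+o≡n θ≤N in below Δ e θ≤N (2 * N ≤? scale * Δ))
            , (λ N≤θ → let Δ , e = m≤n⇒∃[o]m+o≡n N≤θ in above Δ e N≤θ (2 * N ≤? scale * Δ)) ]′ (≤-total θ N)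
        where
        spread : ∀ {u v Δ} → u + Δ ≡ v → ¬ 2 * N ≤ scale * Δ → scale * v ≤ scale * u + 2 * N
        spread {u} {v} {Δ} e ¬big = ≤-trans (≤-reflexive (trans (cong (scale *_) (sym e)) (*-distribˡ-+ scale u Δ)))
            (+-monoʳ-≤ (scale * u) (<⇒≤ (≰⇒> ¬big)))
        below : ∀ Δ → θ + Δ ≡ N → θ ≤ N → Dec (2 * N ≤ scale * Δ) → Optimal q
        below Δ e θ≤N (yes big) = from-I θ d≤θ (below-threshold {scale} {N} {M} {θ} {Δ} {a} {bound * bound} {er q} {partial-mass} 0<a M≤N large₁ big partial≤ e)
        below Δ e θ≤N (no ¬big) = Near.optimal (spread e ¬big) (≤-trans (*-monoʳ-≤ scale θ≤N) (m≤m+n _ _))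
        above : ∀ Δ → N + Δ ≡ θ → N ≤ θ → Dec (2 * N ≤ scale * Δ) → Optimal q
        -- Above N the trivial bound d ≤ N is better than d ≤ θ.
        above Δ e N≤θ (yes big) = from-I N (λ {T} ∣T∣ _ → d≤N {T} ∣T∣)
            (above-threshold {scale} {N} {M} {θ} {Δ} {a} {bound * bound} {er q} {partial-mass} 0<a M≤N large₁ big partial≤ e)
        above Δ e N≤θ (no ¬big) = Near.optimal (≤-trans (*-monoʳ-≤ scale N≤θ) (m≤m+n _ _)) (spread e ¬big)

    local-optimal : Optimal q
    local-optimal = by-cases (q ≤? full-mass)
      where
      by-cases : Dec (q ≤ full-mass) → Optimal q
      by-cases (yes q≤p) = enough-full q≤p
      by-cases (no q≰p)  = let b , e = m≤n⇒∃[o]m+o≡n (≰⇒> q≰p) ; θ , s≡ = m≤n⇒∃[o]m+o≡n (w≤s (≰⇒> q≰p))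
                           in Few.few (suc b) z<s (trans (+-suc full-mass b) e) θ s≡

-- The lexicographic list and its t-disjoint pairs

filter-map : {X Y : Set} {P : Y → Set} (P? : Decidable P) (f : X → Y) (xs : List X) →
             filter P? (map f xs) ≡ map f (filter (λ x → P? (f x)) xs)
filter-map P? f []       = refl
filter-map P? f (x ∷ xs) with P? (f x)
... | yes _ = cong (f x ∷_) (filter-map P? f xs)
... | no _  = filter-map P? f xs

length-filter-map : {X Y : Set} {P : Y → Set} (P? : Decidable P) (f : X → Y) (xs : List X) →
                    length (filter P? (map f xs)) ≡ length (filter (λ x → P? (f x)) xs)
length-filter-map P? f xs = trans (cong length (filter-map P? f xs)) (length-map f (filter (λ x → P? (f x)) xs))

length-filter-∷ : {X : Set} {P : X → Set} (P? : Decidable P) (x : X) (xs : List X) →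
                  length (filter P? (x ∷ xs)) ≡ 𝟙 (P? x) + length (filter P? xs)
length-filter-∷ P? x xs with P? x
... | yes _ = refl
... | no _  = refl

take-≤-++ : {X : Set} (s : ℕ) (xs ys : List X) → s ≤ length xs → take s (xs ++ ys) ≡ take s xs
take-≤-++ zero    xs       ys _         = refl
take-≤-++ (suc s) (x ∷ xs) ys (s≤s s≤)  = cong (x ∷_) (take-≤-++ s xs ys s≤)

take-+-++ : {X : Set} (xs ys : List X) (s : ℕ) → take (length xs + s) (xs ++ ys) ≡ xs ++ take s ys
take-+-++ []       ys s = refl
take-+-++ (x ∷ xs) ys s = cong (x ∷_) (take-+-++ xs ys s)

kSubsetsLex-suc : ∀ n k → kSubsetsLex (suc n) (suc k) ≡ map (true ∷ᵥ_) (kSubsetsLex n k) ++ map (false ∷ᵥ_) (kSubsetsLex n (suc k))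
kSubsetsLex-suc n k = trans (filter-++ (λ A → ∣ A ∣ ≟ suc k) (map (true ∷ᵥ_) (allSubsetsLex n)) _) (cong₂ _++_
  (trans (filter-map (λ A → ∣ A ∣ ≟ suc k) (true ∷ᵥ_) (allSubsetsLex n))
    (cong (map (true ∷ᵥ_)) (filter-≐ (λ (A : Subset n) → suc ∣ A ∣ ≟ suc k) (λ A → ∣ A ∣ ≟ k) (suc-injective , cong suc)
        (allSubsetsLex n))))
  (filter-map (λ A → ∣ A ∣ ≟ suc k) (false ∷ᵥ_) (allSubsetsLex n)))

kSubsetsLex-zero : ∀ n → kSubsetsLex (suc n) 0 ≡ map (false ∷ᵥ_) (kSubsetsLex n 0)
kSubsetsLex-zero n = trans (filter-++ (λ A → ∣ A ∣ ≟ 0) (map (true ∷ᵥ_) (allSubsetsLex n)) _)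
  (cong₂ _++_ (trans (filter-map (λ A → ∣ A ∣ ≟ 0) (true ∷ᵥ_) (allSubsetsLex n))
    (cong (map (true ∷ᵥ_)) (filter-none (λ (A : Subset n) → suc ∣ A ∣ ≟ 0) (All.tabulate {xs = allSubsetsLex n} (λ _ ())))))
        (filter-map (λ A → ∣ A ∣ ≟ 0) (false ∷ᵥ_) (allSubsetsLex n)))

length-kSubsetsLex : ∀ n k → length (kSubsetsLex n k) ≡ bin n k
length-kSubsetsLex zero    zero    = refl
length-kSubsetsLex zero    (suc k) = refl
length-kSubsetsLex (suc n) zero    = trans (cong length (kSubsetsLex-zero n))
    (trans (length-map _ (kSubsetsLex n 0)) (length-kSubsetsLex n 0))
length-kSubsetsLex (suc n) (suc k) = trans (cong length (kSubsetsLex-suc n k)) (trans (length-++ (map (true ∷ᵥ_) (kSubsetsLex n k)))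
  (cong₂ _+_ (trans (length-map _ (kSubsetsLex n k)) (length-kSubsetsLex n k))
      (trans (length-map _ (kSubsetsLex n (suc k))) (length-kSubsetsLex n (suc k)))))

disjoint-from? : ∀ (B A : Subset n) → Dec (∣ A ∩ B ∣ < 1)
disjoint-from? B A = ∣ A ∩ B ∣ <? 1

#-disjoint-kSubsets : ∀ (B : Subset n) k → length (filter (disjoint-from? B) (kSubsetsLex n k)) ≤ bin (n ∸ ∣ B ∣) k
#-disjoint-kSubsets []ᵥ zero    = ≤-refl
#-disjoint-kSubsets []ᵥ (suc k) = z≤n
#-disjoint-kSubsets {suc n} (b ∷ᵥ B) zero = ≤-trans (length-filter-≤ (kSubsetsLex (suc n) 0))
    (≤-reflexive (length-kSubsetsLex (suc n) 0))
  where
  length-filter-≤ : ∀ xs → length (filter (disjoint-from? (b ∷ᵥ B)) xs) ≤ length xs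
  length-filter-≤ = length-filter (disjoint-from? (b ∷ᵥ B))
#-disjoint-kSubsets {suc n} (b ∷ᵥ B) (suc k) = ≤-trans
    (≤-reflexive (trans (cong (λ z → length (filter (disjoint-from? (b ∷ᵥ B)) z)) (kSubsetsLex-suc n k))
    (trans (cong length (filter-++ (disjoint-from? (b ∷ᵥ B)) (map (true ∷ᵥ_) (kSubsetsLex n k)) _))
        (trans (length-++ (filter (disjoint-from? (b ∷ᵥ B)) (map (true ∷ᵥ_) (kSubsetsLex n k))))
      (cong₂ _+_ (length-filter-map (disjoint-from? (b ∷ᵥ B)) (true ∷ᵥ_) (kSubsetsLex n k))
          (length-filter-map (disjoint-from? (b ∷ᵥ B)) (false ∷ᵥ_) (kSubsetsLex n (suc k)))))))) (split b)
  where
  split : ∀ b → length (filter (λ A → disjoint-from? (b ∷ᵥ B) (true ∷ᵥ A)) (kSubsetsLex n k)) + length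
      (filter (λ A → disjoint-from? (b ∷ᵥ B) (false ∷ᵥ A)) (kSubsetsLex n (suc k))) ≤ bin (suc n ∸ ∣ b ∷ᵥ B ∣) (suc k)
  split true  = ≤-trans (≤-reflexive (cong (_+ length
      (filter (λ A → disjoint-from? (true ∷ᵥ B) (false ∷ᵥ A)) (kSubsetsLex n (suc k))))
      (cong length (filter-none (λ A → disjoint-from? (true ∷ᵥ B) (true ∷ᵥ A))
      (All.tabulate {xs = kSubsetsLex n k} (λ { _ (s≤s ()) })))))) (#-disjoint-kSubsets B (suc k))
  split false = ≤-trans (+-mono-≤ (#-disjoint-kSubsets B k) (#-disjoint-kSubsets B (suc k)))
      (≤-reflexive (cong (λ z → bin z (suc k)) (sym (+-∸-assoc 1 (∣p∣≤n B)))))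

module _ (t : ℕ) where

  private
    dis? : ∀ {n} (A B : Subset n) → Dec (∣ A ∩ B ∣ < t)
    dis? A B = ∣ A ∩ B ∣ <? t

  crossPairs : List (Subset n) → List (Subset n) → ℕ
  crossPairs []       ys = 0
  crossPairs (A ∷ xs) ys = length (filter (dis? A) ys) + crossPairs xs ys

  tDisjointPairs-++ : (xs ys : List (Subset n)) → tDisjointPairs t
      (xs ++ ys) ≡ tDisjointPairs t xs + tDisjointPairs t ys + crossPairs xs ys
  tDisjointPairs-++ []       ys = sym (+-identityʳ _)
  tDisjointPairs-++ (A ∷ xs) ys = trans (cong₂ _+_
      (trans (cong length (filter-++ (dis? A) xs ys)) (length-++ (filter (dis? A) xs))) (tDisjointPairs-++ xs ys))
    (eq (length (filter (dis? A) xs)) (length (filter (dis? A) ys)) (tDisjointPairs t xs) (tDisjointPairs t ys) (crossPairs xs ys))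
    where
    eq : ∀ a b d e f → (a + b) + (d + e + f) ≡ (a + d) + e + (b + f)
    eq = solve-∀

  crossPairs-[] : (xs : List (Subset n)) → crossPairs xs [] ≡ 0
  crossPairs-[] []       = refl
  crossPairs-[] (A ∷ xs) = crossPairs-[] xs

  crossPairs-∷ : (xs ys : List (Subset n)) (B : Subset n) → crossPairs xs (B ∷ ys) ≡ length
      (filter (λ A → dis? A B) xs) + crossPairs xs ys
  crossPairs-∷ []       ys B = refl
  crossPairs-∷ (A ∷ xs) ys B = trans (cong₂ _+_ (length-filter-∷ (dis? A) B ys) (crossPairs-∷ xs ys B))
    (trans (eq (𝟙 (dis? A B)) (length (filter (dis? A) ys)) (length (filter (λ A → dis? A B) xs)) (crossPairs xs ys))
      (cong (_+ crossPairs (A ∷ xs) ys) (sym (length-filter-∷ (λ A → dis? A B) A xs))))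
    where
    eq : ∀ a b d e → (a + b) + (d + e) ≡ (a + d) + (b + e)
    eq = solve-∀

  crossPairs-≤ : (xs ys : List (Subset n)) (K : ℕ) → All
      (λ B → length (filter (λ A → dis? A B) xs) ≤ K) ys → crossPairs xs ys ≤ length ys * K
  crossPairs-≤ xs []       K []       = ≤-reflexive (crossPairs-[] xs)
  crossPairs-≤ xs (B ∷ ys) K (h ∷ hs) = ≤-trans (≤-reflexive (crossPairs-∷ xs ys B)) (+-mono-≤ h (crossPairs-≤ xs ys K hs))

  tDisjointPairs-false : (F : List (Subset n)) → tDisjointPairs t (map (false ∷ᵥ_) F) ≡ tDisjointPairs t F
  tDisjointPairs-false []      = refl
  tDisjointPairs-false (A ∷ F) = cong₂ _+_ (length-filter-map (λ B → ∣ (false ∷ᵥ A) ∩ B ∣ <? t) (false ∷ᵥ_) F)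
      (tDisjointPairs-false F)

  tDisjointPairs-true : (F : List (Subset n)) → tDisjointPairs (suc t) (map (true ∷ᵥ_) F) ≡ tDisjointPairs t F
  tDisjointPairs-true []      = refl
  tDisjointPairs-true (A ∷ F) = cong₂ _+_ (trans (length-filter-map (λ B → ∣ (true ∷ᵥ A) ∩ B ∣ <? suc t) (true ∷ᵥ_) F)
    (cong length (filter-≐ (λ B → suc ∣ A ∩ B ∣ <? suc t) (λ B → ∣ A ∩ B ∣ <? t) (≤-pred , s≤s) F))) (tDisjointPairs-true F)

tDisjointPairs-0 : (F : List (Subset n)) → tDisjointPairs 0 F ≡ 0
tDisjointPairs-0 []      = refl
tDisjointPairs-0 (A ∷ F) = cong₂ _+_ (cong length (filter-none (λ B → ∣ A ∩ B ∣ <? 0) (All.tabulate {xs = F} (λ _ ()))))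
    (tDisjointPairs-0 F)

-- `Λ` with the upper indices m and x as independent arguments, so that both can vary in an
-- induction on n.
lam : ℕ → ℕ → ℕ → ℕ → ℕ
lam m x c zero    = 0
lam m x c (suc q) = lam m x c q + tel (suc q) (suc m) c * bin (x ∸ suc q) c

-- The size of the first star is a summand of every `B`, so it factors out and multiplies the sum of
-- all slope increments; what remains is `lam` for one star less.
lam-shift : ∀ m x c q → lam (suc m) (suc x) c (suc q) ≡ bin (suc m) c * tel (suc q) (suc x) c + lam m x c q
lam-shift m x c zero    = sym (+-identityʳ _)
lam-shift m x c (suc q) = trans (cong₂ (λ a b → a + b * bin (x ∸ suc q) c) (lam-shift m x c q) (tel-shift (suc q) (suc m) c))
  (eq (bin (suc m) c) (tel (suc q) (suc x) c) (lam m x c q) (tel (suc q) (suc m) c) (bin (x ∸ suc q) c))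
  where
  eq : ∀ b w l B K → b * w + l + (b + B) * K ≡ b * (w + K) + (l + B * K)
  eq = solve-∀

L-true : ∀ n k s → s ≤ bin n k → L (suc n) (suc k) s ≡ map (true ∷ᵥ_) (L n k s)
L-true n k s h = trans (cong (take s) (kSubsetsLex-suc n k))
  (trans (take-≤-++ s (map (true ∷ᵥ_) (kSubsetsLex n k)) _
      (≤-trans h (≤-reflexive (sym (trans (length-map _ (kSubsetsLex n k)) (length-kSubsetsLex n k))))))
         (take-map s (kSubsetsLex n k)))

L-false : ∀ n k s → L (suc n) (suc k) (bin n k + s) ≡ map (true ∷ᵥ_) (kSubsetsLex n k) ++ map (false ∷ᵥ_) (L n (suc k) s)
L-false n k s = trans (cong₂ (λ a b → take (a + s) b)
    (sym (trans (length-map (true ∷ᵥ_) (kSubsetsLex n k)) (length-kSubsetsLex n k))) (kSubsetsLex-suc n k))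
  (trans (take-+-++ (map (true ∷ᵥ_) (kSubsetsLex n k)) _ s)
      (cong (map (true ∷ᵥ_) (kSubsetsLex n k) ++_) (take-map s (kSubsetsLex n (suc k)))))

LexBound : ℕ → ℕ → ℕ → ℕ → ℕ → Set
LexBound n t c s q = tDisjointPairs t (L n (t + c) s) + lam (n ∸ t) (n ∸ (t + c)) c q ≤ tel q (n ∸ (t + c)) c * s

-- The first star is intersecting. Beyond it the list continues as the lexicographic list on the
-- remaining points, each set being disjoint from at most K sets of the first star; this raises the
-- slope by K and q by one.
lex-bound₁ : ∀ ℓ n c s → ℓ + c < n → s ≤ tel (suc ℓ) n c → ∃[ q ] (q ≤ ℓ × LexBound n 1 c s q)
lex-bound₁ ℓ (suc n) c s (s≤s room) s≤ = by-cases (s ≤? bin n c)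
  where
  by-cases : Dec (s ≤ bin n c) → ∃[ q ] (q ≤ ℓ × LexBound (suc n) 1 c s q)
  by-cases (yes h) = 0 , z≤n , ≤-reflexive (trans (+-identityʳ _)
      (trans (cong (tDisjointPairs 1) (L-true n c s h)) (trans (tDisjointPairs-true 0 (L n c s)) (tDisjointPairs-0 (L n c s)))))
  by-cases (no ¬h) = let s′ , e = m≤n⇒∃[o]m+o≡n (<⇒≤ (≰⇒> ¬h)) in step ℓ n room s′ (sym e) (≰⇒> ¬h) s≤
    where
    step : ∀ ℓ n → ℓ + c ≤ n → ∀ s′ → s ≡ bin n c + s′ → bin n c < s → s ≤ tel (suc ℓ) (suc n) c → ∃[ q ]
        (q ≤ ℓ × LexBound (suc n) 1 c s q)
    step zero n _ s′ _ lt s≤ = contradiction s≤ (<⇒≱ lt)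
    step (suc ℓ) (suc n) (s≤s room) s′ refl lt s≤ =
      let q , q≤ℓ , ih = lex-bound₁ ℓ (suc n) c s′ (s≤s room) (+-cancelˡ-≤ (bin (suc n) c) _ _ (≤-trans s≤ (≤-reflexive (tel-shift (suc ℓ) (suc n) c))))
      in suc q , s≤s q≤ℓ , extend q ih
      where
      open ≤-Reasoning
      b = bin (suc n) c
      𝒯 = map (true ∷ᵥ_) (kSubsetsLex (suc n) c)
      ℱ = map (false ∷ᵥ_) (L (suc n) (suc c) s′)
      K = bin (n ∸ c) c
      x≡ : suc n ∸ c ≡ suc (n ∸ c)
      x≡ = +-∸-assoc 1 (m+n≤o⇒n≤o ℓ room)
      eq₁ : ∀ a x b l → a + x + (b + l) ≡ a + l + x + b
      eq₁ = solve-∀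
      eq₂ : ∀ w s K b → w * s + s * K + b * (K + w) ≡ (K + w) * (b + s)
      eq₂ = solve-∀
      cross : crossPairs 1 𝒯 ℱ ≤ s′ * K
      cross = ≤-trans (crossPairs-≤ 1 𝒯 ℱ K (All.map⁺
          (All.map each (All.take⁺ s′ (All.all-filter (λ A → ∣ A ∣ ≟ suc c) (allSubsetsLex (suc n)))))))
        (*-monoˡ-≤ K (≤-trans (≤-reflexive (trans (length-map (false ∷ᵥ_) (L (suc n) (suc c) s′))
            (length-take s′ (kSubsetsLex (suc n) (suc c))))) (m⊓n≤m s′ _)))
        where
        each : ∀ {B : Subset (suc n)} → ∣ B ∣ ≡ suc c → length (filter (λ A → ∣ A ∩ (false ∷ᵥ B) ∣ <? 1) 𝒯) ≤ K
        each {B} ∣B∣ = ≤-trans (≤-reflexive (length-filter-map (λ A → ∣ A ∩ (false ∷ᵥ B) ∣ <? 1) (true ∷ᵥ_)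
            (kSubsetsLex (suc n) c)))
          (≤-trans (#-disjoint-kSubsets B c) (≤-reflexive (cong (λ z → bin (suc n ∸ z) c) ∣B∣)))
      extend : ∀ q → LexBound (suc n) 1 c s′ q → LexBound (suc (suc n)) 1 c (b + s′) (suc q)
      extend q ih = begin
        tDisjointPairs 1 (L (suc (suc n)) (suc c) (b + s′)) + lam (suc n) (suc n ∸ c) c (suc q)
          ≡⟨ cong₂ _+_ (trans (cong (tDisjointPairs 1) (L-false (suc n) c s′)) (trans (tDisjointPairs-++ 1 𝒯 ℱ)
               (cong₂ (λ u v → u + v + crossPairs 1 𝒯 ℱ)
                   (trans (tDisjointPairs-true 0 (kSubsetsLex (suc n) c)) (tDisjointPairs-0 (kSubsetsLex (suc n) c)))
                 (tDisjointPairs-false 1 (L (suc n) (suc c) s′)))))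
                     (trans (cong (λ z → lam (suc n) z c (suc q)) x≡) (lam-shift n (n ∸ c) c q)) ⟩
        tDisjointPairs 1 (L (suc n) (suc c) s′) + crossPairs 1 𝒯 ℱ + (b * tel (suc q) (suc (n ∸ c)) c + lam n (n ∸ c) c q)
          ≡⟨ eq₁ (tDisjointPairs 1 (L (suc n) (suc c) s′)) (crossPairs 1 𝒯 ℱ) (b * tel (suc q) (suc (n ∸ c)) c)
              (lam n (n ∸ c) c q) ⟩
        tDisjointPairs 1 (L (suc n) (suc c) s′) + lam n (n ∸ c) c q + crossPairs 1 𝒯 ℱ + b * tel (suc q) (suc (n ∸ c)) c
          ≤⟨ +-mono-≤ (+-mono-≤ ih cross) (≤-reflexive (cong (b *_) (tel-shift q (n ∸ c) c))) ⟩
        w * s′ + s′ * K + b * (K + w)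
          ≡⟨ eq₂ w s′ K b ⟩
        (K + w) * (b + s′)
          ≡⟨ cong (_* (b + s′)) (sym (trans (cong (λ z → tel (suc q) z c) x≡) (tel-shift q (n ∸ c) c))) ⟩
        tel (suc q) (suc n ∸ c) c * (b + s′) ∎
        where
        w = tel q (n ∸ c) c

bin-diagonal : ∀ i x c → bin x c ≤ bin (i + x) (i + c)
bin-diagonal zero    x c = ≤-refl
bin-diagonal (suc i) x c = ≤-trans (bin-diagonal i x c) (m≤m+n _ _)

-- While all s sets contain the first point, deleting it lowers n, t and k together and leaves n -
-- t, n - k and c, hence the whole bound, unchanged. This ends at intersection size 1.
lex-bound : ∀ t ℓ n c s → suc ℓ + (t + c) ≤ n → s ≤ tel (suc ℓ) (suc n ∸ suc t) c → ∃[ q ] (q ≤ ℓ × LexBound n (suc t) c s q)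
lex-bound zero    ℓ n       c s room s≤ = lex-bound₁ ℓ n c s room s≤
lex-bound (suc t) ℓ (suc n) c s (s≤s room) s≤ =
  let room′ = ≤-trans (≤-reflexive (sym (+-suc ℓ (t + c)))) room
      q , q≤ℓ , h = lex-bound t ℓ n c s room′ s≤
      t≤n : t ≤ n
      t≤n = ≤-trans (≤-trans (m≤m+n t c) (m≤n+m (t + c) (suc ℓ))) room′
      -- The range of s keeps the list among the sets that contain the first point.
      small : s ≤ bin n (suc t + c)
      small = ≤-trans s≤ (≤-trans (≤-trans (m≤m+n _ _)
          (≤-reflexive (tel-sum (suc ℓ) (n ∸ t) c (m+n≤o⇒m≤o∸n (suc ℓ) (≤-trans (+-monoʳ-≤ (suc ℓ) (m≤m+n t c)) room′)))))
        (≤-trans (bin-diagonal t (n ∸ t) (suc c)) (≤-reflexive (cong₂ bin (m+[n∸m]≡n t≤n) (+-suc t c)))))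
  in q , q≤ℓ , subst (λ z → z + lam (n ∸ suc t) (n ∸ (suc t + c)) c q ≤ tel q (n ∸ (suc t + c)) c * s)
       (sym (trans (cong (tDisjointPairs (suc (suc t))) (L-true n (suc t + c) s small))
           (tDisjointPairs-true (suc t) (L n (suc t + c) s)))) h

-- Descent to a local optimum

module Descent (n t c′ : ℕ) where
  open Estimates n t c′
  open Stars n t c
  open Sunflowers n t c
  open PureFamilies n t c
  open CrossingPairs n t c
  open Shapes n t c′
  open Degrees n t c′
  open Popularity n t c′
  open LocalOptima n t c′

  module _ (X : Subset n) where

    pairs-singleton-≤ : {P : Subset n → Set} (P? : Decidable P) → pairs Disj? (_≟ₛ X) P? ≤ # (P? ∧? Disj? X)
    pairs-singleton-≤ P? = ≤-trans (pairs-≤ Disj? (_≟ₛ X) P? (# (P? ∧? Disj? X)) (λ { A refl → ≤-refl }))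
      (≤-trans (*-monoˡ-≤ (# (P? ∧? Disj? X)) (#-singleton X)) (≤-reflexive (*-identityˡ _)))

    pairs-singleton-≥ : {P : Subset n → Set} (P? : Decidable P) → # (P? ∧? Disj? X) ≤ pairs Disj? (_≟ₛ X) P?
    pairs-singleton-≥ P? = ≤-trans (≤-trans (≤-reflexive (sym (*-identityˡ _)))
        (*-monoˡ-≤ (# (P? ∧? Disj? X)) (#-positive (_≟ₛ X) refl)))
      (pairs-≥ Disj? (_≟ₛ X) P? (# (P? ∧? Disj? X)) (λ { A refl → ≤-refl }))

    not-self-disjoint : ∣ X ∣ ≡ k → ¬ ∣ X ∩ X ∣ < t
    not-self-disjoint e lt = <⇒≱ lt (≤-trans (m≤m+n t c) (≤-trans (≤-reflexive (sym e)) (∣p∩q∣≥∣q∣ {p = X} {q = X} ⊆-refl)))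

    D-singleton : ∣ X ∣ ≡ k → D (_≟ₛ X) ≡ 0
    D-singleton e = n≤0⇒n≡0 (≤-trans (pairs-singleton-≤ (_≟ₛ X))
        (≤-reflexive (#-empty (λ B → (B ≟ₛ X) ×-dec Disj? X B) λ { B (refl , lt) → not-self-disjoint e lt })))

  kSubset? : Decidable (λ (A : Subset n) → ∣ A ∣ ≡ k)
  kSubset? A = ∣ A ∣ ≟ k

  -- The Lagrangian D + 2 w (number of k-sets outside the family) decreases along every improving addition or removal.
  descent : ∀ q →
    (∀ {F : Subset n → Set} (F? : Decidable F) → (∀ {A} → F A → ∣ A ∣ ≡ k) →
      (∀ {A} → F A → # F? ≤ w q + # (F? ∧? Inter? A)) →
      (∀ {A} → ∣ A ∣ ≡ k → ¬ F A → # (F? ∧? Inter? A) + w q ≤ # F?) →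
      2 * (w q * # F?) ≤ D F? + 2 * Λ q) →
    ∀ v {F : Subset n → Set} (F? : Decidable F) → (∀ {A} → F A → ∣ A ∣ ≡ k) →
    D F? + 2 * (w q * (# kSubset? ∸ # F?)) < v → 2 * (w q * # F?) ≤ D F? + 2 * Λ q
  descent q local (suc v) {F} F? sized (s≤s small) = by-cases (anySubset? removable?) (anySubset? addable?)
    where
    open ≤-Reasoning
    ideg : Subset n → ℕ
    ideg A = # (F? ∧? Inter? A)
    ddeg : Subset n → ℕ
    ddeg A = # (F? ∧? Disj? A)
    removable? : Decidable (λ A → F A × w q + ideg A < # F?)
    removable? A = F? A ×-dec (w q + ideg A <? # F?)
    addable? : Decidable (λ A → ∣ A ∣ ≡ k × ¬ F A × # F? < ideg A + w q)
    addable? A = (∣ A ∣ ≟ k) ×-dec ¬? (F? A) ×-dec (# F? <? ideg A + w q)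
    #F≤ : # F? ≤ # kSubset?
    #F≤ = #-mono F? kSubset? (λ _ → sized)
    deg-≤ : ∀ A → # F? ≤ ddeg A + ideg A
    deg-≤ A = #-union F? (F? ∧? Disj? A) (F? ∧? Inter? A) split
      where
      split : ∀ B → F B → (F B × ∣ A ∩ B ∣ < t) ⊎ (F B × t ≤ ∣ A ∩ B ∣)
      split B f with <-≤-connex ∣ A ∩ B ∣ t
      ... | inj₁ d = inj₁ (f , d)
      ... | inj₂ i = inj₂ (f , i)
    deg-≥ : ∀ A → ddeg A + ideg A ≤ # F?
    deg-≥ A = #-disjoint F? (F? ∧? Disj? A) (F? ∧? Inter? A) (λ _ → proj₁) (λ _ → proj₁) (λ _ (_ , d) (_ , i) → <⇒≱ d i)
    remove : ∃[ A ] (F A × w q + ideg A < # F?) → 2 * (w q * # F?) ≤ D F? + 2 * Λ q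
    remove (X , fX , lt) = begin
      2 * (w q * # F?)                        ≡⟨ cong (λ z → 2 * (w q * z)) #F≡ ⟩
      2 * (w q * suc (# F′?))                 ≡⟨ eq₁ (w q) (# F′?) ⟩
      2 * (w q * # F′?) + 2 * w q             ≤⟨ +-mono-≤ (descent q local v F′? (λ (f , _) → sized f) measure)
          (*-monoʳ-≤ 2 (<⇒≤ w<)) ⟩
      D F′? + 2 * Λ q + 2 * ddeg X            ≡⟨ eq₂ (D F′?) (2 * Λ q) (2 * ddeg X) ⟩
      D F′? + 2 * ddeg X + 2 * Λ q            ≤⟨ +-monoˡ-≤ (2 * Λ q) D≥ ⟩
      D F? + 2 * Λ q                          ∎
      where
      F′? : Decidable (λ A → F A × A ≢ X)
      F′? A = F? A ×-dec ¬? (A ≟ₛ X)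
      eq₁ : ∀ a b → 2 * (a * suc b) ≡ 2 * (a * b) + 2 * a
      eq₁ = solve-∀
      eq₂ : ∀ a b d → a + b + d ≡ a + d + b
      eq₂ = solve-∀
      w< : w q < ddeg X
      w< = +-cancelʳ-< (ideg X) (w q) (ddeg X) (<-≤-trans lt (deg-≤ X))
      D≥ : D F′? + 2 * ddeg X ≤ D F?
      D≥ = ≤-trans (+-monoʳ-≤ (D F′?) (*-monoʳ-≤ 2 (≤-trans (#-mono (F? ∧? Disj? X) (F′? ∧? Disj? X)
              (λ B (f , d) → (f , λ { refl → not-self-disjoint X (sized fX) d }) , d)) (pairs-singleton-≥ X F′?))))
        (≤-trans (m≤m+n _ (D (_≟ₛ X))) (pairs-square-≥ Disj? F? F′? (_≟ₛ X) Disj-sym (λ _ → proj₁) (λ { _ refl → fX })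
            (λ _ → proj₂)))
      #F≡ : # F? ≡ suc (# F′?)
      #F≡ = ≤-antisym (≤-trans (#-union F? (_≟ₛ X) F′? split) (+-monoˡ-≤ (# F′?) (#-singleton X)))
              (≤-trans (+-monoˡ-≤ (# F′?) (#-positive (_≟ₛ X) refl))
                  (#-disjoint F? (_≟ₛ X) F′? (λ { _ refl → fX }) (λ _ → proj₁) (λ _ e (_ , ne) → ne e)))
        where
        split : ∀ A → F A → A ≡ X ⊎ (F A × A ≢ X)
        split A f with A ≟ₛ X
        ... | yes e = inj₁ e
        ... | no ne = inj₂ (f , ne)
      measure : D F′? + 2 * (w q * (# kSubset? ∸ # F′?)) < v
      measure = begin-strict
        D F′? + 2 * (w q * (# kSubset? ∸ # F′?))              ≡⟨ cong (λ z → D F′? + 2 * (w q * z)) complement ⟩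
        D F′? + 2 * (w q * suc (# kSubset? ∸ # F?))           ≡⟨ eq₃ (D F′?) (w q) (# kSubset? ∸ # F?) ⟩
        (D F′? + 2 * w q) + 2 * (w q * (# kSubset? ∸ # F?))   <⟨ +-monoˡ-< _ (+-monoʳ-< (D F′?) (*-monoʳ-< 2 w<)) ⟩
        (D F′? + 2 * ddeg X) + 2 * (w q * (# kSubset? ∸ # F?)) ≤⟨ +-monoˡ-≤ _ D≥ ⟩
        D F? + 2 * (w q * (# kSubset? ∸ # F?))                ≤⟨ small ⟩
        v                                                     ∎
        where
        eq₃ : ∀ a w r → a + 2 * (w * suc r) ≡ (a + 2 * w) + 2 * (w * r)
        eq₃ = solve-∀
        complement : # kSubset? ∸ # F′? ≡ suc (# kSubset? ∸ # F?)
        complement = trans (cong (λ z → suc (# kSubset?) ∸ z) (sym #F≡)) (+-∸-assoc 1 #F≤)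
    add : ∃[ A ] (∣ A ∣ ≡ k × ¬ F A × # F? < ideg A + w q) → 2 * (w q * # F?) ≤ D F? + 2 * Λ q
    add (X , ∣X∣ , ¬fX , lt) = +-cancelʳ-≤ (2 * w q) _ _ (begin
      2 * (w q * # F?) + 2 * w q              ≡⟨ sym (eq₁ (w q) (# F?)) ⟩
      2 * (w q * suc (# F?))                  ≡⟨ cong (λ z → 2 * (w q * z)) (sym #F′≡) ⟩
      2 * (w q * # F′?)                       ≤⟨ descent q local v F′? [ sized , (λ { refl → ∣X∣ }) ]′ measure ⟩
      D F′? + 2 * Λ q                         ≤⟨ +-monoˡ-≤ (2 * Λ q) (≤-trans D≤ (+-monoʳ-≤ (D F?) (*-monoʳ-≤ 2 (<⇒≤ <w)))) ⟩
      D F? + 2 * w q + 2 * Λ q                ≡⟨ eq₂ (D F?) (2 * w q) (2 * Λ q) ⟩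
      D F? + 2 * Λ q + 2 * w q                ∎)
      where
      F′? : Decidable (λ A → F A ⊎ A ≡ X)
      F′? A = F? A ⊎-dec (A ≟ₛ X)
      eq₁ : ∀ a b → 2 * (a * suc b) ≡ 2 * (a * b) + 2 * a
      eq₁ = solve-∀
      eq₂ : ∀ a b d → a + b + d ≡ a + d + b
      eq₂ = solve-∀
      <w : ddeg X < w q
      <w = +-cancelʳ-< (ideg X) (ddeg X) (w q) (≤-<-trans (deg-≥ X) (<-≤-trans lt (≤-reflexive (+-comm (ideg X) (w q)))))
      D≤ : D F′? ≤ D F? + 2 * ddeg X
      D≤ = ≤-trans (pairs-square-≤ Disj? F′? F? (_≟ₛ X) Disj-sym (λ _ z → z))
          (≤-trans (≤-reflexive (trans (cong (D F? + 2 * pairs Disj? (_≟ₛ X) F? +_) (D-singleton X ∣X∣)) (+-identityʳ _)))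
        (+-monoʳ-≤ (D F?) (*-monoʳ-≤ 2 (pairs-singleton-≤ X F?))))
      #F′≡ : # F′? ≡ suc (# F?)
      #F′≡ = ≤-antisym (≤-trans (#-union F′? (_≟ₛ X) F? (λ _ → [ inj₂ , inj₁ ]′)) (+-monoˡ-≤ (# F?) (#-singleton X)))
              (≤-trans (+-monoˡ-≤ (# F?) (#-positive (_≟ₛ X) refl))
                  (#-disjoint F′? (_≟ₛ X) F? (λ _ → inj₂) (λ _ → inj₁) (λ { _ refl f → ¬fX f })))
      measure : D F′? + 2 * (w q * (# kSubset? ∸ # F′?)) < v
      measure = begin-strict
        D F′? + 2 * (w q * (# kSubset? ∸ # F′?))                 ≤⟨ +-monoˡ-≤ _ D≤ ⟩
        D F? + 2 * ddeg X + 2 * (w q * (# kSubset? ∸ # F′?))     <⟨ +-monoˡ-< _ (+-monoʳ-< (D F?) (*-monoʳ-< 2 <w)) ⟩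
        D F? + 2 * w q + 2 * (w q * (# kSubset? ∸ # F′?))        ≡⟨ eq₃ (D F?) (w q) (# kSubset? ∸ # F′?) ⟩
        D F? + 2 * (w q * suc (# kSubset? ∸ # F′?))              ≡⟨ cong (λ z → D F? + 2 * (w q * z)) complement ⟩
        D F? + 2 * (w q * (# kSubset? ∸ # F?))                   ≤⟨ small ⟩
        v                                                        ∎
        where
        eq₃ : ∀ a w r → a + 2 * w + 2 * (w * r) ≡ a + 2 * (w * suc r)
        eq₃ = solve-∀
        complement : suc (# kSubset? ∸ # F′?) ≡ # kSubset? ∸ # F?
        complement = trans (sym (+-∸-assoc 1 (#-mono F′? kSubset? (λ _ → [ sized , (λ { refl → ∣X∣ }) ]′))))
            (cong (suc (# kSubset?) ∸_) #F′≡)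
    by-cases : Dec (∃[ A ] (F A × w q + ideg A < # F?)) → Dec (∃[ A ] (∣ A ∣ ≡ k × ¬ F A × # F? < ideg A + w q)) →
               2 * (w q * # F?) ≤ D F? + 2 * Λ q
    by-cases (yes r) _       = remove r
    by-cases (no _)  (yes a) = add a
    by-cases (no ¬r) (no ¬a) = local F? sized (λ {A} f → ≮⇒≥ λ lt → ¬r (A , f , lt)) (λ {A} e ¬f → ≮⇒≥ λ lt → ¬a (A , e , ¬f , lt))

  Λ≡lam : ∀ q → Λ q ≡ lam (n ∸ t) (n ∸ (t + c)) c q
  Λ≡lam zero    = refl
  Λ≡lam (suc q) = cong (_+ B (suc q) * bin (x ∸ suc q) c) (Λ≡lam q)

  _∈ₗ?_ : ∀ (A : Subset n) F → Dec (A ∈ₗ F)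
  _∈ₗ?_ = DecMembership._∈?_ _≟ₛ_

  #-members-≤ : {Q : Subset n → Set} (Q? : Decidable Q) (F : List (Subset n)) → # (λ A → (A ∈ₗ? F) ×-dec Q? A) ≤ length
      (filter Q? F)
  #-members-≤ Q? [] = ≤-reflexive (#-empty (λ A → (A ∈ₗ? []) ×-dec Q? A) λ { _ (() , _) })
  #-members-≤ {Q} Q? (X ∷ F) = ≤-trans (#-union (λ A → (A ∈ₗ? (X ∷ F)) ×-dec Q? A) (λ A → (A ≟ₛ X) ×-dec Q? A)
      (λ A → (A ∈ₗ? F) ×-dec Q? A)
      (λ { A (here e , r) → inj₁ (e , r) ; A (there a , r) → inj₂ (a , r) }))
    (≤-trans (+-mono-≤ (head (Q? X)) (#-members-≤ Q? F)) (≤-reflexive (sym (length-filter-∷ Q? X F))))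
    where
    head : Dec (Q X) → # (λ A → (A ≟ₛ X) ×-dec Q? A) ≤ 𝟙 (Q? X)
    head (yes r) = ≤-trans (#-mono (λ A → (A ≟ₛ X) ×-dec Q? A) (_≟ₛ X) (λ _ → proj₁))
        (≤-trans (#-singleton X) (≤-reflexive (sym (𝟙-yes (Q? X) r))))
    head (no ¬r) = ≤-trans (≤-reflexive (#-empty (λ A → (A ≟ₛ X) ×-dec Q? A) λ { _ (refl , r) → ¬r r })) z≤n

  length-≤-# : (F : List (Subset n)) → Unique F → length F ≤ # (_∈ₗ? F)
  length-≤-# [] _ = z≤n
  length-≤-# (X ∷ F) (ne ∷ un) = ≤-trans (+-mono-≤ (#-positive (_≟ₛ X) refl) (length-≤-# F un))
    (#-disjoint (_∈ₗ? (X ∷ F)) (_≟ₛ X) (_∈ₗ? F) (λ _ → here) (λ _ → there) (λ { _ refl a → All.lookup ne a refl }))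

  -- A k-set is not t-disjoint from itself, so the diagonal is empty and passing from ordered to
  -- unordered pairs is just a factor 2.
  D-≤-tDisjointPairs : (F : List (Subset n)) → All (λ A → ∣ A ∣ ≡ k) F → D (_∈ₗ? F) ≤ 2 * tDisjointPairs t F
  D-≤-tDisjointPairs [] _ = ≤-trans (pairs-≤ Disj? (_∈ₗ? []) (_∈ₗ? []) 0 (λ _ ())) (≤-reflexive (*-zeroʳ (# (_∈ₗ? []))))
  D-≤-tDisjointPairs (X ∷ F) (∣X∣ ∷ sz) = begin
    D (_∈ₗ? (X ∷ F))
      ≤⟨ pairs-square-≤ Disj? (_∈ₗ? (X ∷ F)) (_∈ₗ? F) (_≟ₛ X) Disj-sym (λ { _ (here e) → inj₂ e ; _ (there a) → inj₁ a }) ⟩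
    D (_∈ₗ? F) + 2 * pairs Disj? (_≟ₛ X) (_∈ₗ? F) + D (_≟ₛ X)
      ≡⟨ trans (cong (D (_∈ₗ? F) + 2 * pairs Disj? (_≟ₛ X) (_∈ₗ? F) +_) (D-singleton X ∣X∣)) (+-identityʳ _) ⟩
    D (_∈ₗ? F) + 2 * pairs Disj? (_≟ₛ X) (_∈ₗ? F)
      ≤⟨ +-mono-≤ (D-≤-tDisjointPairs F sz) (*-monoʳ-≤ 2 (≤-trans (pairs-singleton-≤ X (_∈ₗ? F)) (#-members-≤ (Disj? X) F))) ⟩
    2 * tDisjointPairs t F + 2 * length (filter (Disj? X) F)
      ≡⟨ trans (+-comm (2 * tDisjointPairs t F) _) (sym (*-distribˡ-+ 2 (length (filter (Disj? X) F)) (tDisjointPairs t F))) ⟩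
    2 * tDisjointPairs t (X ∷ F) ∎
    where open ≤-Reasoning

-- How large n has to be

module Threshold (t c′ q : ℕ) where

  private
    c = suc c′
    k = t + c

  open ErrorTerms c
  open Constants t c q

  far-error : ℕ
  far-error = er q + 2 * (ε q * (1 + q * c)) + 2 * (k * k + t * k)

  -- Up to common factors the requirements have the form a * M ≤ N; H is the sum of their
  -- coefficients a.
  H : ℕ
  H = far-error + (2 * (2 + c) + (scale * (bound * bound + er q) + (suc (cut * bound) + (scale * C₁ + 2 * (suc q * C₂ * C₁)))))

  -- Since c * N = m * M, N ≥ H * M holds as soon as m ≥ c * H; the summand k + q + 1 is the room
  -- for q + 1 stars.
  threshold : ℕ
  threshold = k + suc q + (t + (c * H + c + 2))

module Asymptotic (n t c′ q : ℕ) (0<t : 0 < t) (0<q : 0 < q) (large : Threshold.threshold t c′ q ≤ n) where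

  open Threshold t c′ q
  open Estimates n t c′
  open Stars n t c
  open CrossingPairs n t c
  open Degrees n t c′
  open LocalOptima n t c′
  open Descent n t c′
  open Constants t c q

  room : k + suc q ≤ n
  room = ≤-trans (m≤m+n _ _) large

  m-large : c * H + c + 2 ≤ m
  m-large = m+n≤o⇒m≤o∸n (c * H + c + 2) (≤-trans (≤-reflexive (+-comm _ t)) (≤-trans (m≤n+m _ (k + suc q)) large))

  cN≡mM : c * N ≡ m * M
  cN≡mM = go m (≤-trans (m≤n+m 2 (c * H + c)) m-large)
    where
    go : ∀ m → 2 ≤ m → c * bin m c ≡ m * bin (m ∸ 1) c′
    go (suc m) _ = bin-absorb-suc m c′

  M>0 : 0 < M
  M>0 = bin-pos (∸-monoˡ-≤ 1 (≤-trans (≤-trans (m≤n+m c (c * H)) (m≤m+n (c * H + c) 2)) m-large))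

  HM≤N : H * M ≤ N
  HM≤N = *-cancelˡ-≤ c (begin
    c * (H * M)     ≡⟨ sym (*-assoc c H M) ⟩
    c * H * M       ≤⟨ *-monoˡ-≤ M (≤-trans (≤-trans (m≤m+n (c * H) c) (m≤m+n _ 2)) m-large) ⟩
    m * M           ≡⟨ sym cN≡mM ⟩
    c * N           ∎)
    where open ≤-Reasoning

  M₂≤M : M₂ ≤ M
  M₂≤M = go m (≤-trans (m≤n+m 2 (c * H + c)) m-large)
    where
    go : ∀ m → 2 ≤ m → bin⁻ (m ∸ 2) c′ ≤ bin (m ∸ 1) c′
    go (suc (suc m)) _ = ≤-trans (m≤m+n _ _) (≤-reflexive (sym (bin-suc m c′)))
    go (suc zero) (s≤s ())

  -- N / M = m / c is at most M / M₂ = (m - 1) / (c - 1) because c ≤ m; for c = 1, M₂ is zero.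
  NM₂ : N * M₂ ≤ M * M
  NM₂ = go m c′ (≤-trans (m≤n+m 2 (c * H + c)) m-large) (≤-trans (≤-trans (m≤n+m c (c * H)) (m≤m+n (c * H + c) 2)) m-large)
    where
    open ≤-Reasoning
    go : ∀ m c′ → 2 ≤ m → suc c′ ≤ m → bin m (suc c′) * bin⁻ (m ∸ 2) c′ ≤ bin (m ∸ 1) c′ * bin (m ∸ 1) c′
    go m              zero     _ _ = ≤-trans (≤-reflexive (*-zeroʳ (bin m 1))) z≤n
    go (suc zero)     (suc _) (s≤s ()) _
    go (suc (suc m)) (suc d) _ (s≤s (s≤s d≤m)) = *-cancelˡ-≤ (suc (suc d) * suc m) (begin
      suc (suc d) * suc m * (N′ * L′)           ≡⟨ eq₁ d m N′ L′ ⟩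
      (suc (suc d) * N′) * (suc m * L′)         ≡⟨ cong₂ _*_ (bin-absorb-suc (suc m) (suc d)) (sym (bin-absorb-suc m d)) ⟩
      (suc (suc m) * M′) * (suc d * M′)         ≡⟨ eq₂ d m M′ ⟩
      suc (suc m) * suc d * (M′ * M′)           ≤⟨ *-monoˡ-≤ (M′ * M′) arith ⟩
      suc (suc d) * suc m * (M′ * M′)           ∎)
      where
      N′ = bin (suc (suc m)) (suc (suc d))
      M′ = bin (suc m) (suc d)
      L′ = bin m d
      eq₁ : ∀ d m N L → suc (suc d) * suc m * (N * L) ≡ (suc (suc d) * N) * (suc m * L)
      eq₁ = solve-∀
      eq₂ : ∀ d m M → (suc (suc m) * M) * (suc d * M) ≡ suc (suc m) * suc d * (M * M)
      eq₂ = solve-∀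
      arith : suc (suc m) * suc d ≤ suc (suc d) * suc m
      arith = ≤-trans (≤-reflexive (eq₃ d m)) (≤-trans (+-monoʳ-≤ (suc d * suc m) (s≤s d≤m)) (≤-reflexive (eq₄ d m)))
        where
        eq₃ : ∀ d m → suc (suc m) * suc d ≡ suc d * suc m + suc d
        eq₃ = solve-∀
        eq₄ : ∀ d m → suc d * suc m + suc m ≡ suc (suc d) * suc m
        eq₄ = solve-∀

  below-H : ∀ {a} → a ≤ H → a * M ≤ N
  below-H a≤H = ≤-trans (*-monoˡ-≤ M a≤H) HM≤N

  H₁ H₂ H₃ H₄ H₅ : ℕ
  H₅ = 2 * (suc q * C₂ * C₁)
  H₄ = scale * C₁ + H₅
  H₃ = suc (cut * bound) + H₄
  H₂ = scale * (bound * bound + er q) + H₃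
  H₁ = 2 * (2 + c) + H₂

  H₁≤ : H₁ ≤ H
  H₁≤ = m≤n+m H₁ far-error
  H₂≤ : H₂ ≤ H
  H₂≤ = ≤-trans (m≤n+m H₂ (2 * (2 + c))) H₁≤
  H₃≤ : H₃ ≤ H
  H₃≤ = ≤-trans (m≤n+m H₃ (scale * (bound * bound + er q))) H₂≤
  H₄≤ : H₄ ≤ H
  H₄≤ = ≤-trans (m≤n+m H₄ (suc (cut * bound))) H₃≤
  H₅≤ : H₅ ≤ H
  H₅≤ = ≤-trans (m≤n+m H₅ (scale * C₁)) H₄≤

  NM≤Y : N * M ≤ Y
  NM≤Y = *-monoʳ-≤ N (≤-trans (≤-reflexive (sym (*-identityˡ M))) (*-monoˡ-≤ M (s≤s (z≤n {c′}))))

  far-error-small : far-error * (M * M) ≤ N * M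
  far-error-small = ≤-trans (≤-reflexive (sym (*-assoc far-error M M))) (*-monoˡ-≤ M (below-H (m≤m+n far-error H₁)))

  κ≤Y : κ ≤ Y
  κ≤Y = ≤-trans (*-monoˡ-≤ (M * M) (≤-trans (m≤m+n (k * k + t * k) (1 * (k * k + t * k)))
      (m≤n+m (2 * (k * k + t * k)) (er q + 2 * (ε q * (1 + q * c)))))) (≤-trans far-error-small NM≤Y)

  far-large : er q * (M * M) + 2 * (ε q * M₂ * (N + q * c * M)) + 2 * κ + N * M ≤ 2 * Y
  far-large = begin
    er q * (M * M) + 2 * (ε q * M₂ * (N + q * c * M)) + 2 * κ + N * M
      ≡⟨ cong (λ z → er q * (M * M) + 2 * z + 2 * κ + N * M) (eq₁ (ε q) M₂ N (q * c) M) ⟩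
    er q * (M * M) + 2 * (ε q * (N * M₂ + q * c * (M₂ * M))) + 2 * κ + N * M
      ≤⟨ +-monoˡ-≤ (N * M) (+-monoˡ-≤ (2 * κ) (+-monoʳ-≤ (er q * (M * M))
          (*-monoʳ-≤ 2 (*-monoʳ-≤ (ε q) (+-mono-≤ NM₂ (*-monoʳ-≤ (q * c) (*-monoˡ-≤ M M₂≤M))))))) ⟩
    er q * (M * M) + 2 * (ε q * (M * M + q * c * (M * M))) + 2 * κ + N * M
      ≡⟨ cong (_+ N * M) (eq₂ (er q) (M * M) (ε q) (q * c) (k * k + t * k)) ⟩
    far-error * (M * M) + N * M
      -- All errors of order M² fit into one `Y`, and the surplus N * M into the other.
      ≤⟨ +-mono-≤ (≤-trans far-error-small NM≤Y) NM≤Y ⟩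
    Y + Y
      ≡⟨ cong (Y +_) (sym (+-identityʳ Y)) ⟩
    2 * Y ∎
    where
    open ≤-Reasoning
    eq₁ : ∀ e L N r M → e * L * (N + r * M) ≡ e * (N * L + r * (L * M))
    eq₁ = solve-∀
    eq₂ : ∀ e MM f r g → e * MM + 2 * (f * (MM + r * MM)) + 2 * (g * MM) ≡ (e + 2 * (f * (1 + r)) + 2 * g) * MM
    eq₂ = solve-∀

  pure-large : 2 * (2 + c) * (M * M) ≤ N * M
  pure-large = ≤-trans (≤-reflexive (sym (*-assoc (2 * (2 + c)) M M)))
      (*-monoˡ-≤ M (below-H (≤-trans (m≤m+n (2 * (2 + c)) H₂) H₁≤)))

  M≤N : M ≤ N
  M≤N = ≤-trans (≤-reflexive (sym (*-identityˡ M))) (below-H {1} (≤-trans (s≤s z≤n) H₃≤))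

  large₁ : scale * (bound * bound + er q) * M ≤ N
  large₁ = below-H (≤-trans (m≤m+n (scale * (bound * bound + er q)) H₃) H₂≤)

  large₂ : cut * (bound * M) < N
  large₂ = ≤-trans (+-mono-≤ M>0 (≤-reflexive (sym (*-assoc cut bound M)))) (below-H (≤-trans (m≤m+n (suc (cut * bound)) H₄) H₃≤))

  large₃ : scale * (C₁ * M) ≤ N
  large₃ = ≤-trans (≤-reflexive (sym (*-assoc scale C₁ M))) (below-H (≤-trans (m≤m+n (scale * C₁) H₅) H₄≤))

  large₄ : 2 * (suc q * (C₂ * M) * C₁) ≤ N
  large₄ = ≤-trans (≤-reflexive (eq (suc q) C₂ M C₁)) (below-H H₅≤)
    where
    eq : ∀ a b M d → 2 * (a * (b * M) * d) ≡ 2 * (a * b * d) * M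
    eq = solve-∀

  family-bound : ∀ {F : Subset n → Set} (F? : Decidable F) → (∀ {A} → F A → ∣ A ∣ ≡ k) → 2 * (w q * # F?) ≤ D F? + 2 * Λ q
  family-bound F? sized = descent q
    (λ G? sz removal addition → LocalOptimum.local-optimal q 0<q 0<t room NM₂ κ≤Y far-large pure-large M≤N large₁ large₂ large₃ large₄ G? sz removal addition)
    (suc (D F? + 2 * (w q * (# kSubset? ∸ # F?)))) F? sized ≤-refl

-- From the supporting lines to the theorem

triangle : ℕ → ℕ
triangle zero    = 0
triangle (suc s) = s + triangle s

triangle-mono : ∀ {r s} → r ≤ s → triangle r ≤ triangle s
triangle-mono z≤n       = z≤n
triangle-mono (s≤s r≤s) = +-mono-≤ r≤s (triangle-mono r≤s)

tDisjointPairs-≤-triangle : ∀ {n} t (F : List (Subset n)) → tDisjointPairs t F ≤ triangle (length F)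
tDisjointPairs-≤-triangle t []      = z≤n
tDisjointPairs-≤-triangle t (A ∷ F) = +-mono-≤ (length-filter (λ B → ∣ A ∩ B ∣ <? t) F) (tDisjointPairs-≤-triangle t F)

-- Distinct t-sets meet in fewer than t elements, so for k = t every family attains the trivial
-- maximum and all families of one size tie.
tDisjointPairs-k≡t : ∀ {n} t (F : List (Subset n)) → Unique F → All (λ A → ∣ A ∣ ≡ t) F → triangle (length F) ≤ tDisjointPairs t F
tDisjointPairs-k≡t t []      _         _           = z≤n
tDisjointPairs-k≡t t (A ∷ F) (ne ∷ un) (∣A∣ ∷ sz) = +-mono-≤
  (≤-reflexive (cong length (sym (filter-all (λ B → ∣ A ∩ B ∣ <? t) (disjoint ne sz)))))
  (tDisjointPairs-k≡t t F un sz)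
  where
  disjoint : ∀ {G} → All (A ≢_) G → All (λ B → ∣ B ∣ ≡ t) G → All (λ B → ∣ A ∩ B ∣ < t) G
  disjoint []       []          = []
  disjoint (A≢B ∷ ne) (∣B∣ ∷ sz) = subst (∣ A ∩ _ ∣ <_) ∣B∣
      (⊈⇒∣∩∣< λ B⊆A → A≢B (sym (⊆∧∣∣≥⇒≡ B⊆A (≤-reflexive (trans ∣A∣ (sym ∣B∣)))))) ∷ disjoint ne sz

-- A sum in place of a maximum: it dominates the threshold of every slope that can occur.
thresholds : ℕ → ℕ → ℕ → ℕ
thresholds t c′ zero    = 0
thresholds t c′ (suc ℓ) = Threshold.threshold t c′ ℓ + thresholds t c′ ℓ

threshold≤ : ∀ t c′ {q ℓ} → q ≤ ℓ → Threshold.threshold t c′ q ≤ thresholds t c′ (suc ℓ)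
threshold≤ t c′ {q} {ℓ} q≤ℓ with m≤n⇒m<n∨m≡n q≤ℓ
... | inj₂ refl = m≤m+n _ _
threshold≤ t c′ {q} {suc ℓ} _ | inj₁ (s≤s q≤ℓ) = ≤-trans (threshold≤ t c′ q≤ℓ) (m≤n+m _ (Threshold.threshold t c′ (suc ℓ)))

lex-optimal : ∀ t c′ ℓ n → suc ℓ + (t + suc c′) + thresholds (suc t) c′ (suc ℓ) ≤ n →
  ∀ s → s ≤ tel (suc ℓ) (suc n ∸ suc t) (suc c′) → ∀ (F : List (Subset n)) → Unique F →
  All (λ A → ∣ A ∣ ≡ suc t + suc c′) F → length F ≡ s → tDisjointPairs (suc t) (L n (suc t + suc c′) s) ≤ tDisjointPairs (suc t) F
lex-optimal t c′ ℓ n large s s≤ F un sz len = conclude (lex-bound t ℓ n (suc c′) s (≤-trans (m≤m+n _ _) large) s≤)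
  where
  conclude : ∃[ q ] (q ≤ ℓ × LexBound n (suc t) (suc c′) s q) → tDisjointPairs (suc t) (L n (suc t + suc c′) s) ≤ tDisjointPairs
      (suc t) F
  -- At slope zero the lexicographic family has no t-disjoint pairs at all.
  conclude (zero , _ , h) = ≤-trans (≤-trans (m≤m+n _ 0) h) z≤n
  conclude (suc q , q≤ , h) = *-cancelˡ-≤ 2 (+-cancelʳ-≤ (2 * Λ (suc q)) _ _ (begin
    2 * tDisjointPairs (suc t) (L n k s) + 2 * Λ (suc q)   ≡⟨ sym (*-distribˡ-+ 2 (tDisjointPairs (suc t) (L n k s)) (Λ (suc q))) ⟩
    2 * (tDisjointPairs (suc t) (L n k s) + Λ (suc q))     ≤⟨ *-monoʳ-≤ 2
        (subst (λ z → tDisjointPairs (suc t) (L n k s) + z ≤ w (suc q) * s) (sym (Λ≡lam (suc q))) h) ⟩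
    2 * (w (suc q) * s)                                    ≤⟨ *-monoʳ-≤ 2
        (*-monoʳ-≤ (w (suc q)) (≤-trans (≤-reflexive (sym len)) (length-≤-# F un))) ⟩
    2 * (w (suc q) * # (_∈ₗ? F))                            ≤⟨ family-bound (_∈ₗ? F) (All.lookup sz) ⟩
    D (_∈ₗ? F) + 2 * Λ (suc q)                              ≤⟨ +-monoˡ-≤ (2 * Λ (suc q)) (D-≤-tDisjointPairs F sz) ⟩
    2 * tDisjointPairs (suc t) F + 2 * Λ (suc q)           ∎))
    where
    open ≤-Reasoning
    open Stars n (suc t) (suc c′)
    open Descent n (suc t) c′
    open Asymptotic n (suc t) c′ (suc q) z<s z<s
        (≤-trans (threshold≤ (suc t) c′ q≤) (≤-trans (m≤n+m _ (suc ℓ + (t + suc c′))) large)) using (family-bound)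

-- The difference of binomials in the range of s telescopes to the size of the union of the first ℓ
-- stars.
range⇒tel : ∀ t ℓ c n s → ℓ + t ≤ n → s ≤ ((n + 1 ∸ t) C (t + c + 1 ∸ t)) ∸ ((n + 1 ∸ t ∸ ℓ) C (t + c + 1 ∸ t)) → s ≤ tel ℓ
    (suc n ∸ t) c
range⇒tel t ℓ c n s room s≤ = ≤-trans s≤ (≤-reflexive (begin-equality
  ((n + 1 ∸ t) C (t + c + 1 ∸ t)) ∸ ((n + 1 ∸ t ∸ ℓ) C (t + c + 1 ∸ t))
    ≡⟨ cong₂ (λ a b → (a C b) ∸ ((a ∸ ℓ) C b)) (cong (_∸ t) (+-comm n 1))
        (trans (cong (_∸ t) (trans (+-assoc t c 1) (cong (t +_) (+-comm c 1)))) (m+n∸m≡n t (suc c))) ⟩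
  (y C suc c) ∸ ((y ∸ ℓ) C suc c)                         ≡⟨ cong₂ _∸_ (sym (bin≡C y (suc c))) (sym (bin≡C (y ∸ ℓ) (suc c))) ⟩
  bin y (suc c) ∸ bin (y ∸ ℓ) (suc c)                     ≡⟨ cong (_∸ bin (y ∸ ℓ) (suc c))
      (sym (tel-sum ℓ y c (m+n≤o⇒m≤o∸n ℓ (≤-trans room (n≤1+n n))))) ⟩
  tel ℓ y c + bin (y ∸ ℓ) (suc c) ∸ bin (y ∸ ℓ) (suc c)   ≡⟨ m+n∸n≡m (tel ℓ y c) (bin (y ∸ ℓ) (suc c)) ⟩
  tel ℓ y c                                               ∎))
  where
  open ≤-Reasoning
  y = suc n ∸ t

theorem1p8 : (k t ℓ : ℕ) → NonZero k → NonZero t → NonZero ℓ →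
    ∃[ n₂ ] ∀ (n : ℕ) → n ≥ n₂ →
    ∀ (s : ℕ) → s ≤ ((n + 1 ∸ t) C (k + 1 ∸ t)) ∸ ((n + 1 ∸ t ∸ ℓ) C (k + 1 ∸ t)) →
    ∀ (F : List (Subset n)) → Unique F → All (λ A → ∣ A ∣ ≡ k) F → length F ≡ s →
    tDisjointPairs t (L n k s) ≤ tDisjointPairs t F
theorem1p8 k (suc t) (suc ℓ) _ _ _ = by-cases (suc t ≤? k)
  where
  Claim : ℕ → Set
  Claim k = ∃[ n₂ ] ∀ (n : ℕ) → n ≥ n₂ →
    ∀ (s : ℕ) → s ≤ ((n + 1 ∸ suc t) C (k + 1 ∸ suc t)) ∸ ((n + 1 ∸ suc t ∸ suc ℓ) C (k + 1 ∸ suc t)) →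
    ∀ (F : List (Subset n)) → Unique F → All (λ A → ∣ A ∣ ≡ k) F → length F ≡ s →
    tDisjointPairs (suc t) (L n k s) ≤ tDisjointPairs (suc t) F

  exact : ∀ c → suc t + c ≡ k → Claim k
  exact zero refl = 0 , λ n _ s _ F un sz len → begin
    tDisjointPairs (suc t) (L n (suc t + 0) s)    ≤⟨ tDisjointPairs-≤-triangle (suc t) (L n (suc t + 0) s) ⟩
    triangle (length (L n (suc t + 0) s))         ≤⟨ triangle-mono
        (≤-trans (≤-reflexive (length-take s (kSubsetsLex n (suc t + 0)))) (m⊓n≤m s _)) ⟩
    triangle s                                    ≡⟨ cong triangle (sym len) ⟩
    triangle (length F)                           ≤⟨ tDisjointPairs-k≡t (suc t) F un
        (All.map (λ e → trans e (+-identityʳ (suc t))) sz) ⟩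
    tDisjointPairs (suc t) F                      ∎
    where open ≤-Reasoning
  exact (suc c′) refl = suc ℓ + (t + suc c′) + thresholds (suc t) c′ (suc ℓ) , λ n large s s≤ F un sz len →
    lex-optimal t c′ ℓ n large s
      (range⇒tel (suc t) (suc ℓ) (suc c′) n s (≤-trans
          (+-monoʳ-≤ (suc ℓ) (≤-trans (m≤m+n (suc t) c′) (≤-reflexive (sym (+-suc t c′))))) (≤-trans (m≤m+n _ _) large)) s≤)
      F un sz len

  -- The lower index k + 1 - t is truncated to zero, so both binomials are 1 and their difference
  -- vanishes.
  empty : ∀ n s → k < suc t → s ≤ ((n + 1 ∸ suc t) C (k + 1 ∸ suc t)) ∸ ((n + 1 ∸ suc t ∸ suc ℓ) C (k + 1 ∸ suc t)) → s ≡ 0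
  empty n s k<t s≤ = n≤0⇒n≡0 (≤-trans s≤ (≤-reflexive (trans
    (cong (λ z → ((n + 1 ∸ suc t) C z) ∸ ((n + 1 ∸ suc t ∸ suc ℓ) C z)) (m≤n⇒m∸n≡0 (≤-trans (≤-reflexive (+-comm k 1)) k<t)))
    (cong₂ _∸_ (sym (bin≡C (n + 1 ∸ suc t) 0)) (sym (bin≡C (n + 1 ∸ suc t ∸ suc ℓ) 0))))))

  by-cases : Dec (suc t ≤ k) → Claim k
  by-cases (yes t≤k) = let c , e = m≤n⇒∃[o]m+o≡n t≤k in exact c e
  by-cases (no t≰k)  = 0 , λ n _ s s≤ F un sz len →
    subst (λ z → tDisjointPairs (suc t) (L n k z) ≤ tDisjointPairs (suc t) F) (sym (empty n s (≰⇒> t≰k) s≤)) z≤n
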